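{- For every integer $k \ge 1$, every $(2k+2)$-regular graph is antimagic.
   Context: Graphs are finite and simple. For a graph $G=(V,E)$ and a bijection $f: E \to \{1,2,\ldots,|E|\}$, the vertex-sum at a vertex $u$ is $\varphi_f(u)=\sum_{e \in E(u)} f(e)$, where $E(u)$ is the set of edges incident to $u$. The bijection $f$ is an antimagic labeling if $\varphi_f(u) \ne \varphi_f(v)$ for any two distinct vertices $u,v$ of $G$, and $G$ is antimagic if it has an antimagic labeling. -}

module Defs where

open import Data.Nat using (ℕ; zero; suc; _+_; _*_; _<_)
open import Data.Fin using (Fin; toℕ)
open import Data.Fin.Properties using (_≟_)
open import Data.Product using (_×_; _,_; proj₁; proj₂; Σ)
open import Data.Sum using (_⊎_)
open import Data.Bool using (Bool; true; false; if_then_else_; _∨_)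
open import Relation.Nullary.Decidable using (⌊_⌋)
open import Relation.Binary.PropositionalEquality using (_≡_)
open import Relation.Nullary using (¬_)
open import Function.Bundles using (_⤖_; Bijection)

Σ-Fin : (m : ℕ) → (Fin m → ℕ) → ℕ
Σ-Fin zero    g = 0
Σ-Fin (suc m) g = g Fin.zero + Σ-Fin m (λ i → g (Fin.suc i))

-- A finite simple graph on vertex set Fin n with edge set indexed by Fin m.
-- Each edge is an unordered pair {u , v} with u ≠ v (no loops), and distinct
-- edge indices give distinct unordered pairs (no multiple edges).
record Graph : Set where
  field
    n     : ℕ
    m     : ℕ
    ends  : Fin m → Fin n × Fin n
    loopless : ∀ e → ¬ (proj₁ (ends e) ≡ proj₂ (ends e))
    simple   : ∀ e e′ →
      (proj₁ (ends e) ≡ proj₁ (ends e′) × proj₂ (ends e) ≡ proj₂ (ends e′)) ⊎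
      (proj₁ (ends e) ≡ proj₂ (ends e′) × proj₂ (ends e) ≡ proj₁ (ends e′)) →
      e ≡ e′

  incident : Fin m → Fin n → Bool
  incident e u = ⌊ proj₁ (ends e) ≟ u ⌋ ∨ ⌊ proj₂ (ends e) ≟ u ⌋

  degree : Fin n → ℕ
  degree u = Σ-Fin m (λ e → if incident e u then 1 else 0)

  -- vertex-sum φ_f(u) = Σ_{e ∈ E(u)} f(e), where the label of edge e is
  -- toℕ (f e) + 1 ∈ {1,…,m}.
  vertexSum : (Fin m → Fin m) → Fin n → ℕ
  vertexSum f u = Σ-Fin m (λ e → if incident e u then suc (toℕ (f e)) else 0)

open Graph public

Regular : ℕ → Graph → Set
Regular d G = ∀ u → degree G u ≡ d

-- f : E → {1,…,|E|} bijection, with label of e = toℕ (Func.to f e) + 1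
IsAntimagicLabeling : (G : Graph) → (Fin (m G) ⤖ Fin (m G)) → Set
IsAntimagicLabeling G f =
  ∀ u v → ¬ (u ≡ v) → ¬ (vertexSum G (Bijection.to f) u ≡ vertexSum G (Bijection.to f) v)

Antimagic : Graph → Set
Antimagic G = Σ (Fin (m G) ⤖ Fin (m G)) (IsAntimagicLabeling G)

{-# OPTIONS --safe #-}
module Submission where

-- The edges are labelled level by level of a breadth-first search, the farthest level first, so
-- that every vertex sum is smaller than all those of the previous level.  It is enough to label
-- the edges B between two consecutive levels such that the sums at the lower level become
-- distinct and stay below those at the upper one.  Each lower vertex keeps one edge σ for the
-- end, when these edges receive the largest labels in an order depending on the sums so far.
-- The other edges are paired at common end points; a pair gets the labels j and S - j, and the
-- pairs are ordered along trails, so that the sums at the other end points are balanced too.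
--
-- Critical are the full lower vertices, with all 2k + 2 edges in B, against the heavy upper
-- ones, which have all but one edge in B but no edge σ.  Augmenting paths show that the heavy
-- vertices missed by the edges σ can be covered by p further edges τ at distinct full vertices,
-- where (2k + 1) p is at most the number of full vertices.  The edges τ precede the edges σ.
-- The case p ≤ 1 is settled by sorting.  If p ≥ 2, the full vertices are balanced exactly up to
-- one edge each, and there are enough of them to make their sums distinct while keeping the
-- largest one close to the average.

-- Away from the roots, an upper vertex has an edge outside `B`, whose label outweighs that of any
-- edge σ. This leaves `2 * k + 1` labels on each side, compared as `k` pairs of constant sum and
-- one odd label. At the upper vertex the odd label has to lie above the paired ones: it comes from
-- a second edge outside `B`, from σ or from τ. So only heavy vertices missed by σ need an edge τ.
-- They can be covered by counting, because a heavy vertex sends `2 * k + 1` edges down and a lower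
-- vertex receives at most `2 * k + 2`. The pairing balances only one side exactly; the other keeps
-- an error of up to `2 * k`. With several τ, their own labels must make up for it, which amounts to
-- `p + 2 * k ≤ h + 2` for `2 * h + 1` leftover edges at full vertices. This follows from
-- `(2 * k - 1) * (p - 2) ≥ 0`, whence the division at `p = 2`. There the bound can be attained, and
-- the smallest label of a τ may be one too small; this is why orderings have no deficit at one
-- prescribed vertex `w₀`.

open import Data.Nat using (ℕ; zero; suc; _+_; _*_; _∸_; _≤_; _<_; _≥_; z≤n; s≤s; _<?_; _≤?_)
import Data.Nat as ℕ
open import Data.Nat.Properties hiding (_≟_)
open import Data.Nat.Tactic.RingSolver using (solve-∀)
open import Data.Bool using (Bool; true; false; not; _xor_; _∧_; if_then_else_)
open import Data.Bool.Properties using (∧-comm; xor-comm; xor-assoc; xor-same; xor-identityʳ; xor-annihilates-not; not-distribˡ-xor; not-distribʳ-xor)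
open import Data.List using (List; []; _∷_; _++_; length; map; reverse; [_]; filter; take; drop; tabulate; allFin)
open import Data.List.Properties using (length-++; length-reverse; unfold-reverse; ++-assoc; length-map; take++drop≡id; length-drop; ∷-injectiveˡ; ∷-injectiveʳ; filter-all; filter-notAll; length-tabulate)
open import Data.List.Relation.Unary.All using (All; []; _∷_)
import Data.List.Relation.Unary.All as All
import Data.List.Relation.Unary.All.Properties as Allₚ
open import Data.List.Relation.Unary.Any using (Any; here; there; any?)
open import Data.List.Relation.Unary.AllPairs as AllPairs using (AllPairs; []; _∷_)
import Data.List.Relation.Unary.AllPairs.Properties as AllPairsₚ
open import Data.List.Relation.Unary.Unique.Propositional using (Unique)
import Data.List.Relation.Unary.Unique.Propositional.Properties as Uniqueₚ
open import Data.List.Membership.Propositional using (_∈_; _∉_; find; lose)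
open import Data.List.Membership.Propositional.Properties using (∈-++⁻; ∈-++⁺ˡ; ∈-++⁺ʳ; ∈-filter⁺; ∈-filter⁻; ∈-map⁺; ∈-allFin)
open import Data.List.Relation.Binary.Permutation.Propositional using (_↭_; ↭-refl; ↭-sym; ↭-trans; prep; swap; refl; trans)
open import Data.List.Relation.Binary.Permutation.Propositional.Properties using (All-resp-↭; ∈-resp-↭; ↭-length; ↭-reverse; shift; ++-comm; ++⁺; ++⁺ˡ; ++⁺ʳ)
open import Data.Product using (_×_; _,_; proj₁; proj₂; Σ-syntax; ∃-syntax)
open import Data.Sum using (_⊎_; inj₁; inj₂; [_,_]′)
open import Data.Empty using (⊥; ⊥-elim)
open import Relation.Nullary using (¬_; Dec; yes; no; ⌊_⌋; _×-dec_; _⊎-dec_; ¬?)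
open import Relation.Binary.Definitions using (DecidableEquality; tri<; tri≈; tri>)
open import Relation.Binary.PropositionalEquality as Eq using (_≡_; _≢_; refl; sym; cong; cong₂; subst; subst₂; module ≡-Reasoning)

-- Finite sums and labelled lists

-- c ≤ d is a sum of hypotheses; the two equations are left to the ring solver.
lin : ∀ x {a b c d} → c ≤ d → a + x ≡ c → d ≡ b + x → a ≤ b
lin x {a} {b} c≤d p q = +-cancelʳ-≤ x a b (subst₂ _≤_ (sym p) q c≤d)

Σl : ∀ {A : Set} → (A → ℕ) → List A → ℕ
Σl f []       = 0
Σl f (x ∷ xs) = f x + Σl f xs

Σl-++ : ∀ {A : Set} (f : A → ℕ) xs ys → Σl f (xs ++ ys) ≡ Σl f xs + Σl f ys
Σl-++ f []       ys = refl
Σl-++ f (x ∷ xs) ys = Eq.trans (cong (f x +_) (Σl-++ f xs ys)) (sym (+-assoc (f x) _ _))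

Σl-↭ : ∀ {A : Set} (f : A → ℕ) {xs ys} → xs ↭ ys → Σl f xs ≡ Σl f ys
Σl-↭ f refl           = refl
Σl-↭ f (prep x p)     = cong (f x +_) (Σl-↭ f p)
Σl-↭ f (swap {xs} {ys} x y p) rewrite Σl-↭ f p = l (f x) (f y) (Σl f ys)
  where
  l : ∀ a b c → a + (b + c) ≡ b + (a + c)
  l = solve-∀
Σl-↭ f (trans p q)    = Eq.trans (Σl-↭ f p) (Σl-↭ f q)

Σl-cong : ∀ {A : Set} {f g : A → ℕ} {xs} → All (λ x → f x ≡ g x) xs → Σl f xs ≡ Σl g xs
Σl-cong []       = refl
Σl-cong (p ∷ ps) = cong₂ _+_ p (Σl-cong ps)

Σl-cong′ : ∀ {A : Set} {f g : A → ℕ} → (∀ x → f x ≡ g x) → ∀ xs → Σl f xs ≡ Σl g xs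
Σl-cong′ p xs = Σl-cong (All.universal p xs)

Σl-mono : ∀ {A : Set} {f g : A → ℕ} {xs} → All (λ x → f x ≤ g x) xs → Σl f xs ≤ Σl g xs
Σl-mono []       = z≤n
Σl-mono (p ∷ ps) = +-mono-≤ p (Σl-mono ps)

Σl-zero : ∀ {A : Set} (xs : List A) → Σl (λ _ → 0) xs ≡ 0
Σl-zero []       = refl
Σl-zero (x ∷ xs) = Σl-zero xs

Σl-one : ∀ {A : Set} (xs : List A) → Σl (λ _ → 1) xs ≡ length xs
Σl-one []       = refl
Σl-one (x ∷ xs) = cong suc (Σl-one xs)

Σl-+ : ∀ {A : Set} (f g : A → ℕ) xs → Σl (λ x → f x + g x) xs ≡ Σl f xs + Σl g xs
Σl-+ f g []       = refl
Σl-+ f g (x ∷ xs) rewrite Σl-+ f g xs = l (f x) (g x) (Σl f xs) (Σl g xs)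
  where
  l : ∀ a b c d → a + b + (c + d) ≡ a + c + (b + d)
  l = solve-∀

Σl-* : ∀ {A : Set} c (f : A → ℕ) xs → Σl (λ x → c * f x) xs ≡ c * Σl f xs
Σl-* c f []       = sym (*-zeroʳ c)
Σl-* c f (x ∷ xs) = Eq.trans (cong (c * f x +_) (Σl-* c f xs)) (sym (*-distribˡ-+ c (f x) _))

Σl-map : ∀ {A B : Set} (f : B → ℕ) (h : A → B) xs → Σl f (map h xs) ≡ Σl (λ x → f (h x)) xs
Σl-map f h []       = refl
Σl-map f h (x ∷ xs) = cong (f (h x) +_) (Σl-map f h xs)

Σl-swap : ∀ {A B : Set} (f : A → B → ℕ) xs ys → Σl (λ x → Σl (f x) ys) xs ≡ Σl (λ y → Σl (λ x → f x y) xs) ys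
Σl-swap f []       ys = sym (Σl-zero ys)
Σl-swap f (x ∷ xs) ys =
  Eq.trans (cong (Σl (f x) ys +_) (Σl-swap f xs ys)) (sym (Σl-+ (f x) (λ y → Σl (λ z → f z y) xs) ys))

-- The sum of g over a list whose i-th entry (counted from 1) carries the label s + i.
lab : ∀ {A : Set} → (A → ℕ) → ℕ → List A → ℕ
lab g s []       = 0
lab g s (x ∷ xs) = g x * suc s + lab g (suc s) xs

lab-++ : ∀ {A : Set} (g : A → ℕ) s xs ys → lab g s (xs ++ ys) ≡ lab g s xs + lab g (s + length xs) ys
lab-++ g s []       ys rewrite +-identityʳ s = refl
lab-++ g s (x ∷ xs) ys rewrite +-suc s (length xs) | lab-++ g (suc s) xs ys =
  sym (+-assoc (g x * suc s) _ _)

lab-shift : ∀ {A : Set} (g : A → ℕ) s t xs → lab g (s + t) xs ≡ lab g s xs + t * Σl g xs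
lab-shift g s t []       = sym (*-zeroʳ t)
lab-shift g s t (x ∷ xs) rewrite lab-shift g (suc s) t xs = l (g x) s t (lab g (suc s) xs) (Σl g xs)
  where
  l : ∀ a s t b c → a * suc (s + t) + (b + t * c) ≡ a * suc s + b + t * (a + c)
  l = solve-∀

lab-≥ : ∀ {A : Set} (g : A → ℕ) s xs → Σl g xs * suc s ≤ lab g s xs
lab-≥ g s []       = z≤n
lab-≥ g s (x ∷ xs) = begin
  (g x + Σl g xs) * suc s           ≡⟨ *-distribʳ-+ (suc s) (g x) _ ⟩
  g x * suc s + Σl g xs * suc s     ≤⟨ +-monoʳ-≤ (g x * suc s) (*-monoʳ-≤ (Σl g xs) (n≤1+n (suc s))) ⟩
  g x * suc s + Σl g xs * suc (suc s) ≤⟨ +-monoʳ-≤ (g x * suc s) (lab-≥ g (suc s) xs) ⟩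
  g x * suc s + lab g (suc s) xs    ∎
  where open ≤-Reasoning

lab-≤ : ∀ {A : Set} (g : A → ℕ) s xs → lab g s xs ≤ Σl g xs * (s + length xs)
lab-≤ g s []       = z≤n
lab-≤ g s (x ∷ xs) = begin
  g x * suc s + lab g (suc s) xs                ≤⟨ +-mono-≤ (*-monoʳ-≤ (g x) (s≤s (m≤m+n s (length xs)))) (lab-≤ g (suc s) xs) ⟩
  g x * suc (s + length xs) + Σl g xs * (suc s + length xs) ≡⟨ sym (*-distribʳ-+ (suc (s + length xs)) (g x) _) ⟩
  (g x + Σl g xs) * suc (s + length xs)         ≡⟨ cong ((g x + Σl g xs) *_) (sym (+-suc s _)) ⟩
  (g x + Σl g xs) * (s + suc (length xs))       ∎
  where open ≤-Reasoning

lab-cong : ∀ {A : Set} {g h : A → ℕ} {xs} s → All (λ x → g x ≡ h x) xs → lab g s xs ≡ lab h s xs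
lab-cong s []       = refl
lab-cong s (p ∷ ps) = cong₂ _+_ (cong (_* suc s) p) (lab-cong (suc s) ps)

lab-map : ∀ {A B : Set} (g : B → ℕ) (h : A → B) s xs → lab g s (map h xs) ≡ lab (λ x → g (h x)) s xs
lab-map g h s []       = refl
lab-map g h s (x ∷ xs) = cong (g (h x) * suc s +_) (lab-map g h (suc s) xs)

lab-0 : ∀ {A : Set} (g : A → ℕ) s xs → Σl g xs ≡ 0 → lab g s xs ≡ 0
lab-0 g s xs p = n≤0⇒n≡0 (subst (λ z → lab g s xs ≤ z * (s + length xs)) p (lab-≤ g s xs))

-- The entry at position `i` of `n` stands at position `n + 1 - i` of the reversal, so its two
-- labels add up to `s + n + 1`.
lab-reverse : ∀ {A : Set} (g : A → ℕ) s xs → lab g s (reverse xs) + lab g 0 xs ≡ (s + suc (length xs)) * Σl g xs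
lab-reverse g s []       = sym (*-zeroʳ (s + 1))
lab-reverse g s (x ∷ xs) = begin
  lab g s (reverse (x ∷ xs)) + (g x * 1 + lab g 1 xs)
    ≡⟨ cong₂ (λ u v → u + (g x * 1 + v))
         (Eq.trans (cong (lab g s) (unfold-reverse x xs)) (lab-++ g s (reverse xs) [ x ]))
         (lab-shift g 0 1 xs) ⟩
  lab g s (reverse xs) + (g x * suc (s + length (reverse xs)) + 0) + (g x * 1 + (lab g 0 xs + 1 * Σl g xs))
    ≡⟨ cong (λ n → lab g s (reverse xs) + (g x * suc (s + n) + 0) + (g x * 1 + (lab g 0 xs + 1 * Σl g xs))) (length-reverse xs) ⟩
  lab g s (reverse xs) + (g x * suc (s + length xs) + 0) + (g x * 1 + (lab g 0 xs + 1 * Σl g xs))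
    ≡⟨ l₁ (lab g s (reverse xs)) (g x) (s + length xs) (lab g 0 xs) (Σl g xs) ⟩
  (lab g s (reverse xs) + lab g 0 xs) + (g x * (suc (s + length xs) + 1) + Σl g xs)
    ≡⟨ cong (_+ (g x * (suc (s + length xs) + 1) + Σl g xs)) (lab-reverse g s xs) ⟩
  (s + suc (length xs)) * Σl g xs + (g x * (suc (s + length xs) + 1) + Σl g xs)
    ≡⟨ l₂ s (length xs) (g x) (Σl g xs) ⟩
  (s + suc (suc (length xs))) * (g x + Σl g xs) ∎
  where
  open ≡-Reasoning
  l₁ : ∀ a b c d e → a + (b * suc c + 0) + (b * 1 + (d + 1 * e)) ≡ (a + d) + (b * (suc c + 1) + e)
  l₁ = solve-∀
  l₂ : ∀ s n a b → (s + suc n) * b + (a * (suc (s + n) + 1) + b) ≡ (s + suc (suc n)) * (a + b)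
  l₂ = solve-∀

lab-+ : ∀ {A : Set} (f g : A → ℕ) s xs → lab (λ x → f x + g x) s xs ≡ lab f s xs + lab g s xs
lab-+ f g s []       = refl
lab-+ f g s (x ∷ xs) rewrite lab-+ f g (suc s) xs = l (f x) (g x) (suc s) (lab f (suc s) xs) (lab g (suc s) xs)
  where
  l : ∀ a b s c d → (a + b) * s + (c + d) ≡ a * s + c + (b * s + d)
  l = solve-∀

Unique-↭ : ∀ {A : Set} {xs ys : List A} → xs ↭ ys → Unique xs → Unique ys
Unique-↭ refl         u                   = u
Unique-↭ (prep x p)   (h ∷ u)             = All-resp-↭ p h ∷ Unique-↭ p u
Unique-↭ (swap x y p) ((h ∷ hs) ∷ k ∷ u)  = ((λ q → h (sym q)) ∷ All-resp-↭ p k) ∷ All-resp-↭ p hs ∷ Unique-↭ p u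
Unique-↭ (trans p q)  u                   = Unique-↭ q (Unique-↭ p u)

-- Balanced orderings from trail decompositions

flip : ∀ {A : Set} → A × A → A × A
flip (a , b) = b , a

flat : ∀ {A : Set} → List (A × A) → List A
flat []            = []
flat ((a , b) ∷ P) = a ∷ b ∷ flat P

infix 4 _≈_

-- Rearrangement in which single pairs may also be turned round: neither the order of the pairs nor
-- the choice of the edge with the smaller label is fixed in advance.
data _≈_ {A : Set} : List (A × A) → List (A × A) → Set where
  done  : [] ≈ []
  keep  : ∀ {P Q} a → P ≈ Q → a ∷ P ≈ a ∷ Q
  turn  : ∀ {P Q} a → P ≈ Q → a ∷ P ≈ flip a ∷ Q
  exch  : ∀ {P} a b → a ∷ b ∷ P ≈ b ∷ a ∷ P
  trans : ∀ {P Q R} → P ≈ Q → Q ≈ R → P ≈ R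

module _ {A : Set} where

  ≈-refl : (P : List (A × A)) → P ≈ P
  ≈-refl []      = done
  ≈-refl (a ∷ P) = keep a (≈-refl P)

  ≈-++ : ∀ {P Q P′ Q′ : List (A × A)} → P ≈ Q → P′ ≈ Q′ → P ++ P′ ≈ Q ++ Q′
  ≈-++ {P′ = P′} {Q′ = Q′} p q = trans (right p) (left _ q)
    where
    right : ∀ {P Q} → P ≈ Q → P ++ P′ ≈ Q ++ P′
    right done        = ≈-refl P′
    right (keep a p)  = keep a (right p)
    right (turn a p)  = turn a (right p)
    right (exch a b)  = exch a b
    right (trans p q) = trans (right p) (right q)
    left : ∀ P → P′ ≈ Q′ → P ++ P′ ≈ P ++ Q′
    left []      q = q
    left (a ∷ P) q = keep a (left P q)

  ↭⇒≈ : ∀ {P Q : List (A × A)} → P ↭ Q → P ≈ Q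
  ↭⇒≈ refl         = ≈-refl _
  ↭⇒≈ (prep x p)   = keep x (↭⇒≈ p)
  ↭⇒≈ (swap x y p) = trans (exch x y) (keep y (keep x (↭⇒≈ p)))
  ↭⇒≈ (trans p q)  = trans (↭⇒≈ p) (↭⇒≈ q)

  flips : (P : List (A × A)) → P ≈ map flip P
  flips []      = done
  flips (a ∷ P) = turn a (flips P)

  ≈-flat : ∀ {P Q : List (A × A)} → P ≈ Q → flat P ↭ flat Q
  ≈-flat done                     = refl
  ≈-flat (keep (x , y) p)         = prep x (prep y (≈-flat p))
  ≈-flat (turn (x , y) p)         = swap x y (≈-flat p)
  ≈-flat (exch (x , y) (z , w))   = ++⁺ʳ _ (++-comm (x ∷ y ∷ []) (z ∷ w ∷ []))
  ≈-flat (trans p q)              = trans (≈-flat p) (≈-flat q)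

  ≈-sum : ∀ (F : A × A → ℕ) → (∀ a → F (flip a) ≡ F a) → ∀ {P Q} → P ≈ Q → Σl F P ≡ Σl F Q
  ≈-sum F s done        = refl
  ≈-sum F s (keep a p)  = cong (F a +_) (≈-sum F s p)
  ≈-sum F s (turn a p)  = cong₂ _+_ (sym (s a)) (≈-sum F s p)
  ≈-sum F s (exch {P} a b) = l (F a) (F b) (Σl F P)
    where
    l : ∀ x y z → x + (y + z) ≡ y + (x + z)
    l = solve-∀
  ≈-sum F s (trans p q) = Eq.trans (≈-sum F s p) (≈-sum F s q)

  ≈-All : ∀ {R : A × A → Set} → (∀ a → R a → R (flip a)) → ∀ {P Q} → P ≈ Q → All R P → All R Q
  ≈-All s done        h             = h
  ≈-All s (keep a p)  (x ∷ h)       = x ∷ ≈-All s p h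
  ≈-All s (turn a p)  (x ∷ h)       = s a x ∷ ≈-All s p h
  ≈-All s (exch a b)  (x ∷ y ∷ h)   = y ∷ x ∷ h
  ≈-All s (trans p q) h             = ≈-All s q (≈-All s p h)

  ≈-length : ∀ {P Q : List (A × A)} → P ≈ Q → length P ≡ length Q
  ≈-length {P} {Q} p = Eq.trans (sym (Σl-one P)) (Eq.trans (≈-sum (λ _ → 1) (λ _ → refl) p) (Σl-one Q))

  ∷-≈-++ : ∀ a (P Q : List (A × A)) → a ∷ (P ++ Q) ≈ P ++ a ∷ Q
  ∷-≈-++ a []      Q = ≈-refl _
  ∷-≈-++ a (b ∷ P) Q = trans (exch a b) (keep b (∷-≈-++ a P Q))

  ++-≈-comm : ∀ (P Q : List (A × A)) → P ++ Q ≈ Q ++ P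
  ++-≈-comm P Q = ↭⇒≈ (++-comm P Q)

bit : Bool → ℕ
bit b = if b then 1 else 0

bit≤1 : ∀ b → bit b ≤ 1
bit≤1 true  = ≤-refl
bit≤1 false = z≤n

xor-move : ∀ a q p → p ≡ (a xor q) → q ≡ (a xor p)
xor-move true  true  _ refl = refl
xor-move true  false _ refl = refl
xor-move false q     _ refl = refl

xor-replace : ∀ u v w p → (((u xor v) xor p) xor (v xor w)) ≡ (p xor (u xor w))
xor-replace true  true  w p = refl
xor-replace true  false w p = Eq.trans (sym (not-distribˡ-xor p w)) (not-distribʳ-xor p w)
xor-replace false true  w p = xor-annihilates-not p w
xor-replace false false w p = refl

module Delta {W : Set} (_≟_ : DecidableEquality W) where

  eqb : W → W → Bool
  eqb a x = ⌊ a ≟ x ⌋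

  eqb-refl : ∀ x → eqb x x ≡ true
  eqb-refl x with x ≟ x
  ... | yes _ = refl
  ... | no q  = ⊥-elim (q refl)

  eqb-≢ : ∀ {a x} → a ≢ x → eqb a x ≡ false
  eqb-≢ {a} {x} p with a ≟ x
  ... | yes q = ⊥-elim (p q)
  ... | no _  = refl

  δ : W → W → ℕ
  δ a x = bit (eqb a x)

-- A pair of edges is read as an arc of a multigraph on `W`, from the `f`-end of the edge that will
-- get the smaller label to that of the other. The rank of an arc is its position in the list.
module Arcs {E W : Set} (_≟_ : DecidableEquality W) (f : E → W) where

  open Delta _≟_

  Arc : Set
  Arc = E × E

  lo hi : W → Arc → ℕ
  lo x a = δ (f (proj₁ a)) x
  hi x a = δ (f (proj₂ a)) x

  #lo #hi Deg : W → List Arc → ℕ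
  #lo x = Σl (lo x)
  #hi x = Σl (hi x)

  -- Loops do not count.
  deg : W → Arc → ℕ
  deg x a = bit (eqb (f (proj₁ a)) x xor eqb (f (proj₂ a)) x)
  Deg x = Σl (deg x)

  -- Sums of the ranks of the arcs leaving (`T`) and entering (`H`) `x`. If as many arcs leave as
  -- enter, the label sum at `x` differs from a multiple of the pair sum by exactly `T - H`.
  T H : ℕ → W → List Arc → ℕ
  T b x = lab (lo x) b
  H b x = lab (hi x) b

  par : W → List Arc → Bool
  par x []      = false
  par x (a ∷ P) = (eqb (f (proj₁ a)) x xor eqb (f (proj₂ a)) x) xor par x P

  par-≈ : ∀ x {P Q} → P ≈ Q → par x P ≡ par x Q
  par-≈ x done        = refl
  par-≈ x (keep a p)  = cong ((eqb (f (proj₁ a)) x xor eqb (f (proj₂ a)) x) xor_) (par-≈ x p)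
  par-≈ x (turn a p)  = cong₂ _xor_ (xor-comm (eqb (f (proj₁ a)) x) _) (par-≈ x p)
  par-≈ x (exch {P} a b) = c (eqb (f (proj₁ a)) x xor eqb (f (proj₂ a)) x) (eqb (f (proj₁ b)) x xor eqb (f (proj₂ b)) x) (par x P)
    where
    c : ∀ u v w → (u xor (v xor w)) ≡ (v xor (u xor w))
    c u v w = Eq.trans (sym (xor-assoc u v w)) (Eq.trans (cong (_xor w) (xor-comm u v)) (xor-assoc v u w))
  par-≈ x (trans p q) = Eq.trans (par-≈ x p) (par-≈ x q)

  par-++ : ∀ x P Q → par x (P ++ Q) ≡ (par x P xor par x Q)
  par-++ x []      Q = refl
  par-++ x (a ∷ P) Q rewrite par-++ x P Q = sym (xor-assoc (eqb (f (proj₁ a)) x xor eqb (f (proj₂ a)) x) (par x P) (par x Q))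

  deg-flip : ∀ x a → deg x (flip a) ≡ deg x a
  deg-flip x (l , h) = cong bit (xor-comm (eqb (f h) x) (eqb (f l) x))

  Deg-≈ : ∀ x {P Q} → P ≈ Q → Deg x P ≡ Deg x Q
  Deg-≈ x = ≈-sum (deg x) (deg-flip x)

  Deg≤length : ∀ x P → Deg x P ≤ length P
  Deg≤length x []      = z≤n
  Deg≤length x (a ∷ P) = +-mono-≤ (bit≤1 _) (Deg≤length x P)

  Deg≤# : ∀ x P → Deg x P ≤ #lo x P + #hi x P
  Deg≤# x []      = z≤n
  Deg≤# x ((l , h) ∷ P) with eqb (f l) x | eqb (f h) x | Deg≤# x P
  ... | true  | true  | r = ≤-trans r (≤-trans (+-mono-≤ (n≤1+n _) (n≤1+n _)) ≤-refl)
  ... | true  | false | r = s≤s r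
  ... | false | true  | r = ≤-trans (s≤s r) (≤-reflexive (sym (+-suc _ _)))
  ... | false | false | r = r

  -- Loops do not change the parity at their vertex, so an odd vertex has an arc that is no loop; it
  -- is reversed if it ends there.
  arcAt : ∀ x P → par x P ≡ true →
          Σ[ l ∈ E ] Σ[ h ∈ E ] Σ[ Q ∈ List Arc ] (P ≈ (l , h) ∷ Q × f l ≡ x × f h ≢ x)
  arcAt x ((l , h) ∷ P) o with f l ≟ x | f h ≟ x
  ... | yes p | no q  = l , h , P , ≈-refl _ , p , q
  ... | no p  | yes q = h , l , P , turn _ (≈-refl _) , q , p
  ... | yes _ | yes _ = let l′ , h′ , Q , e , p , q = arcAt x P o
                        in l′ , h′ , (l , h) ∷ Q , trans (keep _ e) (exch _ _) , p , q
  ... | no _  | no _  = let l′ , h′ , Q , e , p , q = arcAt x P o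
                        in l′ , h′ , (l , h) ∷ Q , trans (keep _ e) (exch _ _) , p , q

  T-flip : ∀ b x P → T b x (map flip P) ≡ H b x P
  T-flip b x = lab-map (lo x) flip b

  H-flip : ∀ b x P → H b x (map flip P) ≡ T b x P
  H-flip b x = lab-map (hi x) flip b

  #lo-flip : ∀ x P → #lo x (map flip P) ≡ #hi x P
  #lo-flip x = Σl-map (lo x) flip

  #hi-flip : ∀ x P → #hi x (map flip P) ≡ #lo x P
  #hi-flip x = Σl-map (hi x) flip

  -- At every passage the leaving arc has the larger rank, so `ranks` is in favour of `T`. Only the
  -- last arc, of rank `b + length trail`, has no successor and is compensated at `end`.
  record Trail (P : List Arc) (y : W) : Set where
    field
      rest trail : List Arc
      end        : W
      end≢y      : end ≢ y
      split      : P ≈ rest ++ trail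
      nonempty   : 0 < length trail
      odd-end    : par end P ≡ true
      par-rest   : ∀ x → par x rest ≡ (par x P xor (eqb y x xor eqb end x))
      count      : ∀ x → #lo x trail + δ end x ≡ #hi x trail + δ y x
      ranks      : ∀ b x → H b x trail + δ y x * suc b ≤ T b x trail + δ end x * (b + length trail)

  -- The walk stops as soon as the vertex just entered is even in the remaining arcs; such a vertex
  -- was odd before. At any other vertex an arc is left to go on.
  walk : ∀ n P y → length P ≤ n → par y P ≡ true → Trail P y
  walk n P y len odd with arcAt y P odd
  walk zero    P y len odd | l , h , Q , e , refl , h≢ with () ← ≤-trans (≤-reflexive (sym (≈-length e))) len
  walk (suc n) P y len odd | l , h , Q , e , refl , h≢ = go (par (f h) Q) refl
    where
    parP : ∀ x → par x P ≡ ((eqb (f l) x xor eqb (f h) x) xor par x Q)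
    parP x = par-≈ x e
    x3 : ∀ u v p q → p ≡ ((u xor v) xor q) → q ≡ (p xor (u xor v))
    x3 u v p q i = Eq.trans (xor-move (u xor v) q p i) (xor-comm (u xor v) p)
    go : ∀ b → par (f h) Q ≡ b → Trail P (f l)
    go false ev = record
      { rest = Q ; trail = (l , h) ∷ [] ; end = f h ; end≢y = h≢
      ; split = trans e (∷-≈-++ _ [] _ ⨾ ++-≈-comm ((l , h) ∷ []) Q)
      ; nonempty = s≤s z≤n
      ; odd-end = Eq.trans (parP (f h)) (oe (eqb-≢ (λ q → h≢ (sym q))) (eqb-refl (f h)) ev)
      ; par-rest = λ x → x3 (eqb (f l) x) (eqb (f h) x) _ _ (parP x)
      ; count = λ x → c (δ (f l) x) (δ (f h) x)
      ; ranks = λ b x → ≤-reflexive (r (δ (f l) x) (δ (f h) x) b) }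
      where
      infixr 5 _⨾_
      _⨾_ : ∀ {P Q R : List Arc} → P ≈ Q → Q ≈ R → P ≈ R
      _⨾_ = trans
      oe : ∀ {u v w} → u ≡ false → v ≡ true → w ≡ false → ((u xor v) xor w) ≡ true
      oe refl refl refl = refl
      c : ∀ u v → u + 0 + v ≡ v + 0 + u
      c = solve-∀
      r : ∀ u v b → v * suc b + 0 + u * suc b ≡ u * suc b + 0 + v * (b + 1)
      r = solve-∀
    go true od with walk n Q (f h) (≤-pred (≤-trans (≤-reflexive (sym (≈-length e))) len)) od
    ... | t = record
      { rest = rest ; trail = (l , h) ∷ trail ; end = end ; end≢y = end≢l
      ; split = trans e (trans (keep _ split) (∷-≈-++ _ rest trail))
      ; nonempty = s≤s z≤n
      ; odd-end = Eq.trans (parP end) (oe (eqb-≢ (λ q → end≢l (sym q))) (eqb-≢ (λ q → end≢y (sym q))) odd-end)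
      ; par-rest = λ x → x4 (eqb (f l) x) (eqb (f h) x) (eqb end x) _ _ _ (parP x) (par-rest x)
      ; count = λ x → c (δ (f l) x) (δ (f h) x) (δ end x) (#lo x trail) (#hi x trail) (count x)
      ; ranks = λ b x → r (δ (f l) x) (δ (f h) x) b (T (suc b) x trail) (H (suc b) x trail) (δ end x) (length trail) (ranks (suc b) x) }
      where
      open Trail t
      -- The odd vertex `f l` has become even in `Q`, whereas `end` is odd there.
      end≢l : end ≢ f l
      end≢l q = absurd (eqb-refl (f l)) (eqb-≢ h≢) (Eq.trans (sym (par-≈ (f l) e)) odd) (Eq.trans (cong (λ z → par z Q) (sym q)) odd-end)
        where
        absurd : ∀ {u v w} → u ≡ true → v ≡ false → ((u xor v) xor w) ≡ true → w ≡ true → ⊥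
        absurd refl refl p refl with () ← p
      oe : ∀ {u v w} → u ≡ false → v ≡ false → w ≡ true → ((u xor v) xor w) ≡ true
      oe refl refl refl = refl
      x4 : ∀ u v w p q s → p ≡ ((u xor v) xor q) → s ≡ (q xor (v xor w)) → s ≡ (p xor (u xor w))
      x4 u v w p q s i j = Eq.trans j (Eq.trans (cong (_xor (v xor w)) (xor-move (u xor v) q p i)) (xor-replace u v w p))
      c : ∀ u v w a b → a + w ≡ b + v → u + a + w ≡ v + b + u
      c u v w a b p = Eq.trans (+-assoc u a w) (Eq.trans (cong (u +_) p) (e₀ u v b))
        where
        e₀ : ∀ u v b → u + (b + v) ≡ v + b + u
        e₀ = solve-∀
      r : ∀ u v b t h w n → h + v * suc (suc b) ≤ t + w * (suc b + n) →
          (v * suc b + h) + u * suc b ≤ (u * suc b + t) + w * (b + suc n)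
      r u v b t h w n p = m+n≤o⇒m≤o _ {v} (lin 0 (+-monoʳ-≤ (u * suc b) p) (e₁ u v b h) (e₂ u b t w n))
        where
        e₁ : ∀ u v b h → v * suc b + h + u * suc b + v + 0 ≡ u * suc b + (h + v * suc (suc b))
        e₁ = solve-∀
        e₂ : ∀ u b t w n → u * suc b + (t + w * (suc b + n)) ≡ (u * suc b + t) + w * (b + suc n) + 0
        e₂ = solve-∀

  Loop NonLoop : Arc → Set
  Loop a    = f (proj₁ a) ≡ f (proj₂ a)
  NonLoop a = f (proj₁ a) ≢ f (proj₂ a)

  deg-nonloop : ∀ x a → NonLoop a → deg x a ≡ lo x a + hi x a
  deg-nonloop x (l , h) nl with f l ≟ x | f h ≟ x
  ... | yes p | yes q = ⊥-elim (nl (Eq.trans p (sym q)))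
  ... | yes p | no q  = refl
  ... | no p  | yes q = refl
  ... | no p  | no q  = refl

  -- An initial stretch of a closed trail has been laid: arc b lies at its end w, arc r at its
  -- older end o, where it is continued next.  Growing at the two ends alternately, the ranks
  -- of the two arcs of any passage differ by at most 2.
  record Grown (P : List Arc) (o w : W) (b r : ℕ) : Set where
    field
      arcs  : List Arc
      same  : P ≈ arcs
      count : ∀ x → #lo x arcs + δ w x ≡ #hi x arcs + δ o x
      upper : ∀ x → T b x arcs + δ w x * b ≤ H b x arcs + δ o x * r + (Deg x P + δ o x + δ w x)
      lower : ∀ x → H b x arcs + δ o x * r ≤ T b x arcs + δ w x * b + (Deg x P + δ o x + δ w x)

  private
    up₁ : ∀ u v z D b r T H → b ≤ suc r → T + u * suc b ≤ H + v * suc b + (D + v + u) →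
          (u * suc b + T) + z * b ≤ (v * suc b + H) + z * r + ((u + v + D) + z + z)
    up₁ u v z D b r T H p q = lin 0 (+-mono-≤ q (+-mono-≤ (*-monoʳ-≤ z p) (z≤n {z}))) (e₁ u z b T) (e₂ u v z D b r H)
      where
      e₁ : ∀ u z b T → (u * suc b + T) + z * b + 0 ≡ T + u * suc b + (z * b + 0)
      e₁ = solve-∀
      e₂ : ∀ u v z D b r H → H + v * suc b + (D + v + u) + (z * suc r + z) ≡ (v * suc b + H) + z * r + ((u + v + D) + z + z) + 0
      e₂ = solve-∀
    lo₁ : ∀ u v z D b r T H → r ≤ b → H + v * suc b ≤ T + u * suc b + (D + v + u) →
          (v * suc b + H) + z * r ≤ (u * suc b + T) + z * b + ((u + v + D) + z + z)
    lo₁ u v z D b r T H p q = lin 0 (+-mono-≤ q (+-mono-≤ (*-monoʳ-≤ z p) (z≤n {z + z}))) (e₁ v z b r H) (e₂ u v z D b T)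
      where
      e₁ : ∀ v z b r H → (v * suc b + H) + z * r + 0 ≡ H + v * suc b + (z * r + 0)
      e₁ = solve-∀
      e₂ : ∀ u v z D b T → T + u * suc b + (D + v + u) + (z * b + (z + z)) ≡ (u * suc b + T) + z * b + ((u + v + D) + z + z) + 0
      e₂ = solve-∀
    up₂ : ∀ u v w D b r T H → b ≤ suc r → H + w * b ≤ T + v * suc b + (D + w + v) →
          (u * suc b + H) + w * b ≤ (v * suc b + T) + u * r + ((u + v + D) + u + w)
    up₂ u v w D b r T H p q = lin 0 (+-mono-≤ q (*-monoʳ-≤ u (s≤s p))) (e₁ u w b H) (e₂ u v w D b r T)
      where
      e₁ : ∀ u w b H → (u * suc b + H) + w * b + 0 ≡ H + w * b + u * suc b
      e₁ = solve-∀
      e₂ : ∀ u v w D b r T → T + v * suc b + (D + w + v) + u * suc (suc r) ≡ (v * suc b + T) + u * r + ((u + v + D) + u + w) + 0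
      e₂ = solve-∀
    lo₂ : ∀ u v w D b r T H → r ≤ b → T + v * suc b ≤ H + w * b + (D + w + v) →
          (v * suc b + T) + u * r ≤ (u * suc b + H) + w * b + ((u + v + D) + u + w)
    lo₂ u v w D b r T H p q = lin 0 (+-mono-≤ q (+-mono-≤ (*-monoʳ-≤ u (≤-trans p (n≤1+n b))) (z≤n {u + u}))) (e₁ u v b r T) (e₂ u v w D b H)
      where
      e₁ : ∀ u v b r T → (v * suc b + T) + u * r + 0 ≡ T + v * suc b + (u * r + 0)
      e₁ = solve-∀
      e₂ : ∀ u v w D b H → H + w * b + (D + w + v) + (u * suc b + (u + u)) ≡ (u * suc b + H) + w * b + ((u + v + D) + u + w) + 0
      e₂ = solve-∀
    xor₁ : ∀ u v q w → (w xor w) ≡ ((u xor v) xor q) → q ≡ (v xor u)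
    xor₁ u v q w i = Eq.trans (xor-move (u xor v) q _ i)
      (Eq.trans (cong ((u xor v) xor_) (xor-same w)) (Eq.trans (xor-identityʳ _) (xor-comm u v)))
    xor₂ : ∀ u v q w → (u xor w) ≡ ((u xor v) xor q) → q ≡ (w xor v)
    xor₂ u v q w i = Eq.trans (xor-move (u xor v) q _ i) (c u v w)
      where
      c : ∀ u v w → ((u xor v) xor (u xor w)) ≡ (w xor v)
      c true  v w = Eq.trans (xor-annihilates-not v w) (xor-comm v w)
      c false v w = xor-comm v w

  -- The term `Deg x P + δ o x + δ w x` counts arc ends at `x`. Each passage uses two of them, which
  -- pays for a difference of at most 2 between its ranks. When the two ends meet, a closed trail is
  -- complete, and the next arc starts a new one with its own rank at both ends.
  grow : ∀ n P o w b r → length P ≤ n → All NonLoop P → r ≤ b → b ≤ suc r →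
         (∀ x → par x P ≡ (eqb o x xor eqb w x)) → Grown P o w b r
  grow n P o w b r len nl r≤b b≤r ev with o ≟ w
  grow n [] o w b r len nl r≤b b≤r ev | yes refl = record
    { arcs = [] ; same = done ; count = λ _ → refl
    ; upper = λ x → ≤-trans (*-monoʳ-≤ (δ o x) b≤r) (≤-trans (≤-reflexive (e (δ o x) r)) (+-monoʳ-≤ (δ o x * r) (m≤m+n (δ o x) _)))
    ; lower = λ x → ≤-trans (*-monoʳ-≤ (δ o x) r≤b) (m≤m+n _ _) }
    where
    e : ∀ u r → u * suc r ≡ u * r + u
    e = solve-∀
  grow (suc n) ((l , h) ∷ Q) o w b r (s≤s len) (nl₀ ∷ nl) r≤b b≤r ev | yes refl = record
    { arcs = (l , h) ∷ arcs ; same = keep _ same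
    ; count = λ x → c (δ (f l) x) (δ (f h) x) (δ o x) _ _ (count x)
    ; upper = λ x → subst (λ z → T b x ((l , h) ∷ arcs) + δ o x * b ≤ H b x ((l , h) ∷ arcs) + δ o x * r + (z + Deg x Q + δ o x + δ o x))
        (sym (deg-nonloop x (l , h) nl₀)) (up₁ (δ (f l) x) (δ (f h) x) (δ o x) (Deg x Q) b r _ _ b≤r (upper x))
    ; lower = λ x → subst (λ z → H b x ((l , h) ∷ arcs) + δ o x * r ≤ T b x ((l , h) ∷ arcs) + δ o x * b + (z + Deg x Q + δ o x + δ o x))
        (sym (deg-nonloop x (l , h) nl₀)) (lo₁ (δ (f l) x) (δ (f h) x) (δ o x) (Deg x Q) b r _ _ r≤b (lower x)) }
    where
    open Grown (grow n Q (f h) (f l) (suc b) (suc b) len nl ≤-refl (n≤1+n _)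
           (λ x → xor₁ (eqb (f l) x) (eqb (f h) x) (par x Q) (eqb o x) (sym (ev x))))
    c : ∀ u v z a b → a + u ≡ b + v → u + a + z ≡ v + b + z
    c u v z a b p = cong (_+ z) (Eq.trans (+-comm u a) (Eq.trans p (+-comm b v)))
  grow n P o w b r len nl r≤b b≤r ev | no o≢w
    with arcAt o P (Eq.trans (ev o) (Eq.trans (cong₂ _xor_ (eqb-refl o) (eqb-≢ (λ q → o≢w (sym q)))) refl))
  grow zero    P o w b r len nl r≤b b≤r ev | no o≢w | l , h , Q , e , refl , h≢ with () ← ≤-trans (≤-reflexive (sym (≈-length e))) len
  grow (suc n) P o w b r len nl r≤b b≤r ev | no o≢w | l , h , Q , e , refl , h≢ = record
    { arcs = arcs′ ; same = trans e (keep _ (trans same (flips arcs)))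
    ; count = λ x → Eq.trans (cong₂ (λ i j → δ (f l) x + i + j) (#lo-flip x arcs) (refl {x = δ w x}))
        (Eq.trans (c (δ (f l) x) (δ (f h) x) (δ w x) _ _ (count x)) (cong (λ i → δ (f h) x + i + δ (f l) x) (sym (#hi-flip x arcs))))
    ; upper = λ x → tr (λ i j → δ (f l) x * suc b + i + δ w x * b ≤ δ (f h) x * suc b + j + δ (f l) x * r + (Deg x P + δ (f l) x + δ w x)) x
        (subst (λ d → δ (f l) x * suc b + H (suc b) x arcs + δ w x * b ≤ δ (f h) x * suc b + T (suc b) x arcs + δ (f l) x * r + (d + δ (f l) x + δ w x))
          (sym (degP x)) (up₂ (δ (f l) x) (δ (f h) x) (δ w x) (Deg x Q) b r _ _ b≤r (lower x)))
    ; lower = λ x → tr (λ i j → δ (f h) x * suc b + j + δ (f l) x * r ≤ δ (f l) x * suc b + i + δ w x * b + (Deg x P + δ (f l) x + δ w x)) x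
        (subst (λ d → δ (f h) x * suc b + T (suc b) x arcs + δ (f l) x * r ≤ δ (f l) x * suc b + H (suc b) x arcs + δ w x * b + (d + δ (f l) x + δ w x))
          (sym (degP x)) (lo₂ (δ (f l) x) (δ (f h) x) (δ w x) (Deg x Q) b r _ _ r≤b (upper x))) }
    where
    nl′ = ≈-All {R = NonLoop} (λ _ q p → q (sym p)) e nl
    -- The new arc makes `f h` the younger end, and the next arc continues at `w`. As the ends have
    -- exchanged roles, the recursive call sees the trail backwards; `arcs′` turns its result round.
    open Grown (grow n Q w (f h) (suc b) b (≤-pred (≤-trans (≤-reflexive (sym (≈-length e))) len)) (All.tail nl′) (n≤1+n b) ≤-refl
           (λ x → xor₂ (eqb (f l) x) (eqb (f h) x) (par x Q) (eqb w x) (Eq.trans (sym (ev x)) (par-≈ x e))))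
    arcs′ = (l , h) ∷ map flip arcs
    degP : ∀ x → Deg x P ≡ (δ (f l) x + δ (f h) x) + Deg x Q
    degP x = Eq.trans (Deg-≈ x e) (cong (_+ Deg x Q) (deg-nonloop x (l , h) (All.head nl′)))
    tr : ∀ (C : ℕ → ℕ → Set) x → C (H (suc b) x arcs) (T (suc b) x arcs) → C (T (suc b) x (map flip arcs)) (H (suc b) x (map flip arcs))
    tr C x = subst₂ C (sym (T-flip (suc b) x arcs)) (sym (H-flip (suc b) x arcs))
    c : ∀ u v z a b → a + v ≡ b + z → u + b + z ≡ v + a + u
    c u v z a b p = Eq.trans (+-assoc u b z) (Eq.trans (cong (u +_) (sym p)) (e₀ u v a))
      where
      e₀ : ∀ u v a → u + (a + v) ≡ v + a + u
      e₀ = solve-∀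

  record Balanced (P : List Arc) : Set where
    field
      arcs  : List Arc
      same  : P ≈ arcs
      count : ∀ x → #lo x arcs ≡ #hi x arcs
      upper : ∀ x → T 0 x arcs ≤ H 0 x arcs + Deg x P
      lower : ∀ x → H 0 x arcs ≤ T 0 x arcs + Deg x P

  balanceNonLoop : ∀ P → All NonLoop P → (∀ x → par x P ≡ false) → Balanced P
  balanceNonLoop [] nl ev = record { arcs = [] ; same = done ; count = λ _ → refl ; upper = λ _ → z≤n ; lower = λ _ → z≤n }
  balanceNonLoop ((l , h) ∷ Q) (nl₀ ∷ nl) ev = record
    { arcs = (l , h) ∷ arcs ; same = keep _ same
    ; count = λ x → c (δ (f l) x) (δ (f h) x) _ _ (count x)
    ; upper = λ x → subst (λ z → T 0 x ((l , h) ∷ arcs) ≤ H 0 x ((l , h) ∷ arcs) + (z + Deg x Q))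
        (sym (deg-nonloop x (l , h) nl₀)) (i (δ (f l) x) (δ (f h) x) (Deg x Q) _ _ (upper x))
    ; lower = λ x → subst (λ z → H 0 x ((l , h) ∷ arcs) ≤ T 0 x ((l , h) ∷ arcs) + (z + Deg x Q))
        (sym (deg-nonloop x (l , h) nl₀)) (j (δ (f l) x) (δ (f h) x) (Deg x Q) _ _ (lower x)) }
    where
    open Grown (grow (length Q) Q (f h) (f l) 1 1 ≤-refl nl ≤-refl (s≤s z≤n)
           (λ x → xor₁ (eqb (f l) x) (eqb (f h) x) (par x Q) false (sym (ev x))))
    c : ∀ u v a b → a + u ≡ b + v → u + a ≡ v + b
    c u v a b p = Eq.trans (+-comm u a) (Eq.trans p (+-comm b v))
    i : ∀ u v D T H → T + u * 1 ≤ H + v * 1 + (D + v + u) → u * 1 + T ≤ v * 1 + H + (u + v + D)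
    i u v D T H p = lin 0 p (e₁ u T) (e₂ u v D H)
      where
      e₁ : ∀ u T → u * 1 + T + 0 ≡ T + u * 1
      e₁ = solve-∀
      e₂ : ∀ u v D H → H + v * 1 + (D + v + u) ≡ v * 1 + H + (u + v + D) + 0
      e₂ = solve-∀
    j : ∀ u v D T H → H + v * 1 ≤ T + u * 1 + (D + v + u) → v * 1 + H ≤ u * 1 + T + (u + v + D)
    j u v D T H p = lin 0 p (e₁ v H) (e₂ u v D T)
      where
      e₁ : ∀ u T → u * 1 + T + 0 ≡ T + u * 1
      e₁ = solve-∀
      e₂ : ∀ u v D H → H + u * 1 + (D + v + u) ≡ u * 1 + H + (u + v + D) + 0
      e₂ = solve-∀

  splitLoops : ∀ P → Σ[ L ∈ List Arc ] Σ[ Q ∈ List Arc ] (P ≈ L ++ Q × All Loop L × All NonLoop Q)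
  splitLoops [] = [] , [] , done , [] , []
  splitLoops (a ∷ P) with splitLoops P | f (proj₁ a) ≟ f (proj₂ a)
  ... | L , Q , e , l , n | yes p = a ∷ L , Q , keep a e , p ∷ l , n
  ... | L , Q , e , l , n | no p  = L , a ∷ Q , trans (keep a e) (∷-≈-++ a L Q) , l , p ∷ n

  par-loops : ∀ x {L} → All Loop L → par x L ≡ false
  par-loops x [] = refl
  par-loops x (_∷_ {a} p ps) rewrite p | xor-same (eqb (f (proj₂ a)) x) = par-loops x ps

  Deg-loops : ∀ x {L} → All Loop L → Deg x L ≡ 0
  Deg-loops x [] = refl
  Deg-loops x (_∷_ {a} p ps) rewrite p | xor-same (eqb (f (proj₂ a)) x) = Deg-loops x ps

  -- Loops add nothing to `Deg` and could not pay for a passage, but they add equally to `T` and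
  -- `H`. Placed in front, they raise all other ranks by the same amount, which is harmless because
  -- as many arcs leave as enter.
  balance : ∀ P → (∀ x → par x P ≡ false) → Balanced P
  balance P ev with splitLoops P
  ... | L , Q , e , l , nl = record
    { arcs = L ++ arcs ; same = trans e (≈-++ (≈-refl L) same)
    ; count = λ x → Eq.trans (Σl-++ (lo x) L arcs) (Eq.trans (cong₂ _+_ (Σl-cong (lh x)) (count x)) (sym (Σl-++ (hi x) L arcs)))
    ; upper = λ x → subst₂ (λ i j → i ≤ j + Deg x P) (sym (T+ x)) (sym (H+ x)) (sh (T 0 x L) (T 0 x arcs) (H 0 x arcs) {length L * #lo x arcs} (subst (λ d → T 0 x arcs ≤ H 0 x arcs + d) (dg x) (upper x)))
    ; lower = λ x → subst₂ (λ i j → i ≤ j + Deg x P) (sym (H+ x)) (sym (T+ x)) (sh (T 0 x L) (H 0 x arcs) (T 0 x arcs) {length L * #lo x arcs} (subst (λ d → H 0 x arcs ≤ T 0 x arcs + d) (dg x) (lower x))) }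
    where
    open Balanced (balanceNonLoop Q nl (λ x → Eq.trans (sym (cong (_xor par x Q) (par-loops x l)))
                    (Eq.trans (sym (par-++ x L Q)) (Eq.trans (sym (par-≈ x e)) (ev x)))))
    lh : ∀ x → All (λ a → lo x a ≡ hi x a) L
    lh x = All.map (cong (λ z → δ z x)) l
    dg : ∀ x → Deg x Q ≡ Deg x P
    dg x = sym (Eq.trans (Deg-≈ x e) (Eq.trans (Σl-++ (deg x) L Q) (cong (_+ Deg x Q) (Deg-loops x l))))
    T+ : ∀ x → T 0 x (L ++ arcs) ≡ T 0 x L + (T 0 x arcs + length L * #lo x arcs)
    T+ x = Eq.trans (lab-++ (lo x) 0 L arcs) (cong (T 0 x L +_) (lab-shift (lo x) 0 (length L) arcs))
    H+ : ∀ x → H 0 x (L ++ arcs) ≡ T 0 x L + (H 0 x arcs + length L * #lo x arcs)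
    H+ x = Eq.trans (lab-++ (hi x) 0 L arcs) (cong₂ _+_ (sym (lab-cong 0 (lh x)))
             (Eq.trans (lab-shift (hi x) 0 (length L) arcs) (cong (λ c → H 0 x arcs + length L * c) (sym (count x)))))
    sh : ∀ m i j {c d} → i ≤ j + d → m + (i + c) ≤ m + (j + c) + d
    sh m i j {c} {d} p = lin 0 (+-monoʳ-≤ (m + c) p) (e₁ m i c) (e₂ m j c d)
      where
      e₁ : ∀ m i c → m + (i + c) + 0 ≡ m + c + i
      e₁ = solve-∀
      e₂ : ∀ m j c d → m + c + (j + d) ≡ m + (j + c) + d + 0
      e₂ = solve-∀

  -- out and inn: one of the open trails starts, or ends, at x.
  data Outcome (w₀ : W) (P Q : List Arc) (x : W) : Set where
    even : par x P ≡ false → #lo x Q ≡ #hi x Q → H 0 x Q ≤ T 0 x Q + Deg x P → (x ≡ w₀ → H 0 x Q ≤ T 0 x Q) → Outcome w₀ P Q x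
    out  : par x P ≡ true → #lo x Q ≡ suc (#hi x Q) → suc (H 0 x Q) ≤ T 0 x Q → Outcome w₀ P Q x
    inn  : par x P ≡ true → #hi x Q ≡ suc (#lo x Q) → H 0 x Q ≤ T 0 x Q + (length P + length P) → Outcome w₀ P Q x

  record Ordering (w₀ : W) (P : List Arc) : Set where
    field
      arcs    : List Arc
      same    : P ≈ arcs
      outcome : ∀ x → Outcome w₀ P arcs x

  search : ∀ (p : E → Bool) xs → (∃[ e ] p e ≡ true) ⊎ All (λ e → p e ≡ false) xs
  search p [] = inj₂ []
  search p (e ∷ xs) with p e in eq | search p xs
  ... | true  | _      = inj₁ (e , eq)
  ... | false | inj₁ r = inj₁ r
  ... | false | inj₂ r = inj₂ (eq ∷ r)

  -- Reversing all arcs exchanges `T` and `H`, so one of the two directions has `H ≤ T` at `w₀`.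
  -- Either is admissible, since `Balanced` bounds the difference on both sides.
  evenOrdering : ∀ w₀ P → (∀ x → par x P ≡ false) → Ordering w₀ P
  evenOrdering w₀ P ev with balance P ev
  ... | B with ≤-total (H 0 w₀ (Balanced.arcs B)) (T 0 w₀ (Balanced.arcs B))
  ... | inj₁ h≤t = record { arcs = arcs ; same = same ; outcome = λ x → even (ev x) (count x) (lower x) λ { refl → h≤t } }
    where open Balanced B
  ... | inj₂ t≤h = record
    { arcs = map flip arcs ; same = trans same (flips arcs)
    ; outcome = λ x → even (ev x) (Eq.trans (#lo-flip x arcs) (Eq.trans (sym (count x)) (sym (#hi-flip x arcs))))
        (subst₂ (λ i j → i ≤ j + Deg x P) (sym (H-flip 0 x arcs)) (sym (T-flip 0 x arcs)) (upper x))
        λ { refl → subst₂ _≤_ (sym (H-flip 0 x arcs)) (sym (T-flip 0 x arcs)) t≤h } }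
    where open Balanced B

  -- Open trails are removed until all vertices are even, and are ranked after what remains. The
  -- first arc of a trail then has a rank above the number of arcs before it, which outweighs the
  -- imbalance its vertex has from these. Removing a trail makes its two ends even, so no vertex is
  -- an end of two open trails.
  ordering : ∀ n w₀ P → length P ≤ n → Ordering w₀ P
  ordering n w₀ P len with search (λ e → par (f e) P) (flat P)
  ... | inj₂ ev = evenOrdering w₀ P λ x → evx x (par x P) refl
    where
    evx : ∀ x b → par x P ≡ b → par x P ≡ false
    evx x false p = p
    evx x true  p with l , h , Q , e , refl , _ ← arcAt x P p = All.head (All-resp-↭ (≈-flat e) ev)
  ordering zero    w₀ [] z≤n | inj₁ (e , ())
  ordering (suc n) w₀ P len | inj₁ (e , od) with walk (length P) P (f e) ≤-refl od
  ... | t with ordering n w₀ (Trail.rest t) (≤-pred (≤-trans shorter len))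
    where
    shorter : suc (length (Trail.rest t)) ≤ length P
    shorter = ≤-trans (≤-trans (≤-reflexive (+-comm 1 _)) (+-monoʳ-≤ (length (Trail.rest t)) (Trail.nonempty t)))
                (≤-reflexive (sym (Eq.trans (≈-length (Trail.split t)) (length-++ (Trail.rest t)))))
  ... | O = record { arcs = arcs ++ trail ; same = trans split (≈-++ same (≈-refl trail)) ; outcome = res }
    where
    open Trail t
    open Ordering O
    y = f e
    R = length arcs
    R≡ : length rest ≡ R
    R≡ = ≈-length same
    lenP : length P ≡ R + length trail
    lenP = Eq.trans (≈-length split) (Eq.trans (length-++ rest) (cong (_+ length trail) R≡))
    res : ∀ x → Outcome w₀ P (arcs ++ trail) x
    res x = go (y ≟ x) (end ≟ x) (outcome x)
      where
      #l = Σl-++ (lo x) arcs trail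
      #h = Σl-++ (hi x) arcs trail
      T= = lab-++ (lo x) 0 arcs trail
      H= = lab-++ (hi x) 0 arcs trail
      Deg≤R : Deg x rest ≤ R
      Deg≤R = ≤-trans (Deg≤length x rest) (≤-reflexive R≡)
      Deg≤P : Deg x rest ≤ Deg x P
      Deg≤P = ≤-trans (m≤m+n _ (Deg x trail)) (≤-reflexive (sym (Eq.trans (Deg-≈ x split) (Σl-++ (deg x) rest trail))))
      pr : ∀ b c → eqb y x ≡ b → eqb end x ≡ c → par x rest ≡ (par x P xor (b xor c))
      pr b c refl refl = par-rest x
      cn : ∀ b c → eqb y x ≡ b → eqb end x ≡ c → #lo x trail + bit c ≡ #hi x trail + bit b
      cn b c refl refl = count x
      rk : ∀ b c → eqb y x ≡ b → eqb end x ≡ c → H R x trail + bit b * suc R ≤ T R x trail + bit c * (R + length trail)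
      rk b c refl refl = ranks R x
      tf : ∀ {A : Set} {b} → b ≡ true → b ≡ false → A
      tf refl ()
      go : Dec (y ≡ x) → Dec (end ≡ x) → Outcome w₀ rest arcs x → Outcome w₀ P (arcs ++ trail) x
      go (yes p) (yes q) _ = ⊥-elim (end≢y (Eq.trans q (sym p)))
      go (yes refl) (no q) o = fin o
        where
        b₁ = eqb-refl y
        b₂ = eqb-≢ q
        odd = od
        pf : par x rest ≡ false
        pf = Eq.trans (pr true false b₁ b₂) (cong (_xor true) odd)
        fin : Outcome w₀ rest arcs x → Outcome w₀ P (arcs ++ trail) x
        fin (out p _ _) = tf p pf
        fin (inn p _ _) = tf p pf
        fin (even _ c r _) = out odd
          (Eq.trans #l (Eq.trans (cong₂ _+_ c (Eq.trans (sym (+-identityʳ _)) (cn true false b₁ b₂))) (Eq.trans (e₁ (#hi x arcs) (#hi x trail)) (cong suc (sym #h)))))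
          (subst₂ _≤_ (cong suc (sym H=)) (sym T=) (lin (R + Deg x rest) (+-mono-≤ (+-mono-≤ r (rk true false b₁ b₂)) Deg≤R) (e₂ (H 0 x arcs) (H R x trail) R _) (e₃ (T 0 x arcs) (T R x trail) R _)))
          where
          e₁ : ∀ a b → a + (b + 1) ≡ suc (a + b)
          e₁ = solve-∀
          e₂ : ∀ a b r d → suc (a + b) + (r + d) ≡ a + (b + 1 * suc r) + d
          e₂ = solve-∀
          e₃ : ∀ a b r d → a + d + (b + 0) + r ≡ a + b + (r + d)
          e₃ = solve-∀
      go (no p) (yes refl) o = fin o
        where
        b₁ = eqb-≢ p
        b₂ = eqb-refl end
        pf : par x rest ≡ false
        pf = Eq.trans (pr false true b₁ b₂) (cong (_xor true) odd-end)
        fin : Outcome w₀ rest arcs x → Outcome w₀ P (arcs ++ trail) x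
        fin (out p _ _) = tf p pf
        fin (inn p _ _) = tf p pf
        -- The loss consists of the rank of the last arc and the imbalance within `rest`, each at
        -- most `length P`.
        fin (even _ c r _) = inn odd-end
          (Eq.trans #h (Eq.trans (cong₂ _+_ (sym c) (Eq.trans (sym (+-identityʳ _)) (sym (cn false true b₁ b₂)))) (Eq.trans (e₁ (#lo x arcs) (#lo x trail)) (cong suc (sym #l)))))
          (subst₂ _≤_ (sym H=) (cong₂ (λ i j → i + (j + j)) (sym T=) (sym lenP))
            (lin (Deg x rest) (+-mono-≤ (+-mono-≤ r (rk false true b₁ b₂)) (≤-trans Deg≤R (m≤m+n R (length trail)))) (e₂ (H 0 x arcs) (H R x trail) _) (e₃ (T 0 x arcs) (T R x trail) R (length trail) _)))
          where
          e₁ : ∀ a b → a + (b + 1) ≡ suc (a + b)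
          e₁ = solve-∀
          e₂ : ∀ a b d → a + b + d ≡ a + (b + 0) + d
          e₂ = solve-∀
          e₃ : ∀ a b r l d → a + d + (b + 1 * (r + l)) + (r + l) ≡ a + b + (r + l + (r + l)) + d
          e₃ = solve-∀
      go (no p) (no q) o = fin o
        where
        b₁ = eqb-≢ p
        b₂ = eqb-≢ q
        pf : par x P ≡ par x rest
        pf = sym (Eq.trans (pr false false b₁ b₂) (xor-identityʳ _))
        ct : #lo x trail ≡ #hi x trail
        ct = Eq.trans (sym (+-identityʳ _)) (Eq.trans (cn false false b₁ b₂) (+-identityʳ _))
        le : H R x trail ≤ T R x trail
        le = subst₂ _≤_ (+-identityʳ _) (+-identityʳ _) (rk false false b₁ b₂)
        add : ∀ a b {d d′} → a ≤ b + d → d ≤ d′ → a + H R x trail ≤ b + T R x trail + d′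
        add a b {d} {d′} i j = lin d (+-mono-≤ (+-mono-≤ i le) j) (refl) (e₃ b (T R x trail) d d′)
          where
          e₃ : ∀ a b d d′ → a + d + b + d′ ≡ a + b + d′ + d
          e₃ = solve-∀
        R≤ : length rest ≤ length P
        R≤ = ≤-trans (≤-reflexive R≡) (≤-trans (m≤m+n R _) (≤-reflexive (sym lenP)))
        fin : Outcome w₀ rest arcs x → Outcome w₀ P (arcs ++ trail) x
        fin (even i c r z) = even (Eq.trans pf i) (Eq.trans #l (Eq.trans (cong₂ _+_ c ct) (sym #h)))
          (subst₂ (λ i j → i ≤ j + Deg x P) (sym H=) (sym T=) (add (H 0 x arcs) (T 0 x arcs) r Deg≤P))
          (λ w → subst₂ _≤_ (sym H=) (sym T=) (+-mono-≤ (z w) le))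
        fin (out i c r) = out (Eq.trans pf i) (Eq.trans #l (Eq.trans (cong₂ _+_ c ct) (cong suc (sym #h))))
          (subst₂ _≤_ (cong suc (sym H=)) (sym T=) (+-mono-≤ r le))
        fin (inn i c r) = inn (Eq.trans pf i) (Eq.trans #h (Eq.trans (cong₂ _+_ c (sym ct)) (cong suc (sym #l))))
          (subst₂ (λ i j → i ≤ j + (length P + length P)) (sym H=) (sym T=) (add (H 0 x arcs) (T 0 x arcs) r (+-mono-≤ R≤ R≤)))

-- Label zones made of pairs with constant sum

-- Listed by increasing label: the pair of rank j gets the j-th smallest label for its first
-- component and the j-th largest label for its second one.
zone : ∀ {E : Set} → List (E × E) → List E
zone P = map proj₁ P ++ reverse (map proj₂ P)

zone-↭ : ∀ {E : Set} (P : List (E × E)) → zone P ↭ flat P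
zone-↭ P = ↭-trans (++⁺ˡ (map proj₁ P) (↭-reverse (map proj₂ P))) (go P)
  where
  go : ∀ P → map proj₁ P ++ map proj₂ P ↭ flat P
  go []            = refl
  go ((a , b) ∷ P) = prep a (↭-trans (shift b (map proj₁ P) (map proj₂ P)) (prep b (go P)))

-- With the labels s + 1, …, s + 2 R, the pair of rank j carries s + j and s + R + suc R ∸ j.
pairSum : ℕ → ℕ → ℕ
pairSum s R = s + (s + R + suc R)

module Zone {E : Set} where

  -- A second component of rank `j` falls short of `s + R + suc R` by `j`, where `R = length P`;
  -- these deficits are collected on the left to avoid subtraction.
  zone-lab : ∀ (g : E → ℕ) s P →
    lab g s (zone P) + lab (λ a → g (proj₂ a)) 0 P ≡
    lab (λ a → g (proj₁ a)) 0 P + s * Σl (λ a → g (proj₁ a)) P + (s + length P + suc (length P)) * Σl (λ a → g (proj₂ a)) P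
  zone-lab g s P = begin
    lab g s (map proj₁ P ++ reverse (map proj₂ P)) + lab (λ a → g (proj₂ a)) 0 P
      ≡⟨ cong₂ _+_ (lab-++ g s (map proj₁ P) _) (sym (lab-map g proj₂ 0 P)) ⟩
    lab g s (map proj₁ P) + lab g (s + length (map proj₁ P)) (reverse (map proj₂ P)) + lab g 0 (map proj₂ P)
      ≡⟨ +-assoc (lab g s (map proj₁ P)) _ _ ⟩
    lab g s (map proj₁ P) + (lab g (s + length (map proj₁ P)) (reverse (map proj₂ P)) + lab g 0 (map proj₂ P))
      ≡⟨ cong₂ _+_ (Eq.trans (lab-map g proj₁ s P) (lab-shift (λ a → g (proj₁ a)) 0 s P)) (lab-reverse g (s + length (map proj₁ P)) (map proj₂ P)) ⟩
    lab (λ a → g (proj₁ a)) 0 P + s * Σl (λ a → g (proj₁ a)) P + (s + length (map proj₁ P) + suc (length (map proj₂ P))) * Σl g (map proj₂ P)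
      ≡⟨ cong (lab (λ a → g (proj₁ a)) 0 P + s * Σl (λ a → g (proj₁ a)) P +_)
           (cong₂ _*_ (cong₂ (λ i j → s + i + suc j) (length-map proj₁ P) (length-map proj₂ P)) (Σl-map g proj₂ P)) ⟩
    lab (λ a → g (proj₁ a)) 0 P + s * Σl (λ a → g (proj₁ a)) P + (s + length P + suc (length P)) * Σl (λ a → g (proj₂ a)) P ∎
    where open ≡-Reasoning

  zone-Σ : ∀ (g : E → ℕ) P → Σl g (zone P) ≡ Σl (λ a → g (proj₁ a)) P + Σl (λ a → g (proj₂ a)) P
  zone-Σ g P = Eq.trans (Σl-++ g (map proj₁ P) _)
    (cong₂ _+_ (Σl-map g proj₁ P) (Eq.trans (Σl-↭ g (↭-reverse (map proj₂ P))) (Σl-map g proj₂ P)))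

  zone-exact : ∀ (g : E → ℕ) s P → All (λ a → g (proj₁ a) ≡ g (proj₂ a)) P →
    ∃[ κ ] (Σl g (zone P) ≡ κ + κ × lab g s (zone P) ≡ κ * pairSum s (length P))
  zone-exact g s P eq = κ , Eq.trans (zone-Σ g P) (cong (κ +_) (sym (Σl-cong eq))) ,
    +-cancelʳ-≡ (lab (λ a → g (proj₂ a)) 0 P) _ _ (Eq.trans (zone-lab g s P)
      (Eq.trans (cong₂ (λ i j → i + s * κ + (s + length P + suc (length P)) * j) (lab-cong 0 eq) (sym (Σl-cong eq)))
        (e (lab (λ a → g (proj₂ a)) 0 P) s κ (s + length P + suc (length P)))))
    where
    κ = Σl (λ a → g (proj₁ a)) P
    e : ∀ t s κ r → t + s * κ + r * κ ≡ κ * (s + r) + t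
    e = solve-∀

  both one : (E → Bool) → E × E → ℕ
  both p a = bit (p (proj₁ a) ∧ p (proj₂ a))
  one  p a = bit (p (proj₁ a) xor p (proj₂ a))

  both+one : ∀ p a → bit (p (proj₁ a)) + bit (p (proj₂ a)) ≡ both p a + both p a + one p a
  both+one p (l , h) with p l | p h
  ... | true  | true  = refl
  ... | true  | false = refl
  ... | false | true  = refl
  ... | false | false = refl

  zone-Σ-both : ∀ p P → Σl (λ e → bit (p e)) (zone P) ≡ Σl (both p) P + Σl (both p) P + Σl (one p) P
  zone-Σ-both p P = Eq.trans (zone-Σ _ P) (Eq.trans (sym (Σl-+ _ _ P)) (Eq.trans (Σl-cong′ (both+one p) P)
    (Eq.trans (Σl-+ _ (one p) P) (cong (_+ Σl (one p) P) (Σl-+ (both p) (both p) P)))))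

  -- What holds at one end of the edges when the order is chosen for the other end: a pair inside
  -- `p` still yields the pair sum, and a single component at least the smallest label of the zone.
  zone-mixed : ∀ (p : E → Bool) s P →
    Σl (both p) P * pairSum s (length P) + Σl (one p) P * suc s ≤ lab (λ e → bit (p e)) s (zone P)
  zone-mixed p s P = lin (B₀ + LH + OH * R + OH * R)
      (+-mono-≤ (+-monoˡ-≤ K (+-mono-≤ (lab-≥ oL 0 P) (lab-≤ oH 0 P))) (z≤n {OH * R}))
      (Eq.trans (cong (λ o → B₁ * pairSum s R + o * suc s + (B₀ + LH + OH * R + OH * R)) OL+OH) (e₁ B₁ OL OH s R B₀ LH))
      (Eq.trans (e₂ LL s B₁ OL OH R B₀) (Eq.trans (cong (λ y → y + OH * R + OH * R) (sym z)) (e₃ (lab (λ e → bit (p e)) s (zone P)) B₀ LH (OH * R))))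
    where
    R = length P
    oL oH : E × E → ℕ
    oL a = bit (p (proj₁ a) ∧ not (p (proj₂ a)))
    oH a = bit (p (proj₂ a) ∧ not (p (proj₁ a)))
    B₀ = lab (both p) 0 P
    B₁ = Σl (both p) P
    OL = Σl oL P
    OH = Σl oH P
    O = Σl (one p) P
    LL = lab oL 0 P
    LH = lab oH 0 P
    K = B₀ + s * (B₁ + OL) + (s + R + suc R) * (B₁ + OH)
    dl : ∀ a → bit (p (proj₁ a)) ≡ both p a + oL a
    dl (l , h) with p l | p h
    ... | true  | true  = refl
    ... | true  | false = refl
    ... | false | _     = refl
    dh : ∀ a → bit (p (proj₂ a)) ≡ both p a + oH a
    dh (l , h) with p l | p h
    ... | true  | true  = refl
    ... | true  | false = refl
    ... | false | true  = refl
    ... | false | false = refl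
    d₁ : ∀ a → one p a ≡ oL a + oH a
    d₁ (l , h) with p l | p h
    ... | true  | true  = refl
    ... | true  | false = refl
    ... | false | true  = refl
    ... | false | false = refl
    OL+OH : O ≡ OL + OH
    OL+OH = Eq.trans (Σl-cong′ d₁ P) (Σl-+ oL oH P)
    z : lab (λ e → bit (p e)) s (zone P) + (B₀ + lab oH 0 P) ≡ (B₀ + lab oL 0 P) + s * (B₁ + OL) + (s + R + suc R) * (B₁ + OH)
    z = Eq.trans (cong (lab (λ e → bit (p e)) s (zone P) +_) (sym (lab-split dh)))
      (Eq.trans (zone-lab _ s P) (cong₂ _+_ (cong₂ (λ i j → i + s * j) (lab-split dl) (Σ-split dl)) (cong ((s + R + suc R) *_) (Σ-split dh))))
      where
      lab-split : ∀ {f o : E × E → ℕ} → (∀ a → f a ≡ both p a + o a) → lab f 0 P ≡ B₀ + lab o 0 P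
      lab-split {o = o} d = Eq.trans (lab-cong 0 (All.universal d P)) (lab-+ (both p) o 0 P)
      Σ-split : ∀ {f o : E × E → ℕ} → (∀ a → f a ≡ both p a + o a) → Σl f P ≡ B₁ + Σl o P
      Σ-split {o = o} d = Eq.trans (Σl-cong′ d P) (Σl-+ (both p) o P)
    e₁ : ∀ B₁ OL OH s R B₀ LH → B₁ * (s + (s + R + suc R)) + (OL + OH) * suc s + (B₀ + LH + OH * R + OH * R) ≡
         OL * 1 + LH + (B₀ + s * (B₁ + OL) + (s + R + suc R) * (B₁ + OH)) + 0
    e₁ = solve-∀
    e₂ : ∀ LL s B₁ OL OH R B₀ → LL + OH * R + (B₀ + s * (B₁ + OL) + (s + R + suc R) * (B₁ + OH)) + OH * R ≡
         B₀ + LL + s * (B₁ + OL) + (s + R + suc R) * (B₁ + OH) + OH * R + OH * R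
    e₂ = solve-∀
    e₃ : ∀ z b l o → z + (b + l) + o + o ≡ z + (b + l + o + o)
    e₃ = solve-∀

module ZoneBounds {E W : Set} (_≟_ : DecidableEquality W) (f : E → W) where
  open Delta _≟_
  open Arcs _≟_ f
  open Zone {E}

  at : W → E → ℕ
  at x e = δ (f e) x

  -- Label sums are measured against `κ` pair sums. In the odd case the extra label is guaranteed to
  -- count as the smallest one, `suc s`; in the even case a deficit `D` may remain, but not at `w₀`.
  data Low (w₀ : W) (s R : ℕ) (Z : List E) (x : W) : Set where
    even : ∀ κ D → Σl (at x) Z ≡ κ + κ → D ≤ κ + κ → κ * pairSum s R ≤ lab (at x) s Z + D →
           (x ≡ w₀ → κ * pairSum s R ≤ lab (at x) s Z) → Low w₀ s R Z x
    odd  : ∀ κ → Σl (at x) Z ≡ suc (κ + κ) → κ * pairSum s R + suc s ≤ lab (at x) s Z → Low w₀ s R Z x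

  data High (s R : ℕ) (Z : List E) (x : W) : Set where
    even : ∀ κ D → Σl (at x) Z ≡ κ + κ → D ≤ κ + κ → D ≤ R → lab (at x) s Z ≤ κ * pairSum s R + D → High s R Z x
    odd  : ∀ κ → Σl (at x) Z ≡ suc (κ + κ) → lab (at x) s Z ≤ κ * pairSum s R + (s + (R + R)) → High s R Z x

  low : ∀ w₀ s P → let open Ordering (ordering (length P) w₀ P ≤-refl) in ∀ x → Low w₀ s (length P) (zone arcs) x
  low w₀ s P x = go (outcome x)
    where
    open Ordering (ordering (length P) w₀ P ≤-refl)
    R≡ : length arcs ≡ length P
    R≡ = sym (≈-length same)
    R = length P
    L = lab (at x) s (zone arcs)
    L= : L + H 0 x arcs ≡ T 0 x arcs + s * #lo x arcs + (s + R + suc R) * #hi x arcs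
    L= = Eq.trans (zone-lab (at x) s arcs) (cong (λ r → T 0 x arcs + s * #lo x arcs + (s + r + suc r) * #hi x arcs) R≡)
    cnt = zone-Σ (at x) arcs
    go : Outcome w₀ P arcs x → Low w₀ s R (zone arcs) x
    go (even _ c r z) = even (#lo x arcs) (Deg x P) (Eq.trans cnt (cong (#lo x arcs +_) (sym c)))
        (≤-trans (≤-reflexive (Deg-≈ x same)) (≤-trans (Deg≤# x arcs) (≤-reflexive (cong (#lo x arcs +_) (sym c)))))
        (lin (H 0 x arcs) (+-monoˡ-≤ (κS) r) (+-comm κS _) (e₁ (T 0 x arcs) (Deg x P) κS L (H 0 x arcs) L=′))
        (λ w → lin (H 0 x arcs) (+-monoˡ-≤ κS (z w)) (+-comm κS _) (sym L=′))
      where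
      κS = #lo x arcs * pairSum s R
      e₀ : ∀ t s k r → t + s * k + r * k ≡ t + k * (s + r)
      e₀ = solve-∀
      L=′ : L + H 0 x arcs ≡ T 0 x arcs + κS
      L=′ = Eq.trans L= (Eq.trans (cong (λ k → T 0 x arcs + s * #lo x arcs + (s + R + suc R) * k) (sym c)) (e₀ (T 0 x arcs) s _ (s + R + suc R)))
      e₁ : ∀ t d k l h → l + h ≡ t + k → t + d + k ≡ l + d + h
      e₁ t d k l h p = Eq.trans (Eq.trans (+-assoc t d k) (Eq.trans (cong (t +_) (+-comm d k)) (sym (+-assoc t k d)))) (Eq.trans (cong (_+ d) (sym p)) (Eq.trans (+-assoc l h d) (Eq.trans (cong (l +_) (+-comm h d)) (sym (+-assoc l d h)))))
    go (out _ c r) = odd (#hi x arcs) (Eq.trans cnt (cong (_+ #hi x arcs) c))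
        (lin (H 0 x arcs) (+-monoˡ-≤ (κS + s) r) (e₁ κS s (H 0 x arcs)) (Eq.trans (e₀ (T 0 x arcs) s (#hi x arcs) (s + R + suc R)) (sym L=′)))
      where
      κS = #hi x arcs * pairSum s R
      L=′ : L + H 0 x arcs ≡ T 0 x arcs + s * suc (#hi x arcs) + (s + R + suc R) * #hi x arcs
      L=′ = Eq.trans L= (cong (λ k → T 0 x arcs + s * k + (s + R + suc R) * #hi x arcs) c)
      e₀ : ∀ t s k r → t + (k * (s + r) + s) ≡ t + s * suc k + r * k
      e₀ = solve-∀
      e₁ : ∀ k s h → k + suc s + h ≡ suc h + (k + s)
      e₁ = solve-∀
    -- The extra second component brings `s + R + suc R`; a loss of at most `R + R` leaves exactly
    -- `suc s`.
    go (inn _ c r) = odd (#lo x arcs) (Eq.trans cnt (Eq.trans (cong (#lo x arcs +_) c) (+-suc _ _)))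
        (lin (H 0 x arcs) (+-monoˡ-≤ (κS + suc s) r) (+-comm (κS + suc s) _) (Eq.trans (e₀ (T 0 x arcs) s (#lo x arcs) R) (sym L=′)))
      where
      κS = #lo x arcs * pairSum s R
      L=′ : L + H 0 x arcs ≡ T 0 x arcs + s * #lo x arcs + (s + R + suc R) * suc (#lo x arcs)
      L=′ = Eq.trans L= (cong (λ k → T 0 x arcs + s * #lo x arcs + (s + R + suc R) * k) c)
      e₀ : ∀ t s k R → t + (R + R) + (k * (s + (s + R + suc R)) + suc s) ≡ t + s * k + (s + R + suc R) * suc k
      e₀ = solve-∀

  -- Reversing the arcs exchanges the two labels of every pair, so the same ordering gives the
  -- bounds from above.
  high : ∀ w₀ s P → let open Ordering (ordering (length P) w₀ P ≤-refl) in ∀ x → High s (length P) (zone (map flip arcs)) x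
  high w₀ s P x = go (outcome x)
    where
    open Ordering (ordering (length P) w₀ P ≤-refl)
    R≡ : length (map flip arcs) ≡ length P
    R≡ = Eq.trans (length-map flip arcs) (sym (≈-length same))
    R = length P
    L = lab (at x) s (zone (map flip arcs))
    L= : L + T 0 x arcs ≡ H 0 x arcs + s * #hi x arcs + (s + R + suc R) * #lo x arcs
    L= = Eq.trans (cong (L +_) (sym (H-flip 0 x arcs))) (Eq.trans (zone-lab (at x) s (map flip arcs))
      (cong₂ _+_ (cong₂ (λ i j → i + s * j) (T-flip 0 x arcs) (#lo-flip x arcs)) (cong₂ (λ r j → (s + r + suc r) * j) R≡ (#hi-flip x arcs))))
    cnt : Σl (at x) (zone (map flip arcs)) ≡ #hi x arcs + #lo x arcs
    cnt = Eq.trans (zone-Σ (at x) (map flip arcs)) (cong₂ _+_ (#lo-flip x arcs) (#hi-flip x arcs))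
    go : Outcome w₀ P arcs x → High s R (zone (map flip arcs)) x
    go (even _ c r z) = even (#lo x arcs) (Deg x P) (Eq.trans cnt (cong (_+ #lo x arcs) (sym c)))
        (≤-trans (≤-reflexive (Deg-≈ x same)) (≤-trans (Deg≤# x arcs) (≤-reflexive (cong (#lo x arcs +_) (sym c)))))
        (Deg≤length x P)
        (lin (T 0 x arcs) (+-monoˡ-≤ κS r) (L=′) (e₁ (T 0 x arcs) (Deg x P) κS))
      where
      κS = #lo x arcs * pairSum s R
      e₀ : ∀ t s k r → t + s * k + r * k ≡ t + k * (s + r)
      e₀ = solve-∀
      L=′ : L + T 0 x arcs ≡ H 0 x arcs + κS
      L=′ = Eq.trans L= (Eq.trans (cong (λ k → H 0 x arcs + s * k + (s + R + suc R) * #lo x arcs) (sym c)) (e₀ (H 0 x arcs) s _ (s + R + suc R)))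
      e₁ : ∀ t d k → t + d + k ≡ k + d + t
      e₁ = solve-∀
    go (out _ c r) = odd (#hi x arcs) (Eq.trans cnt (Eq.trans (cong (#hi x arcs +_) c) (+-suc _ _)))
        (lin (suc (T 0 x arcs)) (+-monoˡ-≤ (κS + (s + R + suc R)) r) (Eq.trans (+-suc L _) (Eq.trans (cong suc L=′) (e₀ (H 0 x arcs) s (#hi x arcs) (s + R + suc R)))) (e₁ (T 0 x arcs) κS s R))
      where
      κS = #hi x arcs * pairSum s R
      L=′ : L + T 0 x arcs ≡ H 0 x arcs + s * #hi x arcs + (s + R + suc R) * suc (#hi x arcs)
      L=′ = Eq.trans L= (cong (λ k → H 0 x arcs + s * #hi x arcs + (s + R + suc R) * k) c)
      e₀ : ∀ t s k r → suc (t + s * k + r * suc k) ≡ suc t + (k * (s + r) + r)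
      e₀ = solve-∀
      e₁ : ∀ t k s R → t + (k + (s + R + suc R)) ≡ k + (s + (R + R)) + suc t
      e₁ = solve-∀
    go (inn _ c r) = odd (#lo x arcs) (Eq.trans cnt (cong (_+ #lo x arcs) c))
        (lin (T 0 x arcs) (+-monoˡ-≤ (κS + s) r) (Eq.trans L=′ (e₀ (H 0 x arcs) s (#lo x arcs) (s + R + suc R))) (e₁ (T 0 x arcs) κS s R))
      where
      κS = #lo x arcs * pairSum s R
      L=′ : L + T 0 x arcs ≡ H 0 x arcs + s * suc (#lo x arcs) + (s + R + suc R) * #lo x arcs
      L=′ = Eq.trans L= (cong (λ k → H 0 x arcs + s * k + (s + R + suc R) * #lo x arcs) c)
      e₀ : ∀ t s k r → t + s * suc k + r * k ≡ t + (k * (s + r) + s)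
      e₀ = solve-∀
      e₁ : ∀ t k s R → t + (R + R) + (k + s) ≡ k + (s + (R + R)) + t
      e₁ = solve-∀

  record HighZone (s : ℕ) (P : List (E × E)) : Set where
    field
      Q     : List E
      perm  : Q ↭ flat P
      high′ : ∀ x → High s (length P) Q x
      mixed : ∀ (p : E → Bool) → Σl (both p) P * pairSum s (length P) + Σl (one p) P * suc s ≤ lab (λ e → bit (p e)) s Q

  highZone : W → ∀ s P → HighZone s P
  highZone w₀ s P = record
    { Q = zone Z
    ; perm = trans (zone-↭ Z) (↭-sym (≈-flat same′))
    ; high′ = high w₀ s P
    ; mixed = λ p → subst (_≤ lab (λ e → bit (p e)) s (zone Z))
        (cong₂ _+_ (cong₂ (λ i j → i * pairSum s j) (sym (≈-sum (both p) (both-flip p) same′)) (sym (≈-length same′)))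
                   (cong (_* suc s) (sym (≈-sum (one p) (one-flip p) same′))))
        (zone-mixed p s Z) }
    where
    open Ordering (ordering (length P) w₀ P ≤-refl)
    Z = map flip arcs
    same′ : P ≈ Z
    same′ = trans same (flips arcs)
    both-flip : ∀ p a → both p (flip a) ≡ both p a
    both-flip p (l , h) = cong bit (∧-comm (p h) (p l))
    one-flip : ∀ p a → one p (flip a) ≡ one p a
    one-flip p (l , h) = cong bit (xor-comm (p h) (p l))

  record LowZone (w₀ : W) (s : ℕ) (P : List (E × E)) : Set where
    field
      Q     : List E
      perm  : Q ↭ flat P
      low′  : ∀ x → Low w₀ s (length P) Q x
      exact : ∀ (g : E → ℕ) → All (λ a → g (proj₁ a) ≡ g (proj₂ a)) P →
              ∃[ κ ] (Σl g Q ≡ κ + κ × lab g s Q ≡ κ * pairSum s (length P))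

  lowZone : ∀ w₀ s P → LowZone w₀ s P
  lowZone w₀ s P = record
    { Q = zone arcs
    ; perm = trans (zone-↭ arcs) (↭-sym (≈-flat same))
    ; low′ = low w₀ s P
    ; exact = λ g eq → subst (λ r → ∃[ κ ] (Σl g (zone arcs) ≡ κ + κ × lab g s (zone arcs) ≡ κ * pairSum s r)) (sym (≈-length same))
        (zone-exact g s arcs (≈-All (λ _ p → sym p) same eq)) }
    where
    open Ordering (ordering (length P) w₀ P ≤-refl)

length-flat : ∀ {A : Set} (P : List (A × A)) → length (flat P) ≡ length P + length P
length-flat []            = refl
length-flat ((a , b) ∷ P) = cong suc (Eq.trans (cong suc (length-flat P)) (sym (+-suc (length P) (length P))))

flat-++ : ∀ {A : Set} (P Q : List (A × A)) → flat (P ++ Q) ≡ flat P ++ flat Q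
flat-++ []            Q = refl
flat-++ ((a , b) ∷ P) Q = cong (λ xs → a ∷ b ∷ xs) (flat-++ P Q)

pairAny : ∀ {A : Set} (xs : List A) → Σ[ P ∈ List (A × A) ] Σ[ ys ∈ List A ] (xs ↭ flat P ++ ys × length ys ≤ 1)
pairAny []       = [] , [] , ↭-refl , z≤n
pairAny (x ∷ []) = [] , x ∷ [] , ↭-refl , ≤-refl
pairAny (x ∷ y ∷ xs) with pairAny xs
... | P , ys , q , le = (x , y) ∷ P , ys , prep x (prep y q) , le

-- Covering the heavy vertices

module Sums {W : Set} (_≟_ : DecidableEquality W) where
  open Delta _≟_

  δ-≡ : ∀ {a x} → a ≡ x → δ a x ≡ 1
  δ-≡ {a} refl = cong bit (eqb-refl a)

  δ-≢ : ∀ {a x} → a ≢ x → δ a x ≡ 0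
  δ-≢ p = cong bit (eqb-≢ p)

  δ-≤1 : ∀ a x → δ a x ≤ 1
  δ-≤1 a x with a ≟ x
  ... | yes _ = ≤-refl
  ... | no _  = z≤n

  Σδ-∉ : ∀ (g : W → ℕ) x {vs} → All (x ≢_) vs → Σl (λ v → g v * δ x v) vs ≡ 0
  Σδ-∉ g x []       = refl
  Σδ-∉ g x (_∷_ {v} p ps) rewrite δ-≢ p | *-zeroʳ (g v) = Σδ-∉ g x ps

  Σδ-∈ : ∀ (g : W → ℕ) {x vs} → Unique vs → x ∈ vs → Σl (λ v → g v * δ x v) vs ≡ g x
  Σδ-∈ g {x} (p ∷ _) (here refl) rewrite δ-≡ {x} refl | Σδ-∉ g x p = Eq.trans (+-identityʳ _) (*-identityʳ _)
  Σδ-∈ g {x} {v ∷ _} (p ∷ u) (there i) rewrite δ-≢ {x} {v} (λ q → All.lookup p i (sym q)) | *-zeroʳ (g v) = Σδ-∈ g u i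

module Count {E W : Set} (_≟_ : DecidableEquality W) (f : E → W) where
  open Delta _≟_
  open Sums _≟_

  # : W → List E → ℕ
  # x = Σl (λ e → δ (f e) x)

  #-∈ : ∀ {e xs} → e ∈ xs → 1 ≤ # (f e) xs
  #-∈ {e} (here refl) = ≤-trans (≤-reflexive (sym (δ-≡ {f e} refl))) (m≤m+n _ _)
  #-∈ {xs = y ∷ _} (there i) = ≤-trans (#-∈ i) (m≤n+m _ _)

  remove : ∀ x xs → (Σ[ e ∈ E ] Σ[ ys ∈ List E ] (xs ↭ e ∷ ys × f e ≡ x)) ⊎ (# x xs ≡ 0)
  remove x [] = inj₂ refl
  remove x (e ∷ xs) with f e ≟ x | remove x xs
  ... | yes p | _ = inj₁ (e , xs , ↭-refl , p)
  ... | no _  | inj₁ (e′ , ys , q , r) = inj₁ (e′ , e ∷ ys , trans (prep e q) (swap e e′ ↭-refl) , r)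
  ... | no p  | inj₂ z = inj₂ z

  pairUp : ∀ xs → Σ[ P ∈ List (E × E) ] Σ[ ys ∈ List E ]
           (xs ↭ flat P ++ ys × All (λ a → f (proj₁ a) ≡ f (proj₂ a)) P × (∀ x → # x ys ≤ 1))
  pairUp [] = [] , [] , ↭-refl , [] , λ _ → z≤n
  pairUp (e ∷ xs) with pairUp xs
  ... | P , ys , q , eq , le with remove (f e) ys
  ... | inj₁ (e′ , zs , r , p) = (e , e′) ∷ P , zs ,
        prep e (trans q (trans (++⁺ˡ (flat P) r) (shift e′ (flat P) zs))) , sym p ∷ eq ,
        λ x → ≤-trans (≤-trans (m≤n+m _ (δ (f e′) x)) (≤-reflexive (sym (Σl-↭ _ r)))) (le x)
  ... | inj₂ z = P , e ∷ ys , trans (prep e q) (↭-sym (shift e (flat P) ys)) , eq , le′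
    where
    le′ : ∀ x → # x (e ∷ ys) ≤ 1
    le′ x with f e ≟ x
    ... | yes refl = ≤-reflexive (cong suc z)
    ... | no _     = le x

  -- Greedy completion. It serves twice: to thin out a cover to one edge per lower vertex, and to
  -- supply edges at the lower vertices still missing.
  extend : ∀ sel xs → (∀ x → # x sel ≤ 1) → Σ[ new ∈ List E ] Σ[ rest ∈ List E ]
           (xs ↭ new ++ rest × (∀ x → # x (sel ++ new) ≤ 1) × (∀ x → # x (sel ++ new) ≡ 0 → # x xs ≡ 0))
  extend sel [] le = [] , [] , ↭-refl , (λ x → ≤-trans (≤-reflexive (Eq.trans (Σl-++ _ sel []) (+-identityʳ _))) (le x)) , λ _ _ → refl
  extend sel (e ∷ xs) le with remove (f e) sel
  ... | inj₁ (e′ , ys , q , p) with extend sel xs le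
  ... | new , rest , r , le′ , cov = new , e ∷ rest , trans (prep e r) (↭-sym (shift e new rest)) , le′ ,
        λ x z → cong₂ _+_ (δ-≢ (λ i → no1 x (Eq.trans p i) z)) (cov x z)
    where
    no1 : ∀ x → f e′ ≡ x → # x (sel ++ new) ≢ 0
    no1 x i z with () ← Eq.trans (sym (δ-≡ i)) (m+n≡0⇒m≡0 (δ (f e′) x)
        (Eq.trans (sym (Σl-↭ (λ a → δ (f a) x) q)) (m+n≡0⇒m≡0 (# x sel) (Eq.trans (sym (Σl-++ _ sel new)) z))))
  extend sel (e ∷ xs) le | inj₂ z with extend (e ∷ sel) xs le₁
    where
    le₁ : ∀ x → # x (e ∷ sel) ≤ 1
    le₁ x with f e ≟ x
    ... | yes refl = ≤-reflexive (cong suc z)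
    ... | no _     = le x
  ... | new , rest , r , le′ , cov = e ∷ new , rest , prep e r ,
        (λ x → ≤-trans (≤-reflexive (mv x)) (le′ x)) ,
        λ x w → cong₂ _+_ (m+n≡0⇒m≡0 (δ (f e) x) (Eq.trans (sym (mv x)) w)) (cov x (Eq.trans (sym (mv x)) w))
    where
    mv : ∀ x → # x (sel ++ e ∷ new) ≡ # x (e ∷ sel ++ new)
    mv x = Σl-↭ _ (shift e sel new)

  extract : ∀ ts xs → Unique ts → All (λ t → 1 ≤ # t xs) ts →
            Σ[ ys ∈ List E ] Σ[ rest ∈ List E ] (xs ↭ ys ++ rest × map f ys ≡ ts)
  extract [] xs _ _ = [] , xs , ↭-refl , refl
  extract (t ∷ ts) xs (p ∷ u) (h ∷ hs) with remove t xs
  ... | inj₂ z with () ← ≤-trans h (≤-reflexive z)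
  ... | inj₁ (e , xs′ , q , r) with extract ts xs′ u (hs′ p hs)
    where
    hs′ : ∀ {ts} → All (t ≢_) ts → All (λ t → 1 ≤ # t xs) ts → All (λ t → 1 ≤ # t xs′) ts
    hs′ [] [] = []
    hs′ (_∷_ {t′} i is) (j ∷ js) = ≤-trans j (≤-reflexive (Eq.trans (Σl-↭ _ q) (cong (_+ # t′ xs′) (δ-≢ (λ k → i (Eq.trans (sym r) k)))))) ∷ hs′ is js
  ... | ys , rest , q′ , r′ = e ∷ ys , rest , trans q (prep e q′) , cong₂ _∷_ r r′

-- An assignment with capacities: each vertex of `us` chooses one of its edges, and `load` counts
-- the choices arriving at a lower vertex. Overloading is allowed and measured by `excess`, which
-- augmenting paths reduce.
module Assign {E W : Set} (_≟_ : DecidableEquality W) (dn up : E → W) (B : List E)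
  (us vs : List W) (us! : Unique us) (vs! : Unique vs) (dn∈ : All (λ e → dn e ∈ vs) B) where

  open import Data.List.Membership.DecPropositional _≟_ using (_∈?_)
  open Delta _≟_
  open Sums _≟_

  Good : (W → E) → Set
  Good c = ∀ {u} → u ∈ us → (c u ∈ B) × (up (c u) ≡ u)

  load : (W → E) → W → ℕ
  load c v = Σl (λ u → δ (dn (c u)) v) us

  move : (W → E) → W → E → W → E
  move c u e w = if eqb w u then e else c w

  move-≢ : ∀ c u e {w} → w ≢ u → move c u e w ≡ c w
  move-≢ c u e p rewrite eqb-≢ p = refl

  load-move : ∀ c {u} e v → u ∈ us → load (move c u e) v + δ (dn (c u)) v ≡ load c v + δ (dn e) v
  load-move c {u} e v = go us!
    where
    g : E → ℕ
    g e = δ (dn e) v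
    same : ∀ {ws} → All (u ≢_) ws → Σl (λ w → g (move c u e w)) ws ≡ Σl (λ w → g (c w)) ws
    same ps = Σl-cong {f = λ w → g (move c u e w)} {g = λ w → g (c w)} (All.map (λ p → cong g (move-≢ c u e (λ q → p (sym q)))) ps)
    go : ∀ {ws} → Unique ws → u ∈ ws → Σl (λ w → g (move c u e w)) ws + g (c u) ≡ Σl (λ w → g (c w)) ws + g e
    go {_ ∷ ws} (p ∷ _) (here refl) rewrite eqb-refl u | same p = l (g e) (Σl (λ w → g (c w)) ws) (g (c u))
      where
      l : ∀ a b c → a + b + c ≡ c + b + a
      l = solve-∀
    go {w ∷ ws} (p ∷ us) (there i) rewrite move-≢ c u e (All.lookup p i) =
      Eq.trans (+-assoc (g (c w)) _ _) (Eq.trans (cong (g (c w) +_) (go us i)) (sym (+-assoc (g (c w)) _ _)))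

  module _ (cap : W → ℕ) where

    excess : (W → E) → ℕ
    excess c = Σl (λ v → load c v ∸ cap v) vs

    -- Because of `bound`, a second run with smaller capacities preserves the loads that the first
    -- one has achieved.
    record Better (c : W → E) : Set where
      field
        c′    : W → E
        good  : Good c′
        less  : excess c′ < excess c
        bound : ∀ v → load c′ v ≤ load c v ⊎ load c′ v ≤ cap v

    -- A search forest, latest vertex first, so that recursion on the list follows a path back to an
    -- overloaded vertex. The alternatives of `add` are a root and a vertex whose chosen edge meets
    -- an edge of an earlier one.
    data Reached (c : W → E) : List W → Set where
      []  : Reached c []
      add : ∀ {u us′} → u ∈ us → All (u ≢_) us′ →
            (cap (dn (c u)) < load c (dn (c u))) ⊎ (Σ[ e ∈ E ] (e ∈ B × up e ∈ us′ × dn e ≡ dn (c u))) →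
            Reached c us′ → Reached c (u ∷ us′)

    Σl-< : ∀ {f g : W → ℕ} {ws v} → All (λ w → f w ≤ g w) ws → v ∈ ws → f v < g v → Σl f ws < Σl g ws
    Σl-< (p ∷ ps) (here refl) q = +-mono-<-≤ q (Σl-mono ps)
    Σl-< (p ∷ ps) (there i)   q = +-mono-≤-< p (Σl-< ps i q)

    -- Moving `u` to `e` frees a place at `p`, the old end of its choice. If `p` was overloaded, the
    -- excess has dropped. If `p` was exactly at capacity, the edge through which `u` was reached
    -- now leads to a free place. If `p` had room before, that edge is used without moving `u`.
    augment : ∀ us′ c → Good c → Reached c us′ → ∀ {e} → e ∈ B → up e ∈ us′ → load c (dn e) < cap (dn e) → Better c
    augment (u ∷ us′) c gc (add u∈ u∉ why r) {e} e∈ u′∈ room with up e ≟ u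
    augment (u ∷ us′) c gc (add u∈ u∉ why r) {e} e∈ (here p) room | no q = ⊥-elim (q p)
    augment (u ∷ us′) c gc (add u∈ u∉ why r) {e} e∈ (there i) room | no q = augment us′ c gc r e∈ i room
    augment (u ∷ us′) c gc (add u∈ u∉ why r) {e} e∈ u′∈ room | yes up≡ = result (<-cmp (load c p) (cap p)) why
      where
      p = dn (c u)
      c₁ = move c u e
      g₁ : Good c₁
      g₁ {w} w∈ with w ≟ u
      ... | yes refl = e∈ , up≡
      ... | no q     = gc w∈
      ld : ∀ v → load c₁ v + δ p v ≡ load c v + δ (dn e) v
      ld v = load-move c e v u∈
      ld≤ : ∀ v → load c₁ v ≤ load c v ⊎ load c₁ v ≤ cap v
      ld≤ v with dn e ≟ v
      ... | yes refl = inj₂ (≤-trans (m≤m+n _ (δ p v)) (≤-trans (≤-reflexive (Eq.trans (ld v) (Eq.trans (cong (load c v +_) (δ-≡ {dn e} refl)) (+-comm _ 1)))) room))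
      ... | no q     = inj₁ (≤-trans (m≤m+n _ (δ p v)) (≤-reflexive (Eq.trans (ld v) (Eq.trans (cong (load c v +_) (δ-≢ q)) (+-identityʳ _)))))
      ex≤ : ∀ v → load c₁ v ∸ cap v ≤ load c v ∸ cap v
      ex≤ v with ld≤ v
      ... | inj₁ i = ∸-monoˡ-≤ (cap v) i
      ... | inj₂ i = ≤-trans (≤-reflexive (m≤n⇒m∸n≡0 i)) z≤n
      load-p : p ≢ dn e → suc (load c₁ p) ≡ load c p
      load-p q = Eq.trans (+-comm 1 _) (Eq.trans (cong (load c₁ p +_) (sym (δ-≡ {p} refl))) (Eq.trans (ld p) (Eq.trans (cong (load c p +_) (δ-≢ (λ i → q (sym i)))) (+-identityʳ _))))
      p≢ : cap p ≤ load c p → p ≢ dn e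
      p≢ i q = <-irrefl refl (<-≤-trans (subst (λ z → load c z < cap z) (sym q) room) i)
      result : _ → _ → Better c
      result (tri> _ _ over) _ = record { c′ = c₁ ; good = g₁ ; bound = ld≤
        ; less = Σl-< (All.universal ex≤ vs) (All.lookup dn∈ (proj₁ (gc u∈))) (lt over (load-p (p≢ (<⇒≤ over)))) }
        where
        lt : ∀ {a b c} → c < b → suc a ≡ b → a ∸ c < b ∸ c
        lt {a} {_} {c} (s≤s i) refl = ≤-reflexive (sym (+-∸-assoc 1 i))
      result (tri< a _ _) (inj₁ over) = ⊥-elim (<-asym a over)
      result (tri≈ _ a _) (inj₁ over) = ⊥-elim (<-irrefl (sym a) over)
      result (tri< a _ _) (inj₂ (e′ , e′∈ , i , q)) = augment us′ c gc r e′∈ i (subst (λ z → load c z < cap z) (sym q) a)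
      result (tri≈ _ a _) (inj₂ (e′ , e′∈ , i , q)) = record
        { c′ = c′ ; good = good ; less = <-≤-trans less (Σl-mono (All.universal ex≤ vs)) ; bound = bd }
        where
        -- The rest of the search remains valid for `c₁`: only the choice of `u` has changed, and no
        -- overloaded vertex equals `p`, which is exactly at capacity.
        tr : ∀ {ws} → All (u ≢_) ws → Reached c ws → Reached c₁ ws
        tr [] [] = []
        tr (_∷_ {w} n ns) (add w∈ w∉ why′ r′) rewrite sym (move-≢ c u e (λ q → n (sym q))) = add w∈ w∉ (why₁ why′) (tr ns r′)
          where
          why₁ : _ → _
          why₁ (inj₂ x) = inj₂ x
          why₁ (inj₁ over) = inj₁ (≤-trans over (≤-trans (m≤m+n _ _) (≤-reflexive (Eq.trans (sym (ld _)) (Eq.trans (cong (load c₁ (dn (c₁ w)) +_) (δ-≢ (λ i → <-irrefl (trans′ i) over))) (+-identityʳ _))))))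
            where
            trans′ : p ≡ dn (c₁ w) → cap (dn (c₁ w)) ≡ load c (dn (c₁ w))
            trans′ i = subst (λ z → cap z ≡ load c z) i (sym a)
        open Better (augment us′ c₁ g₁ (tr u∉ r) e′∈ i (subst (λ z → load c₁ z < cap z) (sym q) (≤-reflexive (Eq.trans (load-p (p≢ (≤-reflexive (sym a)))) a))))
        bd : ∀ v → load c′ v ≤ load c v ⊎ load c′ v ≤ cap v
        bd v with bound v
        ... | inj₂ j = inj₂ j
        ... | inj₁ j with ld≤ v
        ... | inj₁ k = inj₁ (≤-trans j k)
        ... | inj₂ k = inj₂ (≤-trans j k)

    Reason : (W → E) → List W → W → Set
    Reason c us′ u = (cap (dn (c u)) < load c (dn (c u))) ⊎ Any (λ e → up e ∈ us′ × dn e ≡ dn (c u)) B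

    reason? : ∀ c us′ u → Dec (Reason c us′ u)
    reason? c us′ u = (cap (dn (c u)) <? load c (dn (c u))) ⊎-dec any? (λ e → (up e ∈? us′) ×-dec (dn e ≟ dn (c u))) B

    record Closed (c : W → E) : Set where
      field
        us′    : List W
        closed : ∀ {u} → u ∈ us → Reason c us′ u → u ∈ us′
        full   : ∀ {e} → e ∈ B → up e ∈ us′ → cap (dn e) ≤ load c (dn e)

    private
      pick : ∀ {P : W → Set} {xs} → Any P xs → Σ[ x ∈ W ] Σ[ ys ∈ List W ] (xs ↭ x ∷ ys × P x)
      pick {xs = x ∷ xs} (here p)  = x , xs , ↭-refl , p
      pick {xs = x ∷ xs} (there i) with pick i
      ... | y , ys , q , p = y , x ∷ ys , trans (prep x q) (swap x y ↭-refl) , p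

    saturate : ∀ n us′ un c → length un ≤ n → us ↭ us′ ++ un → Good c → Reached c us′ → Better c ⊎ Closed c
    saturate n us′ un c len q gc r with any? (λ e → (up e ∈? us′) ×-dec (load c (dn e) <? cap (dn e))) B
    ... | yes a = let e , e∈ , i , room = find a in inj₁ (augment us′ c gc r e∈ i room)
    ... | no ¬a with any? (reason? c us′) un
    ... | no ¬b = inj₂ record { us′ = us′ ; closed = cl ; full = λ e∈ i → ≮⇒≥ (λ j → ¬a (lose e∈ (i , j))) }
      where
      cl : ∀ {u} → u ∈ us → Reason c us′ u → u ∈ us′
      cl u∈ why with ∈-++⁻ us′ (∈-resp-↭ q u∈)
      ... | inj₁ i = i
      ... | inj₂ i = ⊥-elim (¬b (lose i why))
    saturate n us′ un c len q gc r | no ¬a | yes b with pick b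
    saturate zero us′ un c len q gc r | no ¬a | yes b | u , un′ , q′ , why
      with () ← ≤-trans (≤-reflexive (sym (↭-length q′))) len
    saturate (suc n) us′ un c len q gc r | no ¬a | yes b | u , un′ , q′ , why =
      saturate n (u ∷ us′) un′ c (≤-pred (≤-trans (≤-reflexive (sym (↭-length q′))) len)) q″ gc (add u∈ u∉ (fix why) r)
      where
      q″ : us ↭ u ∷ us′ ++ un′
      q″ = trans q (trans (++⁺ˡ us′ q′) (shift u us′ un′))
      u∈ : u ∈ us
      u∈ = ∈-resp-↭ (↭-sym q″) (here refl)
      u∉ : All (u ≢_) us′
      u∉ with Unique-↭ q″ us!
      ... | p ∷ _ = Allₚ.++⁻ˡ us′ p
      fix : Reason c us′ u → (cap (dn (c u)) < load c (dn (c u))) ⊎ (Σ[ e ∈ E ] (e ∈ B × up e ∈ us′ × dn e ≡ dn (c u)))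
      fix (inj₁ x) = inj₁ x
      fix (inj₂ x) = inj₂ (find x)

    -- N consists of the vertices on alternating paths that start at an overloaded vertex.
    record Optimal (c₀ : W → E) (D : ℕ) : Set where
      field
        c     : W → E
        good  : Good c
        bound : ∀ v → load c v ≤ load c₀ v ⊎ load c v ≤ cap v
        N     : W → Bool
        over  : ∀ v → cap v < load c v → N v ≡ true
        full  : ∀ v → N v ≡ true → cap v ≤ load c v
        count : D * Σl (λ v → bit (N v) * load c v) vs ≤ Σl (λ v → bit (N v) * Count.# _≟_ dn v B) vs

    optimal : ∀ n c₀ D → excess c₀ ≤ n → All (λ u → D ≤ Count.# _≟_ up u B) us → Good c₀ → Optimal c₀ D
    optimal n c₀ D len dg gc with saturate (length us) [] us c₀ ≤-refl ↭-refl gc []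
    optimal zero c₀ D len dg gc | inj₁ b with () ← ≤-trans (Better.less b) len
    optimal (suc n) c₀ D len dg gc | inj₁ b = record
      { c = c ; good = good ; bound = bd ; N = N ; over = over ; full = full ; count = count }
      where
      module B = Better b
      open Optimal (optimal n B.c′ D (≤-pred (≤-trans B.less len)) dg B.good)
      bd : ∀ v → load c v ≤ load c₀ v ⊎ load c v ≤ cap v
      bd v with bound v
      ... | inj₂ j = inj₂ j
      ... | inj₁ j with B.bound v
      ... | inj₁ k = inj₁ (≤-trans j k)
      ... | inj₂ k = inj₂ (≤-trans j k)
    optimal n c D len dg gc | inj₂ cl = record
      { c = c ; good = gc ; bound = λ _ → inj₁ ≤-refl ; N = N ; over = over ; full = full′ ; count = count }
      where
      open Closed cl
      hit? : ∀ v → Dec (Any (λ e → up e ∈ us′ × dn e ≡ v) B)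
      hit? v = any? (λ e → (up e ∈? us′) ×-dec (dn e ≟ v)) B
      N : W → Bool
      N v = ⌊ hit? v ⌋
      N⁺ : ∀ {v} → Any (λ e → up e ∈ us′ × dn e ≡ v) B → N v ≡ true
      N⁺ {v} a with hit? v
      ... | yes _ = refl
      ... | no ¬a = ⊥-elim (¬a a)
      N⁻ : ∀ {v} → N v ≡ true → Any (λ e → up e ∈ us′ × dn e ≡ v) B
      N⁻ {v} i with hit? v
      ... | yes a = a
      over : ∀ v → cap v < load c v → N v ≡ true
      over v i with us₀ us i (λ z → z)
        where
        us₀ : ∀ ws → cap v < Σl (λ u → δ (dn (c u)) v) ws → (∀ {u} → u ∈ ws → u ∈ us) → Σ[ u ∈ W ] (u ∈ us × dn (c u) ≡ v)
        us₀ (u ∷ ws) j k with dn (c u) ≟ v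
        ... | yes p = u , k (here refl) , p
        ... | no _  = us₀ ws j (λ z → k (there z))
      ... | u , u∈ , refl = N⁺ (lose (proj₁ (gc u∈)) (subst (_∈ us′) (sym (proj₂ (gc u∈))) (closed u∈ (inj₁ i)) , refl))
      full′ : ∀ v → N v ≡ true → cap v ≤ load c v
      full′ v i with find (N⁻ i)
      ... | e , e∈ , j , refl = full e∈ j
      b : W → ℕ
      b v = bit (N v)
      expand : ∀ {A : Set} (h : A → W) xs → All (λ x → h x ∈ vs) xs → Σl (λ v → b v * Σl (λ x → δ (h x) v) xs) vs ≡ Σl (λ x → b (h x)) xs
      expand h xs ins = Eq.trans (Σl-cong′ (λ v → sym (Σl-* (b v) (λ x → δ (h x) v) xs)) vs)
        (Eq.trans (Σl-swap (λ v x → b v * δ (h x) v) vs xs) (Σl-cong (All.map (λ {x} i → Σδ-∈ b vs! i) ins)))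
      -- Double counting: a vertex whose choice ends in `N` belongs to the search, so all its edges,
      -- at least `D` of them, end in `N`.
      count : D * Σl (λ v → b v * load c v) vs ≤ Σl (λ v → b v * Count.# _≟_ dn v B) vs
      count = begin
        D * Σl (λ v → b v * load c v) vs   ≡⟨ cong (D *_) (expand (λ u → dn (c u)) us (All.tabulate (λ u∈ → All.lookup dn∈ (proj₁ (gc u∈))))) ⟩
        D * Σl (λ u → b (dn (c u))) us     ≡⟨ sym (Σl-* D _ us) ⟩
        Σl (λ u → D * b (dn (c u))) us     ≤⟨ Σl-mono (All.map (λ {u} i → ≤-trans (*-monoˡ-≤ (b (dn (c u))) i) (≤-reflexive (*-comm _ (b (dn (c u)))))) dg) ⟩
        Σl (λ u → b (dn (c u)) * Count.# _≟_ up u B) us ≡⟨ Σl-cong′ (λ u → sym (Σl-* (b (dn (c u))) _ B)) us ⟩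
        Σl (λ u → Σl (λ e → b (dn (c u)) * δ (up e) u) B) us ≡⟨ Σl-swap (λ u e → b (dn (c u)) * δ (up e) u) us B ⟩
        Σl (λ e → Σl (λ u → b (dn (c u)) * δ (up e) u) us) B ≤⟨ Σl-mono (All.tabulate per) ⟩
        Σl (λ e → b (dn e)) B              ≡⟨ sym (expand dn B dn∈) ⟩
        Σl (λ v → b v * Count.# _≟_ dn v B) vs ∎
        where
        open ≤-Reasoning
        per : ∀ {e} → e ∈ B → Σl (λ u → b (dn (c u)) * δ (up e) u) us ≤ b (dn e)
        per {e} e∈ with up e ∈? us
        ... | no q = ≤-trans (≤-reflexive (Σδ-∉ (λ u → b (dn (c u))) (up e) (Allₚ.¬Any⇒All¬ us q))) z≤n
        ... | yes q = ≤-trans (≤-reflexive (Σδ-∈ (λ u → b (dn (c u))) us! q)) (imp (N (dn (c (up e)))) refl)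
          where
          imp : ∀ x → N (dn (c (up e))) ≡ x → bit x ≤ b (dn e)
          imp false _ = z≤n
          imp true  i = ≤-reflexive (cong bit (sym (N⁺ (lose e∈ (closed q (inj₂ (N⁻ i)) , refl)))))

∈⇒↭ : ∀ {A : Set} {x : A} {xs} → x ∈ xs → Σ[ ys ∈ List A ] xs ↭ x ∷ ys
∈⇒↭ {xs = x ∷ xs} (here refl) = xs , ↭-refl
∈⇒↭ {xs = y ∷ xs} (there i) with ∈⇒↭ i
... | ys , q = y ∷ ys , trans (prep y q) (swap y _ ↭-refl)

⊆⇒↭ : ∀ {A : Set} (xs : List A) {ys} → Unique xs → All (_∈ ys) xs → Σ[ zs ∈ List A ] ys ↭ xs ++ zs
⊆⇒↭ [] {ys} _ _ = ys , ↭-refl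
⊆⇒↭ (x ∷ xs) {ys} (p ∷ u) (i ∷ is) with ∈⇒↭ i
... | ys′ , q with ⊆⇒↭ xs u (stay p is)
  where
  stay : ∀ {xs} → All (x ≢_) xs → All (_∈ ys) xs → All (_∈ ys′) xs
  stay [] [] = []
  stay (n ∷ ns) (j ∷ js) with ∈-resp-↭ q j
  ... | here refl = ⊥-elim (n refl)
  ... | there j′  = j′ ∷ stay ns js
... | zs , q′ = zs , trans q (prep x q′)

module Selection {E W : Set} (_≟_ : DecidableEquality W) (dn up : E → W) (e₀ : E) (k : ℕ) (B : List E)
  (us vs : List W) (us! : Unique us) (vs! : Unique vs)
  (dn∈ : All (λ e → dn e ∈ vs) B)
  (dn≤ : ∀ v → Count.# _≟_ dn v B ≤ 2 * k + 2)
  (dn≥ : All (λ v → 1 ≤ Count.# _≟_ dn v B) vs) where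

  open Delta _≟_
  open Sums _≟_
  module D = Count _≟_ dn
  module U = Count _≟_ up

  full? : ∀ v → Dec (D.# v B ≡ 2 * k + 2)
  full? v = D.# v B ℕ.≟ 2 * k + 2

  full : W → Bool
  full v = ⌊ full? v ⌋

  -- σs has one edge at each lower vertex; τs covers the heavy upper vertices that σs misses.
  record Chosen : Set where
    field
      σs τs rest : List E
      split  : B ↭ σs ++ τs ++ rest
      σ-one  : All (λ v → D.# v σs ≡ 1) vs
      σ-le   : ∀ v → D.# v σs ≤ 1
      τ-le   : ∀ v → D.# v τs ≤ 1
      τ-full : ∀ v → 1 ≤ D.# v τs → D.# v B ≡ 2 * k + 2
      hit    : ∀ {u} → u ∈ us → U.# u B ≡ 2 * k + 1 → 1 ≤ U.# u σs + U.# u τs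
      few    : (2 * k + 1) * length τs ≤ Σl (λ v → bit (full v)) vs

  heavy? : ∀ u → Dec (U.# u B ≡ 2 * k + 1)
  heavy? u = U.# u B ℕ.≟ 2 * k + 1

  hs : List W
  hs = filter heavy? us

  hs! : Unique hs
  hs! = Uniqueₚ.filter⁺ heavy? us!

  open Assign _≟_ dn up B hs vs hs! vs! dn∈

  c₀ : W → E
  c₀ u with U.remove u B
  ... | inj₁ (e , _) = e
  -- A default value; heavy vertices do have an edge in `B`.
  ... | inj₂ _       = e₀

  heavy : ∀ {u} → u ∈ hs → 2 * k + 1 ≤ U.# u B
  heavy i = ≤-reflexive (sym (proj₂ (∈-filter⁻ heavy? {xs = us} i)))

  good₀ : Good c₀
  good₀ {u} i with U.remove u B
  ... | inj₁ (e , ys , q , p) = ∈-resp-↭ (↭-sym q) (here refl) , p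
  ... | inj₂ z with () ← ≤-trans (≤-trans (≤-reflexive (+-comm 1 (2 * k))) (heavy i)) (≤-reflexive z)

  cap : W → ℕ
  cap v = suc (bit (full v))

  cap-≥ : ∀ v → D.# v B ≤ (2 * k + 1) * cap v
  cap-≥ v with full? v
  ... | yes p = ≤-trans (dn≤ v) (m+n≤o⇒m≤o _ {2 * k} (≤-reflexive (e k)))
    where
    e : ∀ k → 2 * k + 2 + 2 * k ≡ (2 * k + 1) * 2
    e = solve-∀
  ... | no p = ≤-trans (≤-pred (≤-trans (≤∧≢⇒< (dn≤ v) p) (≤-reflexive (+-suc (2 * k) 1)))) (≤-reflexive (sym (*-identityʳ _)))

  abstract
    opt₁ : Optimal cap c₀ (2 * k + 1)
    opt₁ = optimal cap (excess cap c₀) c₀ (2 * k + 1) ≤-refl (All.tabulate heavy) good₀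

  module O₁ = Optimal opt₁

  load∈ : ∀ c → Good c → ∀ v → 0 < load c v → v ∈ vs
  load∈ c gc v = go hs (λ i → i)
    where
    go : ∀ ws → (∀ {u} → u ∈ ws → u ∈ hs) → 0 < Σl (λ u → δ (dn (c u)) v) ws → v ∈ vs
    go (u ∷ ws) i j with dn (c u) ≟ v
    ... | yes refl = All.lookup dn∈ (proj₁ (gc (i (here refl))))
    ... | no _     = go ws (λ z → i (there z)) j

  -- Count the edges into `N`. Each vertex receives at most `(2 * k + 1) * cap` of them, while every
  -- unit of load requires `2 * k + 1`. The load is at least `cap` throughout `N`, so it cannot be
  -- larger anywhere.
  fits₁ : ∀ v → load O₁.c v ≤ cap v
  fits₁ v = ≮⇒≥ λ over → <-irrefl refl (<-≤-trans (Σl-< cap (All.universal le vs) (load∈ O₁.c O₁.good v (≤-<-trans z≤n over)) (lt over))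
      (≤-trans (≤-reflexive (Σl-* (2 * k + 1) _ vs)) O₁.count))
    where
    le : ∀ w → bit (O₁.N w) * D.# w B ≤ (2 * k + 1) * (bit (O₁.N w) * load O₁.c w)
    le w with O₁.N w in eq
    ... | false = z≤n
    ... | true  = ≤-trans (≤-reflexive (+-identityʳ _)) (≤-trans (cap-≥ w) (≤-trans (*-monoʳ-≤ (2 * k + 1) (O₁.full w eq)) (≤-reflexive (cong ((2 * k + 1) *_) (sym (+-identityʳ _))))))
    lt : cap v < load O₁.c v → bit (O₁.N v) * D.# v B < (2 * k + 1) * (bit (O₁.N v) * load O₁.c v)
    lt over rewrite O₁.over v over | +-identityʳ (D.# v B) | +-identityʳ (load O₁.c v) = begin-strict
      D.# v B                       ≤⟨ cap-≥ v ⟩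
      (2 * k + 1) * cap v           <⟨ m<m+n _ (m<n+m 0 {2 * k + 1} (≤-trans (s≤s z≤n) (≤-reflexive (+-comm 1 (2 * k))))) ⟩
      (2 * k + 1) * cap v + ((2 * k + 1) + 0) ≡⟨ e k (cap v) ⟩
      (2 * k + 1) * suc (cap v)     ≤⟨ *-monoʳ-≤ (2 * k + 1) over ⟩
      (2 * k + 1) * load O₁.c v     ∎
      where
      open ≤-Reasoning
      e : ∀ k c → (2 * k + 1) * c + ((2 * k + 1) + 0) ≡ (2 * k + 1) * suc c
      e = solve-∀

  abstract
    opt₂ : Optimal (λ _ → 1) O₁.c (2 * k + 1)
    opt₂ = optimal (λ _ → 1) (excess (λ _ → 1) O₁.c) O₁.c (2 * k + 1) ≤-refl (All.tabulate heavy) O₁.good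

  module O₂ = Optimal opt₂
  open O₂ using (c; good; N)

  fits : ∀ v → load c v ≤ cap v
  fits v with O₂.bound v
  ... | inj₁ i = ≤-trans i (fits₁ v)
  ... | inj₂ i = ≤-trans i (s≤s z≤n)

  -- The second run has capacity 1 everywhere. Its loads are at most 1 outside `N` and at least 1
  -- inside, so the surplus is the load of `N` minus its size. Again the edges into `N` are counted:
  -- a vertex receives at most `2 * k + 1`, and one more if it is full.
  doubles : (2 * k + 1) * Σl (λ v → load c v ∸ 1) vs ≤ Σl (λ v → bit (full v)) vs
  doubles = lin X (≤-trans (O₂.count) (Σl-mono (All.universal cap′ vs))) e₁ e₂
    where
    X = (2 * k + 1) * Σl (λ v → bit (N v)) vs
    cap′ : ∀ v → bit (N v) * D.# v B ≤ (2 * k + 1) * bit (N v) + bit (full v)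
    cap′ v with N v
    ... | false = z≤n
    ... | true with full? v
    ... | yes p = ≤-trans (≤-reflexive (+-identityʳ _)) (≤-trans (dn≤ v) (≤-reflexive (e k)))
      where
      e : ∀ k → 2 * k + 2 ≡ (2 * k + 1) * 1 + 1
      e = solve-∀
    ... | no p  = ≤-trans (≤-reflexive (+-identityʳ _)) (≤-trans (≤-pred (≤-trans (≤∧≢⇒< (dn≤ v) p) (≤-reflexive (+-suc (2 * k) 1))))
                    (≤-reflexive (Eq.trans (sym (*-identityʳ _)) (sym (+-identityʳ _)))))
    term : ∀ v → load c v ∸ 1 + bit (N v) ≡ bit (N v) * load c v
    term v with N v in eq
    ... | true  = Eq.trans (m∸n+n≡m (O₂.full v eq)) (sym (+-identityʳ _))
    ... | false = Eq.trans (+-identityʳ _) (m≤n⇒m∸n≡0 (≮⇒≥ λ over → absurd (Eq.trans (sym eq) (O₂.over v over))))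
      where
      absurd : false ≢ true
      absurd ()
    e₁ : (2 * k + 1) * Σl (λ v → load c v ∸ 1) vs + X ≡ (2 * k + 1) * Σl (λ v → bit (N v) * load c v) vs
    e₁ = Eq.trans (sym (*-distribˡ-+ (2 * k + 1) _ _)) (cong ((2 * k + 1) *_) (Eq.trans (sym (Σl-+ _ _ vs)) (Σl-cong′ term vs)))
    e₂ : Σl (λ v → (2 * k + 1) * bit (N v) + bit (full v)) vs ≡ Σl (λ v → bit (full v)) vs + X
    e₂ = Eq.trans (Σl-+ _ _ vs) (Eq.trans (cong (_+ Σl (λ v → bit (full v)) vs) (Σl-* (2 * k + 1) _ vs)) (+-comm X _))

  chosen : Chosen
  chosen with ⊆⇒↭ (map c hs) (cov! hs! (λ i → i)) (Allₚ.map⁺ (All.tabulate (λ i → proj₁ (good i))))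
    where
    cov! : ∀ {ws} → Unique ws → (∀ {u} → u ∈ ws → u ∈ hs) → Unique (map c ws)
    cov! [] _ = []
    cov! {w ∷ ws} (p ∷ u) i = Allₚ.map⁺ (All.tabulate (λ {x} j q → All.lookup p j
        (Eq.trans (sym (proj₂ (good (i (here refl))))) (Eq.trans (cong up q) (proj₂ (good (i (there j)))))))) ∷ cov! u (λ j → i (there j))
  ... | rest₀ , q₀ with D.extend [] (map c hs) (λ _ → z≤n)
  ... | σ₁ , τs , q₁ , le₁ , cv₁ with D.extend σ₁ rest₀ le₁
  ... | new , rest , q₂ , le₂ , cv₂ = record
    { σs = σ₁ ++ new ; τs = τs ; rest = rest ; split = split
    ; σ-one = All.map (λ {v} i → ≤-antisym (le₂ v) (one v i)) dn≥
    ; σ-le = le₂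
    ; τ-le = λ v → ≤-trans (≤-reflexive (#τ v)) (≤-trans (∸-monoˡ-≤ 1 (fits v)) (bit≤1 (full v)))
    ; τ-full = λ v i → fl v (≤-trans i (≤-reflexive (#τ v)))
    ; hit = ht
    ; few = ≤-trans (≤-reflexive (cong ((2 * k + 1) *_) len)) doubles }
    where
    cov = map c hs
    split : B ↭ (σ₁ ++ new) ++ τs ++ rest
    split = trans q₀ (trans (++⁺ q₁ q₂) (↭-lemma σ₁ τs new rest))
      where
      ↭-lemma : ∀ (a b c d : List E) → (a ++ b) ++ c ++ d ↭ (a ++ c) ++ b ++ d
      ↭-lemma a b c d = trans (subst (_↭ a ++ (b ++ c) ++ d) (Eq.trans (cong (a ++_) (++-assoc b c d)) (sym (++-assoc a b (c ++ d)))) ↭-refl)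
        (trans (++⁺ˡ a (++⁺ʳ d (++-comm b c))) (subst (a ++ (c ++ b) ++ d ↭_) (Eq.trans (cong (a ++_) (++-assoc c b d)) (sym (++-assoc a c (b ++ d)))) ↭-refl))
    #cov : ∀ v → D.# v cov ≡ load c v
    #cov v = Σl-map _ c hs
    #σ₁τ : ∀ v → load c v ≡ D.# v σ₁ + D.# v τs
    #σ₁τ v = Eq.trans (sym (#cov v)) (Eq.trans (Σl-↭ _ q₁) (Σl-++ _ σ₁ τs))
    #B : ∀ v → D.# v B ≡ D.# v cov + D.# v rest₀
    #B v = Eq.trans (Σl-↭ _ q₀) (Σl-++ _ cov rest₀)
    #τ : ∀ v → D.# v τs ≡ load c v ∸ 1
    #τ v with D.# v σ₁ in eq | le₁ v
    ... | zero        | _ = Eq.trans (n≤0⇒n≡0 (≤-trans (m≤n+m _ (D.# v σ₁)) (≤-reflexive (Eq.trans (sym (#σ₁τ v)) l0)))) (sym (cong (_∸ 1) l0))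
      where
      l0 : load c v ≡ 0
      l0 = Eq.trans (sym (#cov v)) (cv₁ v eq)
    ... | suc zero    | _ = sym (cong (_∸ 1) (Eq.trans (#σ₁τ v) (cong (_+ D.# v τs) eq)))
    ... | suc (suc _) | s≤s ()
    one : ∀ v → 1 ≤ D.# v B → 1 ≤ D.# v (σ₁ ++ new)
    one v i with D.# v (σ₁ ++ new) in eq
    ... | suc _ = s≤s z≤n
    ... | zero  = ≤-trans i (≤-reflexive (Eq.trans (#B v) (cong₂ _+_ (cv₁ v (m+n≡0⇒m≡0 (D.# v σ₁) (Eq.trans (sym (Σl-++ _ σ₁ new)) eq))) (cv₂ v eq))))
    fl : ∀ v → 1 ≤ load c v ∸ 1 → D.# v B ≡ 2 * k + 2
    fl v i with full? v | ≤-trans i (∸-monoˡ-≤ 1 (fits v))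
    ... | yes p | _ = p
    ... | no _  | ()
    ht : ∀ {u} → u ∈ us → U.# u B ≡ 2 * k + 1 → 1 ≤ U.# u (σ₁ ++ new) + U.# u τs
    ht {u} i h = begin
      1                             ≤⟨ subst (λ w → 1 ≤ U.# w cov) (proj₂ (good u∈)) (U.#-∈ (∈-map⁺ c u∈)) ⟩
      U.# u cov                     ≡⟨ Eq.trans (Σl-↭ _ q₁) (Σl-++ _ σ₁ τs) ⟩
      U.# u σ₁ + U.# u τs           ≤⟨ +-monoˡ-≤ (U.# u τs) (≤-trans (m≤m+n _ (U.# u new)) (≤-reflexive (sym (Σl-++ _ σ₁ new)))) ⟩
      U.# u (σ₁ ++ new) + U.# u τs  ∎
      where
      open ≤-Reasoning
      u∈ = ∈-filter⁺ heavy? i h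
    len : length τs ≡ Σl (λ v → load c v ∸ 1) vs
    len = begin
      length τs                                 ≡⟨ sym (Σl-one τs) ⟩
      Σl (λ _ → 1) τs                           ≡⟨ sym (Σl-cong (All.map (λ i → Eq.trans (Σl-cong′ (λ v → sym (+-identityʳ _)) vs) (Σδ-∈ (λ _ → 1) vs! i)) dnτ)) ⟩
      Σl (λ e → Σl (λ v → δ (dn e) v) vs) τs    ≡⟨ Σl-swap (λ e v → δ (dn e) v) τs vs ⟩
      Σl (λ v → D.# v τs) vs                    ≡⟨ Σl-cong′ #τ vs ⟩
      Σl (λ v → load c v ∸ 1) vs                ∎
      where
      open ≡-Reasoning
      dnτ : All (λ e → dn e ∈ vs) τs
      dnτ = Allₚ.++⁻ˡ τs (Allₚ.++⁻ʳ (σ₁ ++ new) (All-resp-↭ split dn∈))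

-- Distinct final sums

module Sorting {A : Set} (key : A → ℕ) where

  Sorted : List A → Set
  Sorted = AllPairs (λ a b → key a ≤ key b)

  insert : ∀ x xs → Sorted xs → Σ[ ys ∈ List A ] (x ∷ xs ↭ ys × Sorted ys)
  insert x [] s = x ∷ [] , ↭-refl , [] ∷ []
  insert x (y ∷ xs) (p ∷ s) with ≤-total (key x) (key y)
  ... | inj₁ i = x ∷ y ∷ xs , ↭-refl , (i ∷ All.map (≤-trans i) p) ∷ p ∷ s
  ... | inj₂ i with insert x xs s
  ... | ys , q , s′ = y ∷ ys , trans (swap x y ↭-refl) (prep y q) , All-resp-↭ q (i ∷ p) ∷ s′

  sort : ∀ xs → Σ[ ys ∈ List A ] (xs ↭ ys × Sorted ys)
  sort [] = [] , ↭-refl , []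
  sort (x ∷ xs) with sort xs
  ... | ys , q , s with insert x ys s
  ... | zs , q′ , s′ = zs , trans (prep x q) q′ , s′

module Values {E W : Set} (_≟_ : DecidableEquality W) (f : E → W) (N : W → ℕ) where
  open Delta _≟_
  open Sums _≟_
  open Count _≟_ f

  -- The final sums at the points f e, if each of them still receives one label, on the list.
  vals : ℕ → List E → List ℕ
  vals L []       = []
  vals L (e ∷ es) = N (f e) + suc L ∷ vals (suc L) es

  vals-++ : ∀ L as bs → vals L (as ++ bs) ≡ vals L as ++ vals (L + length as) bs
  vals-++ L []       bs rewrite +-identityʳ L = refl
  vals-++ L (a ∷ as) bs rewrite +-suc L (length as) = cong (N (f a) + suc L ∷_) (vals-++ (suc L) as bs)

  value : ℕ → List E → W → ℕ
  value L es v = N v + lab (λ e → δ (f e) v) L es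

  value-∈ : ∀ L es v → # v es ≡ 1 → value L es v ∈ vals L es
  value-∈ L (e ∷ es) v h with f e ≟ v
  ... | yes refl = here (cong (N v +_) (Eq.trans (cong (suc L + 0 +_) (lab-0 _ (suc L) es (suc-injective h))) (Eq.trans (+-identityʳ _) (+-identityʳ _))))
  ... | no _     = there (value-∈ (suc L) es v h)

  value-≤ : ∀ {M} L es v → # v es ≡ 1 → All (_≤ M) (vals L es) → value L es v ≤ M
  value-≤ L es v h p = All.lookup p (value-∈ L es v h)

  value-≢ : ∀ L es → Unique (vals L es) → ∀ v v′ → # v es ≡ 1 → # v′ es ≡ 1 → v ≢ v′ → value L es v ≢ value L es v′
  value-≢ L (e ∷ es) (p ∷ u) v v′ h h′ n with f e ≟ v | f e ≟ v′
  ... | yes q | yes q′ = λ _ → n (Eq.trans (sym q) q′)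
  ... | no _  | no _   = value-≢ (suc L) es u v v′ h h′ n
  ... | yes refl | no _ = λ q → All.lookup p (value-∈ (suc L) es v′ h′)
          (Eq.trans (cong (N v +_) (sym (Eq.trans (cong (suc L + 0 +_) (lab-0 _ (suc L) es (suc-injective h))) (Eq.trans (+-identityʳ _) (+-identityʳ _))))) q)
  ... | no _ | yes refl = λ q → All.lookup p (value-∈ (suc L) es v h)
          (Eq.trans (cong (N v′ +_) (sym (Eq.trans (cong (suc L + 0 +_) (lab-0 _ (suc L) es (suc-injective h′))) (Eq.trans (+-identityʳ _) (+-identityʳ _))))) (sym q))

  vals-< : ∀ {X} L es → All (λ e → X ≤ N (f e)) es → All (X + L <_) (vals L es)
  vals-< L [] [] = []
  vals-< {X} L (e ∷ es) (p ∷ ps) = ≤-trans (≤-reflexive (sym (+-suc X L))) (+-monoˡ-≤ (suc L) p) ∷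
    All.map (<-trans (≤-reflexive (sym (+-suc X L)))) (vals-< (suc L) es ps)

  vals-≤ : ∀ {X} L es → All (λ e → N (f e) ≤ X) es → All (_≤ X + (L + length es)) (vals L es)
  vals-≤ L [] [] = []
  vals-≤ {X} L (e ∷ es) (p ∷ ps) rewrite +-suc L (length es) =
    +-mono-≤ p (s≤s (m≤m+n L (length es))) ∷ vals-≤ (suc L) es ps

  open Sorting (λ e → N (f e))

  vals-sorted : ∀ L es → Sorted es → AllPairs _<_ (vals L es)
  vals-sorted L []       []      = []
  vals-sorted L (e ∷ es) (p ∷ s) = vals-< (suc L) es p ∷ vals-sorted (suc L) es s

  vals-unique : ∀ L es → Sorted es → Unique (vals L es)
  vals-unique L es s = AllPairs.map <⇒≢ (vals-sorted L es s)

  -- Permits one entry out of order. The sums around `e` stay increasing, because the gap only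
  -- raises the labels after it, and the sum at `e` exceeds all of them.
  vals-insert : ∀ L as e bs → Sorted (as ++ bs) →
    All (_< N (f e) + suc (L + length as)) (vals L as) →
    All (_< N (f e) + suc (L + length as)) (vals (suc (L + length as)) bs) →
    Unique (vals L (as ++ e ∷ bs))
  vals-insert L [] e bs s _ q rewrite +-identityʳ L = All.map (λ i j → <⇒≢ i (sym j)) q ∷ vals-unique (suc L) bs s
  vals-insert L (a ∷ as) e bs (p ∷ s) (i ∷ is) q rewrite +-suc L (length as) =
    subst (All (N (f a) + suc L ≢_)) (sym (vals-++ (suc L) as (e ∷ bs)))
      (Allₚ.++⁺ (All.map <⇒≢ (vals-< (suc L) as (Allₚ.++⁻ˡ as p)))
        (<⇒≢ i ∷ All.map <⇒≢ (All.map (≤-<-trans (+-monoʳ-≤ (N (f a)) (s≤s (≤-trans (m≤m+n L (length as)) (n≤1+n _)))))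
            (vals-< (suc (suc L + length as)) bs (Allₚ.++⁻ʳ as p)))))
    ∷ vals-insert (suc L) as e bs s is q

-- Parity and estimates for vertex sums

private
  oddPart : ∀ k κ o → κ + κ + o ≡ 2 * k + 1 → ∃[ j ] (κ + j ≡ k × o ≡ suc (j + j))
  oddPart k κ o h with κ ≤? k
  ... | yes p with m≤n⇒∃[o]m+o≡n p
  ... | j , refl = j , refl , +-cancelˡ-≡ (κ + κ) _ _ (Eq.trans h (e κ j))
    where
    e : ∀ κ j → 2 * (κ + j) + 1 ≡ κ + κ + suc (j + j)
    e = solve-∀
  oddPart k κ o h | no p = ⊥-elim (<-irrefl refl (≤-trans (lin 0 (+-mono-≤ (≰⇒> p) (≰⇒> p)) (e k) (sym (+-identityʳ _))) (≤-trans (m≤m+n _ o) (≤-reflexive h))))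
    where
    e : ∀ k → suc (2 * k + 1) + 0 ≡ suc k + suc k
    e = solve-∀

  evenPart : ∀ k κ o → κ + κ + o ≡ 2 * k → ∃[ j ] (κ + j ≡ k × o ≡ j + j)
  evenPart k κ o h with oddPart k κ (suc o) (Eq.trans (+-suc (κ + κ) o) (Eq.trans (cong suc h) (+-comm 1 _)))
  ... | j , p , q = j , p , suc-injective q

  odd-odd : ∀ k κ o → suc (κ + κ) + o ≡ 2 * k + 1 → ∃[ j ] (κ + j ≡ k × o ≡ j + j)
  odd-odd k κ o h = evenPart k κ o (suc-injective (Eq.trans h (+-comm _ 1)))

  odd-even : ∀ k κ o → suc (κ + κ) + o ≡ 2 * k → ∃[ j ] (suc (κ + j) ≡ k × o ≡ suc (j + j))
  odd-even k κ o h with evenPart k κ (suc o) (Eq.trans (+-suc (κ + κ) o) h)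
  ... | zero  , p , ()
  ... | suc j , p , q = j , Eq.trans (sym (+-suc κ j)) p , Eq.trans (suc-injective q) (+-suc j j)

module Arith where
  -- The first label above the zone, together with any number from `s` on, is worth a pair. This is
  -- how labels outside the zone replace missing pairs.
  pairSum-≤ : ∀ s R {y} → s ≤ y → pairSum s R ≤ suc (s + (R + R)) + y
  pairSum-≤ s R p = lin 0 (+-monoʳ-≤ (suc (s + (R + R))) p) (e s R) (sym (+-identityʳ _))
    where
    e : ∀ s R → s + (s + R + suc R) + 0 ≡ suc (s + (R + R)) + s
    e = solve-∀


  -- o labels that are at most s, added to a sum Q of labels of the paired zone s + 1, …, s + 2 R.
  upper-even : ∀ {k s R κ D o Q sm} → κ + κ + o ≡ 2 * k + 1 → D ≤ R → Q ≤ κ * pairSum s R + D → sm ≤ o * s →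
               Q + sm ≤ k * pairSum s R + (s + (R + R))
  upper-even {k} {s} {R} {κ} {D} {o} {Q} {sm} h d q m with oddPart k κ o h
  ... | j , refl , refl = lin D (+-mono-≤ (+-mono-≤ (+-mono-≤ q m) d) (z≤n {j * (R + suc R) + R}))
        (sym (+-identityʳ _)) (e₂ κ j s R D)
    where
    e₂ : ∀ κ j s R D → κ * (s + (s + R + suc R)) + D + suc (j + j) * s + R + (j * (R + suc R) + R) ≡
         (κ + j) * (s + (s + R + suc R)) + (s + (R + R)) + D
    e₂ = solve-∀

  upper-odd : ∀ {k s R κ o Q sm} → suc (κ + κ) + o ≡ 2 * k + 1 → Q ≤ κ * pairSum s R + (s + (R + R)) → sm ≤ o * s →
              Q + sm ≤ k * pairSum s R + (s + (R + R))
  upper-odd {k} {s} {R} {κ} {o} {Q} {sm} h q m with odd-odd k κ o h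
  ... | j , refl , refl = lin 0 (+-mono-≤ (+-mono-≤ q m) (z≤n {j * (R + suc R)})) refl (e₂ κ j s R)
    where
    e₂ : ∀ κ j s R → κ * (s + (s + R + suc R)) + (s + (R + R)) + (j + j) * s + j * (R + suc R) ≡
         (κ + j) * (s + (s + R + suc R)) + (s + (R + R)) + 0
    e₂ = solve-∀

  -- For the end point of τ, with the label of τ set apart: no odd label remains to absorb the
  -- imbalance, so an error of `2 * k` stays.
  upper-even′ : ∀ {k s R κ D o Q sm} → κ + κ + o ≡ 2 * k → D ≤ κ + κ → Q ≤ κ * pairSum s R + D → sm ≤ o * s →
                Q + sm ≤ k * pairSum s R + 2 * k
  upper-even′ {k} {s} {R} {κ} {D} {o} {Q} {sm} h d q m with evenPart k κ o h
  ... | j , refl , refl = lin D (+-mono-≤ (+-mono-≤ (+-mono-≤ q m) d) (z≤n {j * (R + suc R) + (j + j)}))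
        (sym (+-identityʳ _)) (e₂ κ j s R D)
    where
    e₂ : ∀ κ j s R D → κ * (s + (s + R + suc R)) + D + (j + j) * s + (κ + κ) + (j * (R + suc R) + (j + j)) ≡
         (κ + j) * (s + (s + R + suc R)) + 2 * (κ + j) + D
    e₂ = solve-∀

  upper-odd′ : ∀ {k s R κ o Q sm} → suc (κ + κ) + o ≡ 2 * k → Q ≤ κ * pairSum s R + (s + (R + R)) → sm ≤ o * s →
               Q + sm ≤ k * pairSum s R + 2 * k
  upper-odd′ {k} {s} {R} {κ} {o} {Q} {sm} h q m with odd-even k κ o h
  ... | j , refl , refl = lin 0 (+-mono-≤ (+-mono-≤ q m) (z≤n {suc (j * (R + suc R)) + 2 * suc (κ + j)})) refl (e₂ κ j s R)
    where
    e₂ : ∀ κ j s R → κ * (s + (s + R + suc R)) + (s + (R + R)) + suc (j + j) * s + (suc (j * (R + suc R)) + 2 * suc (κ + j)) ≡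
         suc (κ + j) * (s + (s + R + suc R)) + 2 * suc (κ + j) + 0
    e₂ = solve-∀

  -- o labels that are at least x, added to kb exact pairs and possibly a single small label t.
  lower-mixed : ∀ {k kb ko o x t S} → kb + kb + ko + o ≡ 2 * k + 1 → ko ≤ 1 → 1 ≤ o → S ≤ x + x → S ≤ x + t →
                k * S + x ≤ kb * S + ko * t + o * x
  lower-mixed {k} {kb} {zero} {o} {x} {t} {S} h _ _ p q with oddPart k kb o (Eq.trans (cong (_+ o) (sym (+-identityʳ _))) h)
  ... | j , refl , refl = lin 0 (+-monoˡ-≤ (kb * S + x) (*-monoʳ-≤ j p)) (e₁ kb j S x) (e₂ kb j S x)
    where
    e₁ : ∀ kb j S x → (kb + j) * S + x + 0 ≡ j * S + (kb * S + x)
    e₁ = solve-∀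
    e₂ : ∀ kb j S x → j * (x + x) + (kb * S + x) ≡ kb * S + 0 + suc (j + j) * x + 0
    e₂ = solve-∀
  lower-mixed {k} {kb} {suc zero} {o} {x} {t} {S} h _ 1≤o p q with odd-odd k kb o (Eq.trans (cong (_+ o) (+-comm 1 _)) h)
  ... | zero  , refl , refl with () ← 1≤o
  ... | suc i , refl , refl = lin 0 (+-monoˡ-≤ (kb * S + x) (+-mono-≤ (*-monoʳ-≤ i p) q)) (e₁ kb i S x) (e₂ kb i S x t)
    where
    e₁ : ∀ kb i S x → (kb + suc i) * S + x + 0 ≡ i * S + S + (kb * S + x)
    e₁ = solve-∀
    e₂ : ∀ kb i S x t → i * (x + x) + (x + t) + (kb * S + x) ≡ kb * S + (t + 0) + (suc i + suc i) * x + 0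
    e₂ = solve-∀
  lower-mixed {ko = suc (suc _)} _ (s≤s ()) _ _ _

  -- The label `t` is set apart for the comparison with the lower level. The other labels outside
  -- the zone are even in number, and every two of them replace a pair; the deficit `D` is not
  -- covered.
  lower-even : ∀ {k κ D o x t S Q Z} → κ + κ + suc o ≡ 2 * k + 1 → S ≤ x + x → κ * S ≤ Q + D → o * x + t ≤ Z →
               k * S + t ≤ Q + Z + D
  lower-even {k} {κ} {D} {o} {x} {t} {S} {Q} {Z} h p q z with oddPart k κ (suc o) h
  ... | j , refl , refl = lin ((j + j) * x) (+-mono-≤ (+-mono-≤ q z) (*-monoʳ-≤ j p)) (e₁ κ j S t x) (e₂ Q D Z j x)
    where
    e₁ : ∀ κ j S t x → (κ + j) * S + t + (j + j) * x ≡ κ * S + ((j + j) * x + t) + j * S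
    e₁ = solve-∀
    e₂ : ∀ Q D Z j x → Q + D + Z + j * (x + x) ≡ Q + Z + D + (j + j) * x
    e₂ = solve-∀

  lower-odd : ∀ {k κ o x t S y Q Z} → suc (κ + κ) + suc o ≡ 2 * k + 1 → S ≤ x + x → S ≤ x + y → κ * S + y ≤ Q → o * x + t ≤ Z →
              k * S + t ≤ Q + Z
  lower-odd {k} {κ} {o} {x} {t} {S} {y} {Q} {Z} h p r q z with odd-odd k κ (suc o) h
  ... | zero  , _ , ()
  ... | suc i , refl , refl = lin (y + (i + suc i) * x) (+-mono-≤ (+-mono-≤ q z) (+-mono-≤ (*-monoʳ-≤ i p) r)) (e₁ κ i S t x y) (e₂ Q Z i x y)
    where
    e₁ : ∀ κ i S t x y → (κ + suc i) * S + t + (y + (i + suc i) * x) ≡ κ * S + y + ((i + suc i) * x + t) + (i * S + S)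
    e₁ = solve-∀
    e₂ : ∀ Q Z i x y → Q + Z + (i * (x + x) + (x + y)) ≡ Q + Z + (y + (i + suc i) * x)
    e₂ = solve-∀

  upper-exact : ∀ {k s R κ o sm} → κ + κ + o ≡ 2 * k → sm ≤ o * s → κ * pairSum s R + sm ≤ k * pairSum s R
  upper-exact {k} {s} {R} {κ} {o} {sm} h m with evenPart k κ o h
  ... | j , refl , refl = lin 0 (+-mono-≤ (+-monoʳ-≤ (κ * pairSum s R) m) (z≤n {j * (R + suc R)})) refl (e₂ κ j s R)
    where
    e₂ : ∀ κ j s R → κ * (s + (s + R + suc R)) + (j + j) * s + j * (R + suc R) ≡ (κ + j) * (s + (s + R + suc R)) + 0
    e₂ = solve-∀

  one-of-two : ∀ {k κ a b} → κ + κ + (a + b) ≡ 2 * k + 1 → a ≤ 1 → b ≤ 1 → a + b ≡ 1 × κ ≡ k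
  one-of-two {k} {κ} {a} {b} h a≤ b≤ with oddPart k κ (a + b) h
  ... | zero , p , q = q , Eq.trans (sym (+-identityʳ κ)) p
  ... | suc j , p , q with s≤s (s≤s ()) ← ≤-trans (≤-reflexive (Eq.trans (cong (λ i → suc (suc i)) (sym (+-suc j j))) (sym q))) (+-mono-≤ a≤ b≤)

  -- Twice the difference of the two sides is at least `(2 * k - 1) * (p - 2)`.
  size-bound : ∀ k p h → 1 ≤ k → 2 ≤ p → (2 * k + 1) * p ≤ suc (suc (h + h)) → p + 2 * k ≤ suc (suc h)
  size-bound (suc k) (suc zero) h _ (s≤s ()) _
  size-bound (suc k) (suc (suc q)) h _ _ i = *-cancelˡ-≤ 2 (lin (q + 2 * k * q) (+-mono-≤ (+-monoˡ-≤ 2 i) (z≤n {q + 2 * k * q})) (e₁ k q) (e₂ h (q + 2 * k * q)))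
    where
    e₁ : ∀ k q → 2 * (suc (suc q) + 2 * suc k) + (q + 2 * k * q) ≡ (2 * suc k + 1) * suc (suc q) + 2 + 0
    e₁ = solve-∀
    e₂ : ∀ h y → suc (suc (h + h)) + 2 + y ≡ 2 * suc (suc h) + y
    e₂ = solve-∀

module Progression {E W : Set} (_≟_ : DecidableEquality W) (f : E → W) (N : W → ℕ) where
  open Delta _≟_
  open Sums _≟_
  open Count _≟_ f
  open Values _≟_ f N
  open Sorting (λ e → N (f e))

  data Prog : ℕ → List E → Set where
    []  : ∀ {A} → Prog A []
    _∷_ : ∀ {A e es} → N (f e) ≡ suc A → Prog (suc A) es → Prog A (e ∷ es)

  prog-++ : ∀ {A} as {bs} → Prog A (as ++ bs) → Prog A as × Prog (A + length as) bs
  prog-++ {A} []       p       rewrite +-identityʳ A = [] , p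
  prog-++ {A} (a ∷ as) (i ∷ p) rewrite +-suc A (length as) = let q , r = prog-++ as p in i ∷ q , r

  prog-≥ : ∀ {A es} → Prog A es → All (λ e → suc A ≤ N (f e)) es
  prog-≥ []      = []
  prog-≥ (i ∷ p) = ≤-reflexive (sym i) ∷ All.map (≤-trans (n≤1+n _)) (prog-≥ p)

  prog-sorted : ∀ {A es} → Prog A es → Sorted es
  prog-sorted []      = []
  prog-sorted (i ∷ p) = All.map (≤-trans (≤-reflexive i)) (All.map (≤-trans (n≤1+n _)) (prog-≥ p)) ∷ prog-sorted p

  -- The sum so far and the label both grow by one from entry to entry, so the final sums advance by
  -- two and all have the same parity.
  prog-vals : ∀ {A es} L → Prog A es → All (λ x → ∃[ j ] (j < length es × x ≡ A + L + 2 + (j + j))) (vals L es)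
  prog-vals L [] = []
  prog-vals {A} L (i ∷ p) = (0 , s≤s z≤n , Eq.trans (cong (_+ suc L) i) (e₁ A L)) ∷
    All.map (λ { (j , j< , q) → suc j , s≤s j< , Eq.trans q (e₂ A L j) }) (prog-vals (suc L) p)
    where
    e₁ : ∀ A L → suc A + suc L ≡ A + L + 2 + 0
    e₁ = solve-∀
    e₂ : ∀ A L j → suc A + suc L + 2 + (j + j) ≡ A + L + 2 + (suc j + suc j)
    e₂ = solve-∀

  labelled-prog : ∀ K l es → (∀ v → # v es ≤ 1) → All (λ e → N (f e) ≡ K + lab (λ a → δ (f a) (f e)) l es) es → Prog (K + l) es
  labelled-prog K l [] _ _ = []
  labelled-prog K l (e ∷ es) le (p ∷ ps) =
    Eq.trans p (Eq.trans (cong (K +_) (Eq.trans (cong₂ (λ i j → i * suc l + j) (δ-≡ {f e} refl) (lab-0 _ (suc l) es none)) (Eq.trans (+-identityʳ _) (+-identityʳ _)))) (+-suc K l))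
    ∷ subst (λ A → Prog A es) (+-suc K l) (labelled-prog K (suc l) es (λ v → ≤-trans (m≤n+m _ (δ (f e) v)) (le v)) (All.tabulate rec))
    where
    none : # (f e) es ≡ 0
    none = n≤0⇒n≡0 (≤-pred (≤-trans (≤-reflexive (cong (_+ # (f e) es) (sym (δ-≡ {f e} refl)))) (le (f e))))
    rec : ∀ {a} → a ∈ es → N (f a) ≡ K + lab (λ b → δ (f b) (f a)) (suc l) es
    rec {a} a∈ = Eq.trans (All.lookup ps a∈) (cong (λ i → K + (i * suc l + lab (λ b → δ (f b) (f a)) (suc l) es))
      (δ-≢ (λ q → <-irrefl refl (≤-trans (#-∈ a∈) (≤-reflexive (Eq.trans (cong (λ v → # v es) (sym q)) none))))))

  vals-map : ∀ L as bs → map f as ≡ map f bs → vals L as ≡ vals L bs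
  vals-map L []       []       _ = refl
  vals-map L (a ∷ as) (b ∷ bs) q = cong₂ (λ v xs → N v + suc L ∷ xs) (∷-injectiveˡ q) (vals-map (suc L) as bs (∷-injectiveʳ q))

-- Edges between consecutive levels

-- The edges of B join a vertex dn e of the lower level vs to a vertex up e of the upper level us.
-- They get the labels s + 1, …, s + length B; below them a vertex v has the partial sum w v.
-- Further edges at a vertex of us get larger labels.
record ZoneLabelling {E W : Set} (_≟_ : DecidableEquality W) (dn up : E → W) (k : ℕ) (B : List E)
  (us vs : List W) (s : ℕ) (w : W → ℕ) : Set where
  open Delta _≟_
  field
    ys       : List E
    perm     : B ↭ ys
    distinct : ∀ {v v′} → v ∈ vs → v′ ∈ vs → v ≢ v′ → w v + lab (λ e → δ (dn e) v) s ys ≢ w v′ + lab (λ e → δ (dn e) v′) s ys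
    below    : ∀ {v u} c → v ∈ vs → u ∈ us → Count.# _≟_ up u B + c ≡ 2 * k + 2 →
               w v + lab (λ e → δ (dn e) v) s ys < lab (λ e → δ (up e) u) s ys + c * suc (s + length B)

module Level {E W : Set} (_≟_ : DecidableEquality W) (dn up : E → W) (e₀ : E) (k : ℕ) (B : List E)
  (us vs : List W) (us! : Unique us) (vs! : Unique vs)
  (dn∈ : All (λ e → dn e ∈ vs) B)
  (dn≥ : All (λ v → 1 ≤ Count.# _≟_ dn v B) vs)
  (up≤ : All (λ u → Count.# _≟_ up u B ≤ 2 * k + 1) us)
  (s : ℕ) (w z : W → ℕ)
  (z+ : ∀ v → Count.# _≟_ dn v B + z v ≡ 2 * k + 2)
  (w≤ : ∀ v → w v ≤ z v * s) where

  open Delta _≟_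
  open Sums _≟_

  dn≤ : ∀ v → Count.# _≟_ dn v B ≤ 2 * k + 2
  dn≤ v = ≤-trans (m≤m+n _ (z v)) (≤-reflexive (z+ v))

  open Selection _≟_ dn up e₀ k B us vs us! vs! dn∈ dn≤ dn≥
  open Arith

  atD atU : W → E → ℕ
  atD v e = δ (dn e) v
  atU u e = δ (up e) u

  Labelling : Set
  Labelling = ZoneLabelling _≟_ dn up k B us vs s w

  module Finish (pre σl : List E) (perm : B ↭ pre ++ σl) (one : All (λ v → D.# v σl ≡ 1) vs) where

    N : W → ℕ
    N v = w v + lab (atD v) s pre

    L : ℕ
    L = s + length pre

    open Values _≟_ dn N public

    total : ∀ v → w v + lab (atD v) s (pre ++ σl) ≡ value L σl v
    total v = Eq.trans (cong (w v +_) (lab-++ (atD v) s pre σl)) (sym (+-assoc (w v) _ _))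

    top : ℕ
    top = L + length σl

    top≡ : top ≡ s + length B
    top≡ = Eq.trans (+-assoc s (length pre) (length σl)) (cong (s +_) (Eq.trans (sym (length-++ pre)) (sym (↭-length perm))))

    -- The number `M` separates the two levels. By `up≤` every upper vertex has an edge outside `B`,
    -- so one label above `top` is always available there; hence `suc c`.
    finish : ∀ M → Unique (vals L σl) → All (_≤ M) (vals L σl) →
             (∀ {u} c → u ∈ us → U.# u B + suc c ≡ 2 * k + 2 → M < lab (atU u) s (pre ++ σl) + suc c * suc top) → Labelling
    finish M un le big = record
      { ys = pre ++ σl ; perm = perm
      ; distinct = λ {v} {v′} i i′ n q → value-≢ L σl un v v′ (All.lookup one i) (All.lookup one i′) n
          (Eq.trans (sym (total v)) (Eq.trans q (total v′)))
      ; below = λ {v} {u} c i j h → bl {v} c i j h }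
      where
      bl : ∀ {v u} c → v ∈ vs → u ∈ us → U.# u B + c ≡ 2 * k + 2 →
           w v + lab (atD v) s (pre ++ σl) < lab (atU u) s (pre ++ σl) + c * suc (s + length B)
      bl {v} {u} zero i j h = ⊥-elim (<-irrefl refl (≤-trans (≤-reflexive (Eq.trans (sym (+-suc (2 * k) 1)) (Eq.trans (sym h) (+-identityʳ _)))) (All.lookup up≤ j)))
      bl {v} {u} (suc c) i j h = ≤-<-trans (≤-trans (≤-reflexive (total v)) (value-≤ L σl v (All.lookup one i) le))
        (subst (λ t → M < lab (atU u) s (pre ++ σl) + suc c * suc t) top≡ (big c j h))

  -- At most one edge τ.  The upper end points are balanced exactly.  At a lower vertex the
  -- imbalance is absorbed by a leftover edge, except possibly at the end point of τ.
  module Few (ch : Chosen) (p≤1 : length (Chosen.τs ch) ≤ 1) where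
    open Chosen ch

    -- Edges are paired at common upper ends first. The leftovers have distinct upper ends and are
    -- paired arbitrarily, up to `M` if their number is odd. So an upper vertex has at most one edge
    -- whose partner, if any, lies elsewhere.
    record Pairs : Set where
      field
        P        : List (E × E)
        M        : List E
        perm     : rest ↭ flat P ++ M
        M≤1      : length M ≤ 1
        single≤1 : ∀ u → Σl (Zone.one (λ e → eqb (up e) u)) P + U.# u M ≤ 1

    pairs : Pairs
    pairs with U.pairUp rest
    ... | P₁ , ys , q₁ , eq , le with pairAny ys
    ... | P₂ , M , q₂ , M≤ = record
      { P = P₁ ++ P₂ ; M = M
      ; perm = trans q₁ (trans (++⁺ˡ (flat P₁) q₂) (subst (flat P₁ ++ flat P₂ ++ M ↭_) (Eq.trans (sym (++-assoc (flat P₁) (flat P₂) M)) (cong (_++ M) (sym (flat-++ P₁ P₂)))) ↭-refl))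
      ; M≤1 = M≤ ; single≤1 = sg }
      where
      open Zone {E}
      sg : ∀ u → Σl (one (λ e → eqb (up e) u)) (P₁ ++ P₂) + U.# u M ≤ 1
      sg u = begin
        Σl (one p) (P₁ ++ P₂) + U.# u M            ≡⟨ cong (_+ U.# u M) (Σl-++ (one p) P₁ P₂) ⟩
        Σl (one p) P₁ + Σl (one p) P₂ + U.# u M    ≡⟨ cong (λ i → i + Σl (one p) P₂ + U.# u M) (none eq) ⟩
        Σl (one p) P₂ + U.# u M                    ≤⟨ +-monoˡ-≤ (U.# u M) (fl P₂) ⟩
        U.# u (flat P₂) + U.# u M                  ≡⟨ sym (Eq.trans (Σl-↭ _ q₂) (Σl-++ _ (flat P₂) M)) ⟩
        U.# u ys                                   ≤⟨ le u ⟩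
        1                                          ∎
        where
        open ≤-Reasoning
        p : E → Bool
        p e = eqb (up e) u
        none : ∀ {P} → All (λ a → up (proj₁ a) ≡ up (proj₂ a)) P → Σl (one p) P ≡ 0
        none [] = refl
        none (_∷_ {a} i is) rewrite i | xor-same (eqb (up (proj₂ a)) u) = none is
        fl : ∀ P → Σl (one p) P ≤ U.# u (flat P)
        fl [] = z≤n
        fl ((a , b) ∷ P) = ≤-trans (+-mono-≤ (xor≤ (p a) (p b)) (fl P)) (≤-reflexive (+-assoc (bit (p a)) _ _))
          where
          xor≤ : ∀ x y → bit (x xor y) ≤ bit x + bit y
          xor≤ true  true  = z≤n
          xor≤ true  false = ≤-refl
          xor≤ false y     = ≤-refl

    open Pairs (pairs)

    R s₁ lQ S : ℕ
    R = length P
    s₁ = s + length M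
    lQ = s₁ + (R + R)
    S = pairSum s₁ R

    open ZoneBounds _≟_ dn using (High; even; odd; HighZone; highZone)

    abstract
      zoned : HighZone s₁ P
      zoned = highZone (dn e₀) s₁ P

    module H = HighZone zoned
    Q = H.Q

    pre : List E
    pre = M ++ Q ++ τs

    lenQ : length Q ≡ R + R
    lenQ = Eq.trans (↭-length H.perm) (length-flat P)

    perm₁ : B ↭ pre ++ σs
    perm₁ = trans split (trans (++-comm σs (τs ++ rest)) (++⁺ʳ σs (trans (++-comm τs rest)
      (trans (++⁺ʳ τs (trans perm (trans (++-comm (flat P) M) (++⁺ˡ M (↭-sym H.perm)))))
        (subst ((M ++ Q) ++ τs ↭_) (++-assoc M Q τs) ↭-refl)))))

    lab-pre : ∀ (g : E → ℕ) → lab g s pre ≡ lab g s M + (lab g s₁ Q + lab g lQ τs)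
    lab-pre g = Eq.trans (lab-++ g s M (Q ++ τs)) (cong (lab g s M +_) (Eq.trans (lab-++ g s₁ Q τs)
      (cong (λ l → lab g s₁ Q + lab g (s₁ + l) τs) lenQ)))

    ΣB : ∀ (g : E → ℕ) → Σl g B ≡ Σl g M + (Σl g Q + Σl g τs) + Σl g σs
    ΣB g = Eq.trans (Σl-↭ g perm₁) (Eq.trans (Σl-++ g pre σs)
      (cong (_+ Σl g σs) (Eq.trans (Σl-++ g M (Q ++ τs)) (cong (Σl g M +_) (Σl-++ g Q τs)))))

    -- `k` pair sums and the first label above the zone: what an upper vertex is sure of, besides
    -- one edge outside `B`.
    X : ℕ
    X = k * S + suc lQ

    module _ (σl : List E) (σ↭ : σs ↭ σl) where

      σl-one : All (λ v → D.# v σl ≡ 1) vs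
      σl-one = All.map (λ {v} i → Eq.trans (sym (Σl-↭ (atD v) σ↭)) i) σ-one

      open Finish pre σl (trans perm₁ (++⁺ˡ pre σ↭)) σl-one public

      lQ≤top : lQ ≤ top
      lQ≤top = ≤-trans (≤-trans (≤-reflexive (cong (s₁ +_) (sym lenQ))) (≤-trans (+-monoʳ-≤ s₁ (m≤m+n (length Q) (length τs)))
        (≤-reflexive (Eq.trans (+-assoc s (length M) _) (cong (s +_) (sym (Eq.trans (length-++ M) (cong (length M +_) (length-++ Q)))))))))
        (m≤m+n L (length σl))

      big : ∀ {u} c → u ∈ us → U.# u B + suc c ≡ 2 * k + 2 → X + top < lab (atU u) s (pre ++ σl) + suc c * suc top
      big {u} c i h = begin-strict
        X + top                                            <⟨ ≤-reflexive (sym (+-suc X top)) ⟩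
        X + suc top                                        ≤⟨ +-monoˡ-≤ (suc top) low ⟩
        lab g s (pre ++ σl) + c * suc top + suc top        ≡⟨ e (lab g s (pre ++ σl)) c (suc top) ⟩
        lab g s (pre ++ σl) + suc c * suc top              ∎
        where
        open ≤-Reasoning
        open Zone {E}
        g : E → ℕ
        g = atU u
        p : E → Bool
        p e = eqb (up e) u
        kb ko o : ℕ
        kb = Σl (both p) P
        ko = Σl (one p) P + U.# u M
        o  = U.# u τs + U.# u σs + c
        x : ℕ
        x = suc lQ
        e : ∀ a c t → a + c * t + t ≡ a + (t + c * t)
        e = solve-∀
        cnt : kb + kb + ko + o ≡ 2 * k + 1
        cnt = suc-injective (Eq.trans (Eq.trans (e₁ kb (Σl (one p) P) (U.# u M) (U.# u τs) (U.# u σs) c)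
            (cong (_+ suc c) (sym (Eq.trans (ΣB g) (cong (λ q → U.# u M + (q + U.# u τs) + U.# u σs)
              (Eq.trans (Σl-↭ g (trans H.perm (↭-sym (zone-↭ P)))) (zone-Σ-both p P))))))) (Eq.trans h (+-suc (2 * k) 1)))
          where
          e₁ : ∀ kb o m t σ c → suc (kb + kb + (o + m) + (t + σ + c)) ≡ m + (kb + kb + o + t) + σ + suc c
          e₁ = solve-∀
        -- If `c` is zero, then `u` is heavy and meets an edge σ or τ.
        o≥1 : 1 ≤ o
        o≥1 = lem c h
          where
          lem : ∀ c → U.# u B + suc c ≡ 2 * k + 2 → 1 ≤ U.# u τs + U.# u σs + c
          lem zero h = ≤-trans (hit i (suc-injective (Eq.trans (+-comm 1 _) (Eq.trans h (+-suc (2 * k) 1)))))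
            (≤-reflexive (Eq.trans (+-comm (U.# u σs) _) (sym (+-identityʳ _))))
          lem (suc c) h = ≤-trans (s≤s z≤n) (m≤n+m (suc c) _)
        tail : lab g lQ τs + lab g L σl ≥ (U.# u τs + U.# u σs) * x
        tail = begin
          (U.# u τs + U.# u σs) * x             ≡⟨ *-distribʳ-+ x (U.# u τs) _ ⟩
          U.# u τs * x + U.# u σs * x           ≤⟨ +-mono-≤ (lab-≥ g lQ τs) (≤-trans (*-monoʳ-≤ (U.# u σs) (s≤s lQ≤L))
                                                    (≤-trans (≤-reflexive (cong (_* suc L) (Σl-↭ g σ↭))) (lab-≥ g L σl))) ⟩
          lab g lQ τs + lab g L σl              ∎
          where
          lQ≤L : lQ ≤ L
          lQ≤L = ≤-trans (≤-reflexive (cong (s₁ +_) (sym lenQ))) (≤-trans (+-monoʳ-≤ s₁ (m≤m+n (length Q) (length τs)))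
            (≤-reflexive (Eq.trans (+-assoc s (length M) _) (cong (s +_) (sym (Eq.trans (length-++ M) (cong (length M +_) (length-++ Q))))))))
        low : X ≤ lab g s (pre ++ σl) + c * suc top
        low = begin
          k * S + x                                          ≤⟨ lower-mixed {k} {kb} {ko} {o} {x} {suc s} {S} cnt (single≤1 u) o≥1 S≤2x S≤x+s ⟩
          kb * S + ko * suc s + o * x                        ≡⟨ e₂ (kb * S) (Σl (one p) P) (U.# u M) (suc s) (U.# u τs + U.# u σs) c x ⟩
          U.# u M * suc s + (kb * S + Σl (one p) P * suc s) + (U.# u τs + U.# u σs) * x + c * x
            ≤⟨ +-mono-≤ (+-mono-≤ (+-mono-≤ (lab-≥ g s M) (≤-trans (+-monoʳ-≤ (kb * S) (*-monoʳ-≤ (Σl (one p) P) (s≤s (m≤m+n s (length M))))) (H.mixed p))) tail)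
                 (*-monoʳ-≤ c (s≤s lQ≤top)) ⟩
          lab g s M + lab g s₁ Q + (lab g lQ τs + lab g L σl) + c * suc top ≡⟨ cong (_+ c * suc top) (Eq.trans (e₃ (lab g s M) (lab g s₁ Q) (lab g lQ τs) (lab g L σl))
                 (sym (Eq.trans (lab-++ g s pre σl) (cong (_+ lab g L σl) (lab-pre g))))) ⟩
          lab g s (pre ++ σl) + c * suc top                  ∎
          where
          e₂ : ∀ K o m s t c x → K + (o + m) * s + (t + c) * x ≡ m * s + (K + o * s) + t * x + c * x
          e₂ = solve-∀
          e₃ : ∀ a b c d → a + b + (c + d) ≡ a + (b + c) + d
          e₃ = solve-∀
          S≤2x : S ≤ x + x
          S≤2x = pairSum-≤ s₁ R (≤-trans (m≤m+n s₁ (R + R)) (n≤1+n lQ))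
          S≤x+s : S ≤ x + suc s
          S≤x+s = pairSum-≤ s₁ R (≤-trans (+-monoʳ-≤ s M≤1) (≤-reflexive (+-comm s 1)))

    N₀ : W → ℕ
    N₀ v = w v + lab (atD v) s pre

    small : W → ℕ
    small v = w v + lab (atD v) s M

    small≤ : ∀ v → small v ≤ (z v + D.# v M) * s₁
    small≤ v = ≤-trans (+-mono-≤ (≤-trans (w≤ v) (*-monoʳ-≤ (z v) (m≤m+n s (length M)))) (lab-≤ (atD v) s M)) (≤-reflexive (sym (*-distribʳ-+ s₁ (z v) _)))

    N₀≡ : ∀ v → N₀ v ≡ lab (atD v) s₁ Q + small v + lab (atD v) lQ τs
    N₀≡ v = Eq.trans (cong (w v +_) (lab-pre (atD v))) (e (w v) (lab (atD v) s M) (lab (atD v) s₁ Q) (lab (atD v) lQ τs))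
      where
      e : ∀ a b c d → a + (b + (c + d)) ≡ c + (a + b) + d
      e = solve-∀

    count : ∀ {v} → v ∈ vs → D.# v Q + (z v + D.# v M) + D.# v τs ≡ 2 * k + 1
    count {v} i = suc-injective (Eq.trans (e (D.# v Q) (z v) (D.# v M) (D.# v τs))
        (Eq.trans (cong (λ o → D.# v M + (D.# v Q + D.# v τs) + o + z v) (sym (All.lookup σ-one i)))
        (Eq.trans (cong (_+ z v) (sym (ΣB (atD v)))) (Eq.trans (z+ v) (+-suc (2 * k) 1)))))
      where
      e : ∀ q z m t → suc (q + (z + m) + t) ≡ m + (q + t) + 1 + z
      e = solve-∀

    N-free : ∀ {v} → v ∈ vs → D.# v τs ≡ 0 → N₀ v ≤ k * S + lQ
    N-free {v} i t0 = ≤-trans (≤-reflexive (Eq.trans (N₀≡ v) (Eq.trans (cong (lab (atD v) s₁ Q + small v +_) (lab-0 (atD v) lQ τs t0)) (+-identityʳ _))))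
        (go (H.high′ v))
      where
      cnt : D.# v Q + (z v + D.# v M) ≡ 2 * k + 1
      cnt = Eq.trans (sym (+-identityʳ _)) (Eq.trans (cong (D.# v Q + (z v + D.# v M) +_) (sym t0)) (count i))
      go : High s₁ R Q v → lab (atD v) s₁ Q + small v ≤ k * S + lQ
      go (even κ Dg c _ d q) = upper-even {k} {s₁} {R} {κ} (Eq.trans (cong (_+ (z v + D.# v M)) (sym c)) cnt) d q (small≤ v)
      go (odd κ c q)         = upper-odd {k} {s₁} {R} {κ} (Eq.trans (cong (_+ (z v + D.# v M)) (sym c)) cnt) q (small≤ v)

    N-double : ∀ {v} → v ∈ vs → D.# v τs ≡ 1 → N₀ v ≤ X + 2 * k
    N-double {v} i t1 = begin
      N₀ v                                             ≡⟨ N₀≡ v ⟩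
      lab (atD v) s₁ Q + small v + lab (atD v) lQ τs   ≤⟨ +-mono-≤ (go (H.high′ v)) (≤-trans (lab-≤ (atD v) lQ τs)
                                                          (≤-trans (≤-reflexive (Eq.trans (cong (_* (lQ + length τs)) t1) (+-identityʳ _)))
                                                            (≤-trans (+-monoʳ-≤ lQ p≤1) (≤-reflexive (+-comm lQ 1))))) ⟩
      k * S + 2 * k + suc lQ                           ≡⟨ e (k * S) (2 * k) (suc lQ) ⟩
      X + 2 * k                                        ∎
      where
      open ≤-Reasoning
      e : ∀ a b c → a + b + c ≡ a + c + b
      e = solve-∀
      cnt : D.# v Q + (z v + D.# v M) ≡ 2 * k
      cnt = suc-injective (Eq.trans (+-comm 1 _) (Eq.trans (cong (D.# v Q + (z v + D.# v M) +_) (sym t1)) (Eq.trans (count i) (+-comm _ 1))))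
      go : High s₁ R Q v → lab (atD v) s₁ Q + small v ≤ k * S + 2 * k
      go (even κ Dg c d _ q) = upper-even′ {k} {s₁} {R} {κ} (Eq.trans (cong (_+ (z v + D.# v M)) (sym c)) cnt) d q (small≤ v)
      go (odd κ c q)         = upper-odd′ {k} {s₁} {R} {κ} (Eq.trans (cong (_+ (z v + D.# v M)) (sym c)) cnt) q (small≤ v)

    dnσ : All (λ e → dn e ∈ vs) σs
    dnσ = Allₚ.++⁻ˡ σs (All-resp-↭ split dn∈)

    open Sorting (λ e → N₀ (dn e))

    #-two : ∀ {v v′} xs → v ≢ v′ → D.# v xs + D.# v′ xs ≤ length xs
    #-two [] n = z≤n
    #-two {v} {v′} (e ∷ xs) n = ≤-trans (≤-reflexive (e₁ (δ (dn e) v) (D.# v xs) (δ (dn e) v′) _)) (+-mono-≤ lem (#-two xs n))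
      where
      e₁ : ∀ a b c d → a + b + (c + d) ≡ a + c + (b + d)
      e₁ = solve-∀
      lem : δ (dn e) v + δ (dn e) v′ ≤ 1
      lem with dn e ≟ v | dn e ≟ v′
      ... | yes p | yes q = ⊥-elim (n (Eq.trans (sym p) q))
      ... | yes _ | no _  = ≤-refl
      ... | no _  | yes _ = ≤-refl
      ... | no _  | no _  = z≤n

    -- Only the end point of τ can exceed `X`, say by `d`. Its edge σ is placed `d` positions before
    -- the last one, which makes its final sum exactly `X + top`. All other vertices have at most
    -- `X - 1` before σ and stay below.
    labelling : Labelling
    labelling with any? (λ e → X <? N₀ (dn e)) σs
    ... | no ¬a with sort σs
    ... | σl , σ↭ , so = finish σl σ↭ (X + top σl σ↭) (vals-unique σl σ↭ (L σl σ↭) σl so)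
            (vals-≤ σl σ↭ (L σl σ↭) σl (All-resp-↭ σ↭ (All.map ≮⇒≥ (Allₚ.¬Any⇒All¬ σs ¬a)))) (big σl σ↭)
    labelling | yes a with find a
    ... | e , e∈ , over with ∈⇒↭ e∈
    ... | σ′ , q with sort σ′
    ... | ss , q′ , so = finish σl σ↭ (X + tp) un (subst (All (_≤ X + tp)) (sym (vals-++ σl σ↭ L′ as (e ∷ bs))) (Allₚ.++⁺ (All.map <⇒≤ as<) (≤-reflexive val ∷ All.map <⇒≤ bs<))) (big σl σ↭)
      where
      v₀ = dn e
      v₀∈ : v₀ ∈ vs
      v₀∈ = All.lookup dnσ e∈
      τ1 : D.# v₀ τs ≡ 1
      τ1 with D.# v₀ τs in t | τ-le v₀
      ... | suc zero    | _ = refl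
      ... | suc (suc _) | s≤s ()
      ... | zero        | _ = ⊥-elim (<-irrefl refl (<-≤-trans over (≤-trans (N-free v₀∈ t) (+-monoʳ-≤ (k * S) (n≤1+n lQ)))))
      d = N₀ v₀ ∸ X
      d≤ : d ≤ 2 * k
      d≤ = m≤n+o⇒m∸n≤o _ X (N-double v₀∈ τ1)
      d+X : X + d ≡ N₀ v₀
      d+X = m+[n∸m]≡n (<⇒≤ over)
      -- There are enough positions for the shift by `d ≤ 2 * k`: with a τ present, `few` yields
      -- `2 * k + 1` full vertices, each with an edge σ.
      σs≥ : suc (2 * k) ≤ length σs
      σs≥ = begin
        suc (2 * k)                         ≡⟨ Eq.trans (+-comm 1 _) (sym (*-identityʳ _)) ⟩
        (2 * k + 1) * 1                     ≤⟨ *-monoʳ-≤ (2 * k + 1) (≤-trans (≤-reflexive (sym τ1)) (≤-trans (m≤m+n _ _) (≤-trans (≤-reflexive (sym (Σl-+ (atD v₀) (λ _ → 0) τs))) (≤-trans (Σl-mono (All.universal (λ a → ≤-trans (≤-reflexive (+-identityʳ _)) (δ-≤1 (dn a) v₀)) τs)) (≤-reflexive (Σl-one τs)))))) ⟩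
        (2 * k + 1) * length τs             ≤⟨ few ⟩
        Σl (λ v → bit (full v)) vs          ≤⟨ Σl-mono (All.map (λ {v} i → ≤-trans (bit≤1 (full v)) (≤-reflexive (sym i))) σ-one) ⟩
        Σl (λ v → D.# v σs) vs              ≡⟨ Σl-swap (λ v a → δ (dn a) v) vs σs ⟩
        Σl (λ a → Σl (λ v → δ (dn a) v) vs) σs ≡⟨ Σl-cong (All.map (λ i → Eq.trans (Σl-cong′ (λ v → sym (+-identityʳ _)) vs) (Σδ-∈ (λ _ → 1) vs! i)) dnσ) ⟩
        Σl (λ _ → 1) σs                     ≡⟨ Σl-one σs ⟩
        length σs                           ∎
        where
        open ≤-Reasoning
      lenss : suc (length ss) ≡ length σs
      lenss = sym (Eq.trans (↭-length q) (cong suc (↭-length q′)))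
      d≤ss : d ≤ length ss
      d≤ss = ≤-trans d≤ (≤-pred (≤-trans σs≥ (≤-reflexive (sym lenss))))
      as = take (length ss ∸ d) ss
      bs = drop (length ss ∸ d) ss
      ab : as ++ bs ≡ ss
      ab = take++drop≡id (length ss ∸ d) ss
      lenb : length bs ≡ d
      lenb = Eq.trans (length-drop (length ss ∸ d) ss) (m∸[m∸n]≡n d≤ss)
      σl = as ++ e ∷ bs
      σ↭ : σs ↭ σl
      σ↭ = trans q (trans (prep e (trans q′ (subst (ss ↭_) (sym ab) ↭-refl))) (↭-sym (shift e as bs)))
      L′ = L σl σ↭
      tp = top σl σ↭
      tp≡ : suc (L′ + length as) + d ≡ tp
      tp≡ = Eq.trans (e₁ L′ (length as) d) (cong (L′ +_) (Eq.trans (cong (λ b → length as + suc b) (sym lenb)) (sym (length-++ as))))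
        where
        e₁ : ∀ l a d → suc (l + a) + d ≡ l + (a + suc d)
        e₁ = solve-∀
      val : N₀ v₀ + suc (L′ + length as) ≡ X + tp
      val = Eq.trans (cong (_+ suc (L′ + length as)) (sym d+X)) (Eq.trans (e₁ X d (suc (L′ + length as))) (cong (X +_) tp≡))
        where
        e₁ : ∀ x d l → x + d + l ≡ x + (l + d)
        e₁ = solve-∀
      othersσ : All (λ a → N₀ (dn a) ≤ k * S + lQ) σ′
      othersσ = All.tabulate λ {a} a∈ → N-free (All.lookup dnσ (∈-resp-↭ (↭-sym q) (there a∈))) (free a a∈)
        where
        neq : ∀ a → a ∈ σ′ → v₀ ≢ dn a
        neq a a∈ r = <-irrefl refl (≤-trans (≤-trans (s≤s (subst (λ v → 1 ≤ D.# v σ′) (sym r) (D.#-∈ a∈)))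
           (≤-reflexive (Eq.trans (cong (_+ D.# v₀ σ′) (sym (δ-≡ {v₀} refl))) (sym (Σl-↭ (atD v₀) q))))) (σ-le v₀))
        free : ∀ a → a ∈ σ′ → D.# (dn a) τs ≡ 0
        free a a∈ = n≤0⇒n≡0 (≤-pred (≤-trans (≤-reflexive (cong (_+ D.# (dn a) τs) (sym τ1))) (≤-trans (#-two τs (neq a a∈)) p≤1)))
      others : All (λ a → N₀ (dn a) ≤ k * S + lQ) (as ++ bs)
      others = subst (All _) (sym ab) (All-resp-↭ q′ othersσ)
      as< : All (_< X + tp) (vals σl σ↭ L′ as)
      as< = All.map (λ i → ≤-<-trans i (+-mono-<-≤ (+-monoʳ-< (k * S) ≤-refl) (≤-trans (≤-trans (n≤1+n _) (m≤m+n _ d)) (≤-reflexive tp≡)))) (vals-≤ σl σ↭ L′ as (Allₚ.++⁻ˡ as others))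
      bs< : All (_< X + tp) (vals σl σ↭ (suc (L′ + length as)) bs)
      bs< = All.map (λ i → ≤-<-trans i (+-mono-<-≤ (+-monoʳ-< (k * S) ≤-refl) (≤-reflexive (Eq.trans (cong (suc (L′ + length as) +_) lenb) tp≡)))) (vals-≤ σl σ↭ (suc (L′ + length as)) bs (Allₚ.++⁻ʳ as others))
      un : Unique (vals σl σ↭ L′ σl)
      un = vals-insert σl σ↭ L′ as e bs (subst Sorted (sym ab) so)
        (subst (λ m → All (_< m) (vals σl σ↭ L′ as)) (sym val) as<) (subst (λ m → All (_< m) (vals σl σ↭ (suc (L′ + length as)) bs)) (sym val) bs<)

  -- Several edges τ.  The lower end points are balanced exactly, up to one leftover edge.  The
  -- leftover edges C ++ τs, at vertices all of whose edges are in B, get consecutive labels.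
  -- Their vertices get the labels of σs in an order rotated by half: the sums of the two labels
  -- then have different parities in the two halves, and a smaller maximum than if sorted.
  module Many (ch : Chosen) (k≥1 : 1 ≤ k) (t₀ : E) (τ′ : List E) (τs≡ : Chosen.τs ch ≡ t₀ ∷ τ′) (τ′≥1 : 1 ≤ length τ′) where
    open Chosen ch

    splitBy : ∀ {P : E → Set} → (∀ e → Dec (P e)) → ∀ xs → Σ[ as ∈ List E ] Σ[ bs ∈ List E ] (xs ↭ as ++ bs × All (λ e → ¬ P e) as × All P bs)
    splitBy P? [] = [] , [] , ↭-refl , [] , []
    splitBy P? (x ∷ xs) with splitBy P? xs | P? x
    ... | as , bs , q , ps , qs | yes p = as , x ∷ bs , trans (prep x q) (↭-sym (shift x as bs)) , ps , p ∷ qs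
    ... | as , bs , q , ps , qs | no p  = x ∷ as , bs , prep x q , p ∷ ps , qs

    p : ℕ
    p = length τs

    p≥2 : 2 ≤ p
    p≥2 = ≤-trans (s≤s τ′≥1) (≤-reflexive (cong length (sym τs≡)))

    -- C is truncated so that length (C ++ τs) is odd, as the rotation requires.
    record Setup : Set where
      field
        P        : List (E × E)
        Λ low C  : List E
        h        : ℕ
        perm     : rest ↭ flat P ++ Λ
        same     : All (λ a → dn (proj₁ a) ≡ dn (proj₂ a)) P
        Λ≤1      : ∀ v → D.# v Λ ≤ 1
        split-Λ  : Λ ↭ low ++ C
        C-full   : All (λ e → D.# (dn e) B ≡ 2 * k + 2) C
        size     : length C + p ≡ suc (h + h)
        enough   : (2 * k + 1) * p ≤ suc (suc (h + h))

    length≥# : ∀ xs → Σl (λ v → D.# v xs) vs ≤ length xs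
    length≥# xs = ≤-trans (≤-reflexive (Σl-swap (λ v a → δ (dn a) v) vs xs)) (≤-trans (Σl-mono (All.universal le xs)) (≤-reflexive (Σl-one xs)))
      where
      le : ∀ a → Σl (λ v → δ (dn a) v) vs ≤ 1
      le a with any? (dn a ≟_) vs
      ... | yes i = ≤-reflexive (Eq.trans (Σl-cong′ (λ v → sym (+-identityʳ _)) vs) (Σδ-∈ (λ _ → 1) vs! i))
      ... | no i  = ≤-trans (≤-reflexive (Eq.trans (Σl-cong′ (λ v → sym (+-identityʳ _)) vs) (Σδ-∉ (λ _ → 1) (dn a) (Allₚ.¬Any⇒All¬ vs i)))) z≤n

    #flat : ∀ v {P} → All (λ a → dn (proj₁ a) ≡ dn (proj₂ a)) P → ∃[ κ ] D.# v (flat P) ≡ κ + κ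
    #flat v [] = 0 , refl
    #flat v (_∷_ {a , b} i is) with #flat v is
    ... | κ , q = δ (dn b) v + κ , Eq.trans (cong₂ (λ x y → δ x v + (δ (dn b) v + y)) i q) (e (δ (dn b) v) κ)
      where
      e : ∀ d κ → d + (d + (κ + κ)) ≡ d + κ + (d + κ)
      e = solve-∀

    -- Besides σ there are `2 * k + 1` edges, all paired but at most one in `Λ` and one in `τs`. By
    -- parity exactly one is unpaired.
    full-one : ∀ {P Λ} → rest ↭ flat P ++ Λ → All (λ a → dn (proj₁ a) ≡ dn (proj₂ a)) P → (∀ v → D.# v Λ ≤ 1) →
               ∀ {v} → v ∈ vs → D.# v B ≡ 2 * k + 2 → D.# v Λ + D.# v τs ≡ 1 × D.# v (flat P) ≡ k + k
    full-one {P} {Λ} q same le {v} i f with #flat v same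
    ... | κ , κ≡ with one-of-two {k} {κ} (suc-injective (Eq.trans cnt (+-suc (2 * k) 1))) (le v) (τ-le v)
      where
      cnt : suc (κ + κ + (D.# v Λ + D.# v τs)) ≡ 2 * k + 2
      cnt = Eq.trans (cong₂ (λ s f → s + (f + (D.# v Λ + D.# v τs))) (sym (All.lookup σ-one i)) (sym κ≡))
        (Eq.trans (e (D.# v σs) (D.# v (flat P)) (D.# v Λ) (D.# v τs))
          (Eq.trans (sym (Eq.trans (Σl-↭ (atD v) split) (Eq.trans (Σl-++ (atD v) σs (τs ++ rest)) (cong (D.# v σs +_)
            (Eq.trans (Σl-++ (atD v) τs rest) (cong (D.# v τs +_) (Eq.trans (Σl-↭ (atD v) q) (Σl-++ (atD v) (flat P) Λ)))))))) f))
        where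
        e : ∀ s f l t → s + (f + (l + t)) ≡ s + (t + (f + l))
        e = solve-∀
    ... | r , refl = r , κ≡

    setup : Setup
    setup with D.pairUp rest
    ... | P , Λ , q , same , le with splitBy (λ e → full? (dn e)) Λ
    ... | as , bs , q′ , nas , fbs = go (parity (length bs + p))
      where
      enough′ : (2 * k + 1) * p ≤ length bs + p
      enough′ = ≤-trans few (≤-trans (Σl-mono (All.tabulate per)) (≤-trans (≤-reflexive (Σl-+ (λ v → D.# v bs) (λ v → D.# v τs) vs)) (+-mono-≤ (length≥# bs) (length≥# τs))))
        where
        per : ∀ {v} → v ∈ vs → bit (full v) ≤ D.# v bs + D.# v τs
        per {v} i with full? v
        ... | no _  = z≤n
        ... | yes f = ≤-reflexive (Eq.trans (sym (proj₁ (full-one q same le i f))) (cong (_+ D.# v τs) (Eq.trans (Σl-↭ (atD v) q′) (Eq.trans (Σl-++ (atD v) as bs) (cong (_+ D.# v bs) (none nas))))))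
          where
          none : ∀ {xs} → All (λ e → ¬ D.# (dn e) B ≡ 2 * k + 2) xs → D.# v xs ≡ 0
          none [] = refl
          none (n ∷ ns) = cong₂ _+_ (δ-≢ (λ { refl → n f })) (none ns)
      parity : ∀ n → (∃[ h ] n ≡ suc (h + h)) ⊎ (∃[ h ] n ≡ h + h)
      parity zero = inj₂ (0 , refl)
      parity (suc n) with parity n
      ... | inj₁ (h , refl) = inj₂ (suc h , cong suc (sym (+-suc h h)))
      ... | inj₂ (h , refl) = inj₁ (h , refl)
      go : _ → Setup
      go (inj₁ (h , r)) = record { P = P ; Λ = Λ ; low = as ; C = bs ; h = h ; perm = q ; same = same ; Λ≤1 = le ; split-Λ = q′ ; C-full = fbs
        ; size = r ; enough = ≤-trans enough′ (≤-trans (≤-reflexive r) (n≤1+n _)) }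
      go (inj₂ (zero , r)) with () ← ≤-trans p≥2 (≤-trans (m≤n+m p (length bs)) (≤-reflexive r))
      go (inj₂ (suc h , r)) = dropOne bs fbs q′ r enough′
        where
        dropOne : ∀ bs → All (λ e → D.# (dn e) B ≡ 2 * k + 2) bs → Λ ↭ as ++ bs → length bs + p ≡ suc h + suc h → (2 * k + 1) * p ≤ length bs + p → Setup
        -- There is an edge to drop, since otherwise `(2 * k + 1) * p ≤ p`.
        dropOne [] _ _ _ en = ⊥-elim (<-irrefl refl (<-≤-trans (m<n+m p {2 * k * p} (*-mono-≤ {1} {2 * k} {1} {p} (≤-trans k≥1 (m≤m+n k _)) (≤-trans (s≤s z≤n) p≥2))) (≤-trans (≤-reflexive (e k p)) en)))
          where
          e : ∀ k p → 2 * k * p + p ≡ (2 * k + 1) * p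
          e = solve-∀
        dropOne (b ∷ bs) (_ ∷ fbs) q″ r en = record { P = P ; Λ = Λ ; low = b ∷ as ; C = bs ; h = h ; perm = q ; same = same ; Λ≤1 = le
          ; split-Λ = trans q″ (shift b as bs) ; C-full = fbs ; size = suc-injective (Eq.trans r (cong suc (+-suc h h)))
          ; enough = ≤-trans en (≤-reflexive (Eq.trans r (cong suc (+-suc h h)))) }

    abstract
      setup′ : Setup
      setup′ = setup

    open Setup setup′

    R lQ S K l′ : ℕ
    R = length P
    lQ = s + (R + R)
    S = pairSum s R
    K = k * S
    l′ = lQ + length low

    open ZoneBounds _≟_ up using (Low; even; odd; LowZone; lowZone)

    abstract
      zoned : LowZone (up t₀) s P
      -- The vertex without deficit is the upper end of the first τ, whose label may be too small to
      -- cover one.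
      zoned = lowZone (up t₀) s P

    module Z = LowZone zoned
    Q = Z.Q

    Ce : List E
    Ce = C ++ τs

    pre : List E
    pre = Q ++ (low ++ Ce)

    lenQ : length Q ≡ R + R
    lenQ = Eq.trans (↭-length Z.perm) (length-flat P)

    perm₁ : B ↭ pre ++ σs
    perm₁ = trans split (trans (++-comm σs (τs ++ rest)) (++⁺ʳ σs (trans (++-comm τs rest)
      (trans (++⁺ʳ τs (trans perm (++⁺ (↭-sym Z.perm) split-Λ)))
        (subst ((Q ++ (low ++ C)) ++ τs ↭_) (Eq.trans (++-assoc Q (low ++ C) τs) (cong (Q ++_) (++-assoc low C τs))) ↭-refl)))))

    lenCe : length Ce ≡ suc (h + h)
    lenCe = Eq.trans (length-++ C) size

    N : W → ℕ
    N v = w v + lab (atD v) s pre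

    lab-pre : ∀ (g : E → ℕ) → lab g s pre ≡ lab g s Q + (lab g lQ low + lab g l′ Ce)
    lab-pre g = Eq.trans (lab-++ g s Q (low ++ Ce)) (cong (lab g s Q +_) (Eq.trans (cong (λ l → lab g (s + l) (low ++ Ce)) lenQ) (lab-++ g lQ low Ce)))

    ΣB : ∀ (g : E → ℕ) → Σl g B ≡ Σl g Q + (Σl g low + (Σl g C + Σl g τs)) + Σl g σs
    ΣB g = Eq.trans (Σl-↭ g perm₁) (Eq.trans (Σl-++ g pre σs) (cong (_+ Σl g σs) (Eq.trans (Σl-++ g Q (low ++ Ce))
      (cong (Σl g Q +_) (Eq.trans (Σl-++ g low Ce) (cong (Σl g low +_) (Σl-++ g C τs)))))))

    #Λ : ∀ v → D.# v Λ ≡ D.# v low + D.# v C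
    #Λ v = Eq.trans (Σl-↭ (atD v) split-Λ) (Σl-++ (atD v) low C)

    exactQ : ∀ v → ∃[ κ ] (D.# v Q ≡ κ + κ × lab (atD v) s Q ≡ κ * S)
    exactQ v = Z.exact (atD v) (All.map (cong (λ x → δ x v)) same)

    in-vs : ∀ {e} → e ∈ rest ⊎ e ∈ τs → dn e ∈ vs
    in-vs (inj₁ i) = All.lookup dn∈ (∈-resp-↭ (↭-sym split) (∈-++⁺ʳ σs (∈-++⁺ʳ τs i)))
    in-vs (inj₂ i) = All.lookup dn∈ (∈-resp-↭ (↭-sym split) (∈-++⁺ʳ σs (∈-++⁺ˡ i)))

    C⊆rest : ∀ {e} → e ∈ C → e ∈ rest
    C⊆rest i = ∈-resp-↭ (↭-sym perm) (∈-++⁺ʳ (flat P) (∈-resp-↭ (↭-sym split-Λ) (∈-++⁺ʳ low i)))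

    Ce-spec : ∀ {e} → e ∈ Ce → dn e ∈ vs × D.# (dn e) B ≡ 2 * k + 2
    Ce-spec i with ∈-++⁻ C i
    ... | inj₁ j = in-vs (inj₁ (C⊆rest j)) , All.lookup C-full j
    ... | inj₂ j = in-vs (inj₂ j) , τ-full _ (D.#-∈ j)

    Ce-vertex : ∀ {e} → e ∈ Ce → D.# (dn e) low ≡ 0 × D.# (dn e) Ce ≡ 1
    Ce-vertex {e} i with Ce-spec i
    ... | v∈ , f = l0 , ≤-antisym (≤-trans (m≤n+m _ (D.# (dn e) low)) (≤-reflexive tot)) (D.#-∈ i)
      where
      tot : D.# (dn e) low + D.# (dn e) Ce ≡ 1
      tot = Eq.trans (cong (D.# (dn e) low +_) (Σl-++ (atD (dn e)) C τs)) (Eq.trans (sym (+-assoc (D.# (dn e) low) _ _))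
        (Eq.trans (cong (_+ D.# (dn e) τs) (sym (#Λ (dn e)))) (proj₁ (full-one perm same Λ≤1 v∈ f))))
      l0 : D.# (dn e) low ≡ 0
      l0 = n≤0⇒n≡0 (≤-pred (≤-trans (≤-trans (≤-reflexive (+-comm 1 _)) (+-monoʳ-≤ (D.# (dn e) low) (D.#-∈ i))) (≤-reflexive tot)))

    Ce≤1 : ∀ v → D.# v Ce ≤ 1
    Ce≤1 v with D.remove v Ce
    ... | inj₁ (e , _ , q , refl) = ≤-reflexive (proj₂ (Ce-vertex (∈-resp-↭ (↭-sym q) (here refl))))
    ... | inj₂ z = ≤-trans (≤-reflexive z) z≤n

    -- A full vertex has no earlier labels; before σ it has `k` exact pairs and its one edge in
    -- `Ce`. So the sums of these vertices are consecutive numbers, in the order of `Ce`.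
    N-Ce : ∀ {e} → e ∈ Ce → N (dn e) ≡ K + lab (atD (dn e)) l′ Ce
    N-Ce {e} i with Ce-spec i | exactQ (dn e)
    ... | v∈ , f | κ , #Q , labQ = begin
      w v + lab (atD v) s pre                              ≡⟨ cong₂ _+_ w0 (lab-pre (atD v)) ⟩
      lab (atD v) s Q + (lab (atD v) lQ low + lab (atD v) l′ Ce) ≡⟨ cong₂ _+_ (Eq.trans labQ (cong (_* S) κ≡k)) (cong (_+ lab (atD v) l′ Ce) (lab-0 (atD v) lQ low (proj₁ (Ce-vertex i)))) ⟩
      K + lab (atD v) l′ Ce                                ∎
      where
      open ≡-Reasoning
      v = dn e
      κ≡k : κ ≡ k
      κ≡k = *-cancelˡ-≡ κ k 2 (Eq.trans (d κ) (Eq.trans (sym #Q) (Eq.trans (Σl-↭ (atD v) Z.perm) (Eq.trans (proj₂ (full-one perm same Λ≤1 v∈ f)) (sym (d k))))))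
        where
        d : ∀ n → 2 * n ≡ n + n
        d n = cong (n +_) (+-identityʳ n)
      w0 : w v ≡ 0
      w0 = n≤0⇒n≡0 (≤-trans (w≤ v) (≤-reflexive (cong (_* s) (+-cancelˡ-≡ (D.# v B) (z v) 0 (Eq.trans (z+ v) (Eq.trans (sym f) (sym (+-identityʳ _))))))))

    N-low : ∀ {v} → v ∈ vs → D.# v Ce ≡ 0 → N v ≤ K + l′
    N-low {v} i c0 with exactQ v
    ... | κ , #Q , labQ = begin
      w v + lab (atD v) s pre                ≡⟨ cong (w v +_) (Eq.trans (lab-pre (atD v)) (cong₂ _+_ labQ (Eq.trans (cong (lab (atD v) lQ low +_) (lab-0 (atD v) l′ Ce c0)) (+-identityʳ _)))) ⟩
      w v + (κ * S + lab (atD v) lQ low)     ≡⟨ e (w v) (κ * S) (lab (atD v) lQ low) ⟩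
      κ * S + w v + lab (atD v) lQ low       ≤⟨ go (D.# v low) refl ⟩
      K + l′                                 ∎
      where
      open ≤-Reasoning
      e : ∀ a b c → a + (b + c) ≡ b + a + c
      e = solve-∀
      cnt : κ + κ + (D.# v low + z v) ≡ 2 * k + 1
      cnt = suc-injective (Eq.trans (e₁ (κ + κ) (D.# v low) (z v)) (Eq.trans (cong₂ (λ q o → q + (D.# v low + 0) + o + z v) (sym #Q) (sym (All.lookup σ-one i)))
        (Eq.trans (cong (λ c → D.# v Q + (D.# v low + c) + D.# v σs + z v) (sym (Eq.trans (sym (Σl-++ (atD v) C τs)) c0)))
          (Eq.trans (cong (_+ z v) (sym (ΣB (atD v)))) (Eq.trans (z+ v) (+-suc (2 * k) 1))))))
        where
        e₁ : ∀ q l z → suc (q + (l + z)) ≡ q + (l + 0) + 1 + z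
        e₁ = solve-∀
      low≤ : D.# v low ≤ 1
      low≤ = ≤-trans (≤-trans (m≤m+n _ _) (≤-reflexive (sym (#Λ v)))) (Λ≤1 v)
      go : ∀ m → D.# v low ≡ m → κ * S + w v + lab (atD v) lQ low ≤ K + l′
      go zero m = ≤-trans (≤-reflexive (Eq.trans (cong (κ * S + w v +_) (lab-0 (atD v) lQ low m)) (+-identityʳ _)))
        (≤-trans (upper-even {k} {s} {R} {κ} {0} {z v} (Eq.trans (cong (λ m → κ + κ + (m + z v)) (sym m)) cnt) z≤n (≤-reflexive (sym (+-identityʳ _))) (w≤ v))
          (+-monoʳ-≤ K (m≤m+n lQ (length low))))
      go (suc zero) m = +-mono-≤ (upper-exact {k} {s} {R} {κ} {z v} (suc-injective (Eq.trans (sym (+-suc (κ + κ) (z v))) (Eq.trans (Eq.trans (cong (λ m → κ + κ + (m + z v)) (sym m)) cnt) (+-comm _ 1)))) (w≤ v))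
        (≤-trans (lab-≤ (atD v) lQ low) (≤-reflexive (Eq.trans (cong (_* l′) m) (+-identityʳ l′))))
      go (suc (suc _)) m with s≤s () ← ≤-trans (≤-reflexive (sym m)) low≤

    -- With the last labels given in the order `T ++ O`, the final sums of the two parts interlace
    -- and fill an interval of `2 * h + 1` consecutive numbers. Distinct sums with the same total
    -- cannot have a smaller maximum.
    O T : List E
    O = take (suc h) Ce
    T = drop (suc h) Ce

    O++T : O ++ T ≡ Ce
    O++T = take++drop≡id (suc h) Ce

    lenT : length T ≡ h
    lenT = Eq.trans (length-drop (suc h) Ce) (Eq.trans (cong (_∸ suc h) lenCe) (m+n∸m≡n h h))

    lenO : length O ≡ suc h
    lenO = +-cancelʳ-≡ h _ _ (Eq.trans (cong (length O +_) (sym lenT)) (Eq.trans (sym (length-++ O)) (Eq.trans (cong length O++T) lenCe)))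

    #TO : ∀ v → D.# v (T ++ O) ≡ D.# v Ce
    #TO v = Eq.trans (Σl-↭ (atD v) (++-comm T O)) (cong (D.# v) O++T)

    fibres! : ∀ xs → (∀ v → D.# v xs ≤ 1) → Unique (map dn xs)
    fibres! [] _ = []
    fibres! (x ∷ xs) le = Allₚ.map⁺ (All.tabulate λ {y} i q → <-irrefl refl (≤-trans (s≤s (subst (λ v → 1 ≤ D.# v xs) (sym q) (D.#-∈ i)))
        (≤-trans (≤-reflexive (cong (_+ D.# (dn x) xs) (sym (δ-≡ {dn x} refl)))) (le (dn x)))))
      ∷ fibres! xs (λ v → ≤-trans (m≤n+m _ (δ (dn x) v)) (le v))

    record Last : Set where
      field
        sl σC   : List E
        perm₂   : σs ↭ sl ++ σC
        sorted  : Sorting.Sorted (λ e → N (dn e)) sl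
        follows : map dn σC ≡ map dn (T ++ O)
        sl-low  : All (λ e → N (dn e) ≤ K + l′) sl

    last : Last
    last with D.extract (map dn (T ++ O)) σs (fibres! (T ++ O) (λ v → ≤-trans (≤-reflexive (#TO v)) (Ce≤1 v)))
                (Allₚ.map⁺ (All.tabulate (λ {e} i → ≤-reflexive (sym (All.lookup σ-one (proj₁ (Ce-spec (back i))))))))
      where
      back : ∀ {e} → e ∈ T ++ O → e ∈ Ce
      back {e} i = subst (e ∈_) O++T (∈-resp-↭ (++-comm T O) i)
    ... | σC , σlow , q , fo with Sorting.sort (λ e → N (dn e)) σlow
    ... | sl , q′ , so = record { sl = sl ; σC = σC ; perm₂ = trans q (trans (++-comm σC σlow) (++⁺ʳ σC q′)) ; sorted = so ; follows = fo
          ; sl-low = All-resp-↭ q′ (All.tabulate lw) }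
      where
      #σC : ∀ v → D.# v σC ≡ D.# v Ce
      #σC v = Eq.trans (sym (Σl-map (λ x → δ x v) dn σC)) (Eq.trans (cong (Σl (λ x → δ x v)) fo) (Eq.trans (Σl-map (λ x → δ x v) dn (T ++ O)) (#TO v)))
      lw : ∀ {e} → e ∈ σlow → N (dn e) ≤ K + l′
      lw {e} i = N-low (All.lookup dn∈ (∈-resp-↭ (↭-sym split) (∈-++⁺ˡ (∈-resp-↭ (↭-sym q) (∈-++⁺ʳ σC i)))))
        (n≤0⇒n≡0 (≤-pred (≤-trans (≤-trans (≤-reflexive (Eq.trans (+-comm 1 _) (cong (_+ 1) (sym (#σC (dn e)))))) (+-monoʳ-≤ (D.# (dn e) σC) (D.#-∈ i)))
          (≤-trans (≤-reflexive (sym (Eq.trans (Σl-↭ (atD (dn e)) q) (Σl-++ (atD (dn e)) σC σlow)))) (σ-le (dn e))))))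

    open Last last

    σl : List E
    σl = sl ++ σC

    σl-one : All (λ v → D.# v σl ≡ 1) vs
    σl-one = All.map (λ {v} i → Eq.trans (sym (Σl-↭ (atD v) perm₂)) i) σ-one

    module F = Finish pre σl (trans perm₁ (++⁺ˡ pre perm₂)) σl-one
    open Values _≟_ dn N
    open Progression _≟_ dn N

    L L₂ X : ℕ
    L = s + length pre
    L₂ = L + length sl
    X = K + l′ + L₂

    L≡ : L ≡ l′ + suc (h + h)
    L≡ = Eq.trans (cong (s +_) (Eq.trans (length-++ Q) (cong₂ _+_ lenQ (Eq.trans (length-++ low) (cong (length low +_) lenCe)))))
      (e s (R + R) (length low) (suc (h + h)))
      where
      e : ∀ s r l c → s + (r + (l + c)) ≡ s + r + l + c
      e = solve-∀

    lenσC : length σC ≡ suc (h + h)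
    lenσC = Eq.trans (sym (length-map dn σC)) (Eq.trans (cong length follows) (Eq.trans (length-map dn (T ++ O)) (Eq.trans (length-++ T) (Eq.trans (cong₂ _+_ lenT lenO) (+-suc h h)))))

    top≡ : F.top ≡ L₂ + suc (h + h)
    top≡ = Eq.trans (cong (L +_) (length-++ sl)) (Eq.trans (sym (+-assoc L (length sl) (length σC))) (cong (L₂ +_) lenσC))

    vals≡ : vals L σl ≡ vals L sl ++ (vals L₂ T ++ vals (L₂ + h) O)
    vals≡ = Eq.trans (vals-++ L sl σC) (cong (vals L sl ++_) (Eq.trans (vals-map L₂ σC (T ++ O) follows)
      (Eq.trans (vals-++ L₂ T O) (cong (λ l → vals L₂ T ++ vals (L₂ + l) O) lenT))))

    progs : Prog (K + l′) O × Prog (K + l′ + suc h) T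
    progs = let a , b = prog-++ O (subst (Prog (K + l′)) (sym O++T) (labelled-prog K l′ Ce Ce≤1 (All.tabulate N-Ce)))
            in a , subst (λ o → Prog (K + l′ + o) T) lenO b

    sl-vals : All (_≤ X) (vals L sl)
    sl-vals = vals-≤ L sl sl-low

    T-vals : All (λ x → ∃[ j ] (j < h × x ≡ X + h + 2 + suc (j + j))) (vals L₂ T)
    T-vals = All.map (λ { (j , j< , q) → j , subst (j <_) lenT j< , Eq.trans q (e (K + l′) h L₂ j) }) (prog-vals L₂ (proj₂ progs))
      where
      e : ∀ a h l j → a + suc h + l + 2 + (j + j) ≡ a + l + h + 2 + suc (j + j)
      e = solve-∀

    O-vals : All (λ x → ∃[ j ] (j < suc h × x ≡ X + h + 2 + (j + j))) (vals (L₂ + h) O)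
    O-vals = All.map (λ { (j , j< , q) → j , subst (j <_) lenO j< , Eq.trans q (e (K + l′) h L₂ j) }) (prog-vals (L₂ + h) (proj₁ progs))
      where
      e : ∀ a h l j → a + (l + h) + 2 + (j + j) ≡ a + l + h + 2 + (j + j)
      e = solve-∀

    M : ℕ
    M = X + h + 2 + (h + h)

    vals! : Unique (vals L σl)
    vals! = subst Unique (sym vals≡) (AllPairsₚ.++⁺ (vals-unique L sl sorted)
      (AllPairsₚ.++⁺ (vals-unique L₂ T (prog-sorted (proj₂ progs))) (vals-unique (L₂ + h) O (prog-sorted (proj₁ progs)))
        (All.map (λ { (i , _ , p) → All.map (λ { (j , _ , q) r → odd≢even i j (+-cancelˡ-≡ (X + h + 2) _ _ (Eq.trans (sym p) (Eq.trans r q))) }) O-vals }) T-vals))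
      (All.map (λ i → Allₚ.++⁺ (All.map (λ { (j , _ , q) r → above i (suc (j + j)) (Eq.trans r q) }) T-vals)
                              (All.map (λ { (j , _ , q) r → above i (j + j) (Eq.trans r q) }) O-vals)) sl-vals))
      where
      odd≢even : ∀ i j → suc (i + i) ≢ j + j
      odd≢even i zero ()
      odd≢even zero (suc j) p with () ← Eq.trans (suc-injective p) (+-suc j j)
      odd≢even (suc i) (suc j) p = odd≢even i j (suc-injective (suc-injective (Eq.trans (cong (λ z → suc (suc z)) (sym (+-suc i i))) (Eq.trans p (cong suc (+-suc j j))))))
      above : ∀ {x} → x ≤ X → ∀ j → x ≢ X + h + 2 + j
      above {x} i j q = <-irrefl refl (<-≤-trans (≤-<-trans (≤-trans (≤-reflexive (sym q)) i) (m<m+n X {suc h + 1 + j} (s≤s z≤n))) (≤-reflexive (e X h j)))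
        where
        e : ∀ x h j → x + (suc h + 1 + j) ≡ x + h + 2 + j
        e = solve-∀

    vals≤M : All (_≤ M) (vals L σl)
    vals≤M = subst (All (_≤ M)) (sym vals≡) (Allₚ.++⁺ (All.map (λ i → ≤-trans i (≤-trans (m≤m+n X (h + 2 + (h + h))) (≤-reflexive (e X h)))) sl-vals)
      (Allₚ.++⁺ (All.map (λ { (j , j< , q) → ≤-trans (≤-reflexive q) (+-monoʳ-≤ (X + h + 2) (+-mono-≤ j< (<⇒≤ j<))) }) T-vals)
                (All.map (λ { (j , s≤s j≤ , q) → ≤-trans (≤-reflexive q) (+-monoʳ-≤ (X + h + 2) (+-mono-≤ j≤ j≤)) }) O-vals)))
      where
      e : ∀ x h → x + (h + 2 + (h + h)) ≡ x + h + 2 + (h + h)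
      e = solve-∀

    room : p + 2 * k ≤ suc (suc h)
    room = size-bound k p h k≥1 p≥2 enough

    lτ x : ℕ
    lτ = l′ + length C
    x = suc lQ

    lτ+p : lτ + p ≡ l′ + suc (h + h)
    lτ+p = Eq.trans (+-assoc l′ (length C) p) (cong (l′ +_) size)

    lQ≤l′ : lQ ≤ l′
    lQ≤l′ = m≤m+n lQ (length low)

    l′≤lτ : l′ ≤ lτ
    l′≤lτ = m≤m+n l′ (length C)

    lτ≤L : lτ ≤ L
    lτ≤L = ≤-trans (m≤m+n lτ p) (≤-reflexive (Eq.trans lτ+p (sym L≡)))

    -- An upper vertex needs one label of at least `l′ + suc h`, or `2 * k` more to cover a deficit
    -- of its pairs. The stronger bound is shown for the labels from σ on and for `τ′`, the weaker
    -- one for `t₀`.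
    room-top : l′ + suc h + 2 * k ≤ suc L
    room-top = ≤-trans (+-monoʳ-≤ (l′ + suc h) (≤-pred (≤-pred (≤-trans (+-monoˡ-≤ (2 * k) p≥2) room))))
      (≤-trans (≤-reflexive (e l′ h)) (≤-trans (≤-reflexive (sym L≡)) (n≤1+n L)))
      where
      e : ∀ l h → l + suc h + h ≡ l + suc (h + h)
      e = solve-∀

    room-τ′ : l′ + suc h + 2 * k ≤ suc (suc lτ)
    room-τ′ = lin p (+-monoʳ-≤ (l′ + suc h) room) (e₁ l′ (suc h) (2 * k) p) (Eq.trans (e₂ l′ h) (cong (λ i → suc (suc i)) (sym lτ+p)))
      where
      e₁ : ∀ l h k p → l + h + k + p ≡ l + h + (p + k)
      e₁ = solve-∀
      e₂ : ∀ l h → l + suc h + suc (suc h) ≡ suc (suc (l + suc (h + h)))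
      e₂ = solve-∀

    room-t₀ : l′ + suc h ≤ suc lτ
    room-t₀ = lin p (+-monoʳ-≤ (l′ + suc h) (≤-pred (≤-trans (≤-reflexive (+-comm 1 p)) (≤-trans (+-monoʳ-≤ p (≤-trans k≥1 (m≤m+n k _))) room))))
      refl (Eq.trans (e l′ h) (cong suc (sym lτ+p)))
      where
      e : ∀ l h → l + suc h + suc h ≡ suc (l + suc (h + h))
      e = solve-∀

    module Upper {u} (u∈ : u ∈ us) (c : ℕ) (deg : U.# u B + suc c ≡ 2 * k + 2) where

      g : E → ℕ
      g = atU u

      A C# T# G rest-sum : ℕ
      A  = U.# u low
      C# = U.# u C
      T# = U.# u τs
      G  = U.# u σs
      rest-sum = lab g lQ low + (lab g l′ C + lab g lτ τs) + lab g L σl + c * suc F.top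

      count : U.# u Q + (A + (C# + T#) + G + c) ≡ 2 * k + 1
      count = suc-injective (Eq.trans (e (U.# u Q) (A + (C# + T#)) G c) (Eq.trans (cong (_+ suc c) (sym (ΣB g))) (Eq.trans deg (+-suc (2 * k) 1))))
        where
        e : ∀ q a g c → suc (q + (a + g + c)) ≡ q + a + g + suc c
        e = solve-∀

      total : lab g s (pre ++ σl) + c * suc F.top ≡ lab g s Q + rest-sum
      total = Eq.trans (cong (_+ c * suc F.top) (Eq.trans (lab-++ g s pre σl) (cong (_+ lab g L σl) (Eq.trans (lab-pre g)
        (cong (λ i → lab g s Q + (lab g lQ low + i)) (lab-++ g l′ C τs)))))) (e (lab g s Q) (lab g lQ low + (lab g l′ C + lab g lτ τs)) (lab g L σl) (c * suc F.top))
        where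
        e : ∀ q a b c → q + a + b + c ≡ q + (a + b + c)
        e = solve-∀

      -- Adding `suc F.top`, a lower bound for the label of an edge outside `B`, turns the left-hand
      -- side into `suc M`.
      Goal : Set
      Goal = K + (l′ + suc h) ≤ lab g s Q + rest-sum

      -- One contribution from outside the paired zone is set apart as `t`, and the `o` others count
      -- as `x` each. The pairs lack at most `2 * k`: either `t` covers this, or `u` is the vertex
      -- without deficit.
      core : ∀ o t → U.# u Q + suc o ≡ 2 * k + 1 → o * x + t ≤ rest-sum →
             (l′ + suc h + 2 * k ≤ t ⊎ (u ≡ up t₀ × l′ + suc h ≤ t)) → Goal
      core o t cnt le why = go (Z.low′ u) why
        where
        S≤2x : S ≤ x + x
        S≤2x = pairSum-≤ s R (≤-trans (m≤m+n s (R + R)) (n≤1+n lQ))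
        S≤x+s : S ≤ x + suc s
        S≤x+s = pairSum-≤ s R (n≤1+n s)
        weak : ∀ {A : Set} → (l′ + suc h + 2 * k ≤ t ⊎ (A × l′ + suc h ≤ t)) → l′ + suc h ≤ t
        weak (inj₁ i)       = ≤-trans (m≤m+n _ _) i
        weak (inj₂ (_ , i)) = i
        go : Low (up t₀) s R Q u → _ → Goal
        go (odd κ q r) why = ≤-trans (+-monoʳ-≤ K (weak why))
          (lower-odd {k} {κ} {o} {x} {t} {S} {suc s} (Eq.trans (cong (_+ suc o) (sym q)) cnt) S≤2x S≤x+s r le)
        go (even κ Df q d r des) (inj₂ (i , j)) = ≤-trans (+-monoʳ-≤ K j) (≤-trans
          (lower-even {k} {κ} {0} {o} {x} {t} {S} (Eq.trans (cong (_+ suc o) (sym q)) cnt) S≤2x (≤-trans (des i) (≤-reflexive (sym (+-identityʳ _)))) le)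
          (≤-reflexive (+-identityʳ _)))
        go (even κ Df q d r des) (inj₁ j) = lin Df (≤-trans (+-monoʳ-≤ K (≤-trans (+-monoʳ-≤ (l′ + suc h) D≤2k) j))
          (lower-even {k} {κ} {Df} {o} {x} {t} {S} (Eq.trans (cong (_+ suc o) (sym q)) cnt) S≤2x r le)) (+-assoc K (l′ + suc h) Df) refl
          where
          D≤2k : Df ≤ 2 * k
          D≤2k = ≤-trans d (≤-pred (≤-trans (≤-trans (s≤s (m≤m+n (κ + κ) o)) (≤-reflexive (sym (+-suc (κ + κ) o)))) (≤-trans (≤-reflexive (Eq.trans (cong (_+ suc o) (sym q)) cnt)) (≤-reflexive (+-comm (2 * k) 1)))))

      bA : A * x ≤ lab g lQ low
      bA = lab-≥ g lQ low
      bC : C# * x ≤ lab g l′ C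
      bC = ≤-trans (*-monoʳ-≤ C# (s≤s lQ≤l′)) (lab-≥ g l′ C)
      bT : T# * suc lτ ≤ lab g lτ τs
      bT = lab-≥ g lτ τs
      bT′ : T# * x ≤ lab g lτ τs
      bT′ = ≤-trans (*-monoʳ-≤ T# (s≤s (≤-trans lQ≤l′ l′≤lτ))) bT
      bG : G * suc L ≤ lab g L σl
      bG = ≤-trans (≤-reflexive (cong (_* suc L) (Σl-↭ g perm₂))) (lab-≥ g L σl)
      x≤L : x ≤ suc L
      x≤L = s≤s (≤-trans lQ≤l′ (≤-trans l′≤lτ lτ≤L))
      bG′ : G * x ≤ lab g L σl
      bG′ = ≤-trans (*-monoʳ-≤ G x≤L) bG
      L≤top : suc L ≤ suc F.top
      L≤top = s≤s (m≤m+n L (length σl))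

      via-c : ∀ c′ → c ≡ suc c′ → Goal
      via-c c′ refl = core (A + (C# + T#) + G + c′) (suc F.top) (Eq.trans (cong (U.# u Q +_) (sym (+-suc _ c′))) count)
        (≤-trans (≤-reflexive (e A C# T# G c′ x (suc F.top))) (+-mono-≤ (+-mono-≤ (+-mono-≤ bA (+-mono-≤ bC bT′)) bG′) (+-monoʳ-≤ (suc F.top) (*-monoʳ-≤ c′ (≤-trans x≤L L≤top)))))
        (inj₁ (≤-trans room-top L≤top))
        where
        e : ∀ A C T G c x t → (A + (C + T) + G + c) * x + t ≡ A * x + (C * x + T * x) + G * x + (t + c * x)
        e = solve-∀

      via-σ : ∀ G′ → G ≡ suc G′ → Goal
      via-σ G′ q = core (A + (C# + T#) + G′ + c) (suc L) (Eq.trans (cong (U.# u Q +_) (Eq.trans (e₁ (A + (C# + T#)) G′ c) (cong (λ i → A + (C# + T#) + i + c) (sym q)))) count)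
        (≤-trans (≤-reflexive (e A C# T# G′ c x (suc L))) (+-mono-≤ (+-mono-≤ (+-mono-≤ bA (+-mono-≤ bC bT′))
          (≤-trans (+-monoʳ-≤ (suc L) (*-monoʳ-≤ G′ x≤L)) (≤-trans (≤-reflexive (cong (_* suc L) (sym q))) bG))) (*-monoʳ-≤ c (≤-trans x≤L L≤top))))
        (inj₁ room-top)
        where
        e₁ : ∀ a g c → suc (a + g + c) ≡ a + suc g + c
        e₁ = solve-∀
        e : ∀ A C T G c x t → (A + (C + T) + G + c) * x + t ≡ A * x + (C * x + T * x) + (t + G * x) + c * x
        e = solve-∀

      via-τ : ∀ T′ → T# ≡ suc T′ → Goal
      via-τ T′ q = pick (up t₀ ≟ u)
        where
        e : ∀ A C T G c x t → (A + (C + T) + G + c) * x + t ≡ A * x + (C * x + (t + T * x)) + G * x + c * x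
        e = solve-∀
        e₁ : ∀ a C T g c → suc (a + (C + T) + g + c) ≡ a + (C + suc T) + g + c
        e₁ = solve-∀
        with-top : ∀ t → t + T′ * x ≤ lab g lτ τs → (l′ + suc h + 2 * k ≤ t ⊎ (u ≡ up t₀ × l′ + suc h ≤ t)) → Goal
        with-top t le = core (A + (C# + T′) + G + c) t (Eq.trans (cong (U.# u Q +_) (Eq.trans (e₁ A C# T′ G c) (cong (λ i → A + (C# + i) + G + c) (sym q)))) count)
          (≤-trans (≤-reflexive (e A C# T′ G c x t)) (+-mono-≤ (+-mono-≤ (+-mono-≤ bA (+-mono-≤ bC le)) bG′) (*-monoʳ-≤ c (≤-trans x≤L L≤top))))
        xτ : x ≤ suc lτ
        xτ = s≤s (≤-trans lQ≤l′ l′≤lτ)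
        pick : Dec (up t₀ ≡ u) → Goal
        pick (yes i) = with-top (suc lτ) (≤-trans (+-monoʳ-≤ (suc lτ) (*-monoʳ-≤ T′ xτ)) (≤-trans (≤-reflexive (cong (_* suc lτ) (sym q))) bT)) (inj₂ (sym i , room-t₀))
        -- All edges τ at `u` lie in `τ′`, so their labels start at `suc (suc lτ)`; this one unit is
        -- what `room-τ′` needs.
        pick (no n) = with-top (suc (suc lτ)) (≤-trans (+-monoʳ-≤ (suc (suc lτ)) (*-monoʳ-≤ T′ (≤-trans xτ (n≤1+n _))))
            (≤-trans (≤-reflexive (cong (_* suc (suc lτ)) (sym #τ′))) (≤-trans (lab-≥ g (suc lτ) τ′) (≤-trans (m≤n+m _ (g t₀ * suc lτ)) (≤-reflexive (cong (lab g lτ) (sym τs≡)))))))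
            (inj₁ room-τ′)
          where
          #τ′ : U.# u τ′ ≡ suc T′
          #τ′ = Eq.trans (cong (_+ U.# u τ′) (sym (δ-≢ n))) (Eq.trans (cong (U.# u) (sym τs≡)) q)

      goal : Goal
      goal = byC c refl
        where
        byC : ∀ c′ → c ≡ c′ → Goal
        byC (suc c′) q = via-c c′ q
        byC zero q = byHit G T# refl refl (hit u∈ (suc-injective (Eq.trans (+-comm 1 _) (Eq.trans (cong (λ i → U.# u B + suc i) (sym q)) (Eq.trans deg (+-suc (2 * k) 1))))))
          where
          byHit : ∀ a b → G ≡ a → T# ≡ b → 1 ≤ G + T# → Goal
          byHit (suc a) b i j _ = via-σ a i
          byHit zero (suc b) i j _ = via-τ b j
          byHit zero zero i j le with () ← ≤-trans le (≤-reflexive (cong₂ _+_ i j))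

      big : M < lab g s (pre ++ σl) + suc c * suc F.top
      big = begin-strict
        X + h + 2 + (h + h)                                       <⟨ ≤-reflexive (e₁ K l′ L₂ h) ⟩
        K + (l′ + suc h) + suc (L₂ + suc (h + h))                 ≡⟨ cong (λ i → K + (l′ + suc h) + suc i) (sym top≡) ⟩
        K + (l′ + suc h) + suc F.top                              ≤⟨ +-monoˡ-≤ (suc F.top) goal ⟩
        lab g s Q + rest-sum + suc F.top                          ≡⟨ cong (_+ suc F.top) (sym total) ⟩
        lab g s (pre ++ σl) + c * suc F.top + suc F.top           ≡⟨ e₂ (lab g s (pre ++ σl)) (c * suc F.top) (suc F.top) ⟩
        lab g s (pre ++ σl) + (suc F.top + c * suc F.top)         ∎
        where
        open ≤-Reasoning
        e₁ : ∀ K l L h → suc (K + l + L + h + 2 + (h + h)) ≡ K + (l + suc h) + suc (L + suc (h + h))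
        e₁ = solve-∀
        e₂ : ∀ a b c → a + b + c ≡ a + (c + b)
        e₂ = solve-∀

    labelling : Labelling
    labelling = F.finish M vals! vals≤M (λ c i q → Upper.big i c q)

  labelling : 1 ≤ k → Labelling
  labelling k≥1 = go chosen
    where
    go : Chosen → Labelling
    go ch with Chosen.τs ch in eq
    ... | []         = Few.labelling ch (subst (λ τs → length τs ≤ 1) (sym eq) z≤n)
    ... | t ∷ []     = Few.labelling ch (subst (λ τs → length τs ≤ 1) (sym eq) ≤-refl)
    ... | t ∷ t′ ∷ τ = Many.labelling ch k≥1 t (t′ ∷ τ) eq (s≤s z≤n)

-- If the upper level is a single vertex, the edges only have to be sorted.
module Star {E W : Set} (_≟_ : DecidableEquality W) (dn up : E → W) (k : ℕ) (B : List E) (u₀ : W) (vs : List W)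
  (one : All (λ v → Count.# _≟_ dn v B ≡ 1) vs)
  (centre : All (λ e → up e ≡ u₀) B)
  (s : ℕ) (w : W → ℕ) (w≤ : ∀ {v} → v ∈ vs → w v ≤ (2 * k + 1) * s) where

  open Delta _≟_
  open Sums _≟_
  module D = Count _≟_ dn
  module U = Count _≟_ up
  open Values _≟_ dn w

  starLabelling : ZoneLabelling _≟_ dn up k B (u₀ ∷ []) vs s w
  starLabelling with Sorting.sort (λ e → w (dn e)) B
  ... | ys , q , so = record
    { ys = ys ; perm = q
    ; distinct = λ {v} {v′} i i′ n → value-≢ s ys (vals-unique s ys so) v v′ (one′ i) (one′ i′) n
    ; below = λ { {v} c i (here refl) h → bl c i h } }
    where
    one′ : ∀ {v} → v ∈ vs → D.# v ys ≡ 1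
    one′ {v} i = Eq.trans (sym (Σl-↭ _ q)) (All.lookup one i)
    -- Every label after the first exceeds `suc s` by at least one. This weak bound for the sum at
    -- the centre suffices.
    lower : ∀ (g : E → ℕ) s xs → 0 < length xs → All (λ x → g x ≡ 1) xs → s + length xs + length xs * suc s ≤ lab g s xs + suc s
    lower g s (x ∷ []) _ (p ∷ []) rewrite p = ≤-reflexive (e s)
      where
      e : ∀ s → s + 1 + (suc s + 0) ≡ suc s + 0 + 0 + suc s
      e = solve-∀
    lower g s (x ∷ y ∷ xs) _ (p ∷ ps) rewrite p = lin (suc (length (y ∷ xs)))
        (+-mono-≤ (+-monoʳ-≤ (suc s) (lower g (suc s) (y ∷ xs) (s≤s z≤n) ps)) (s≤s (z≤n {length xs})))
        (e₁ s (length xs)) (e₂ s (lab g (suc s) (y ∷ xs)) (length xs))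
      where
      e₁ : ∀ s b → s + suc (suc b) + (suc s + (suc s + b * suc s)) + suc (suc b) ≡ suc s + (suc s + suc b + (suc (suc s) + b * suc (suc s))) + 1
      e₁ = solve-∀
      e₂ : ∀ s l b → suc s + (l + suc (suc s)) + suc b ≡ suc s + 0 + l + suc s + suc (suc b)
      e₂ = solve-∀
    g : E → ℕ
    g e = δ (up e) u₀
    g1 : All (λ e → g e ≡ 1) B
    g1 = All.map δ-≡ centre
    bl : ∀ {v} c → v ∈ vs → U.# u₀ B + c ≡ 2 * k + 2 → w v + lab (λ e → δ (dn e) v) s ys < lab g s ys + c * suc (s + length B)
    bl {v} c i h = lin (s + s + s + length ys + 2 * k * s + 2 * k + 1)
        (+-mono-≤ (+-mono-≤ (+-mono-≤ top (lower g s ys nonempty (All-resp-↭ q g1))) (*-monoʳ-≤ c (s≤s (m≤m+n s (length B))))) (z≤n {2 * k}))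
        (e₁ (w v + lab (λ e → δ (dn e) v) s ys) s (length ys) c (Eq.trans (cong (_+ c) (sym lenB)) h))
        (e₂ k s (length ys) (lab g s ys) (c * suc (s + length B)))
      where
      lenB : U.# u₀ B ≡ length ys
      lenB = Eq.trans (Σl-cong g1) (Eq.trans (Σl-one B) (↭-length q))
      nonempty : 0 < length ys
      nonempty = ne ys (one′ i)
        where
        ne : ∀ xs → D.# v xs ≡ 1 → 0 < length xs
        ne (_ ∷ _) _ = s≤s z≤n
      top : w v + lab (λ e → δ (dn e) v) s ys ≤ 2 * k * s + s + (s + length ys)
      top = +-mono-≤ (≤-trans (w≤ i) (≤-reflexive (e₀ (2 * k) s))) (≤-trans (lab-≤ (λ e → δ (dn e) v) s ys) (≤-reflexive (Eq.trans (cong (_* (s + length ys)) (one′ i)) (+-identityʳ _))))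
        where
        e₀ : ∀ k s → (k + 1) * s ≡ k * s + s
        e₀ = solve-∀
      e₁ : ∀ a s b c → b + c ≡ 2 * k + 2 → suc a + (s + s + s + b + 2 * k * s + 2 * k + 1) ≡ a + (s + b + b * suc s) + c * suc s + 0
      e₁ a s b c r = Eq.trans (f₁ a s b k) (Eq.trans (cong (λ d → a + (s + b + d * suc s)) (sym r)) (f₂ a s b c))
        where
        f₁ : ∀ a s b k → suc a + (s + s + s + b + 2 * k * s + 2 * k + 1) ≡ a + (s + b + (2 * k + 2) * suc s)
        f₁ = solve-∀
        f₂ : ∀ a s b c → a + (s + b + (b + c) * suc s) ≡ a + (s + b + b * suc s) + c * suc s + 0
        f₂ = solve-∀
      e₂ : ∀ k s b l c → 2 * k * s + s + (s + b) + (l + suc s) + c + 2 * k ≡ l + c + (s + s + s + b + 2 * k * s + 2 * k + 1)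
      e₂ = solve-∀

-- Levels of the graph

open import Defs
open import Data.Fin using (Fin; toℕ; fromℕ<)
open import Data.Fin.Properties using (_≟_; toℕ-fromℕ<; toℕ-injective; toℕ<n)
import Data.Fin.Properties as Finₚ
open import Function.Bundles using (mk⤖)

module _ {A : Set} where

  filter-⊎ : ∀ {P Q R : A → Set} (P? : ∀ x → Dec (P x)) (Q? : ∀ x → Dec (Q x)) (R? : ∀ x → Dec (R x)) →
             (∀ {x} → P x → Q x ⊎ R x) → (∀ {x} → Q x → P x) → (∀ {x} → R x → P x) → (∀ {x} → Q x → R x → ⊥) →
             ∀ xs → filter P? xs ↭ filter Q? xs ++ filter R? xs
  filter-⊎ P? Q? R? to q r no-qr [] = refl
  filter-⊎ P? Q? R? to q r no-qr (x ∷ xs) with P? x | Q? x | R? x | filter-⊎ P? Q? R? to q r no-qr xs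
  ... | yes p | yes a | yes b | ih = ⊥-elim (no-qr a b)
  ... | yes p | yes a | no b  | ih = prep x ih
  ... | yes p | no a  | yes b | ih = trans (prep x ih) (↭-sym (shift x (filter Q? xs) (filter R? xs)))
  ... | yes p | no a  | no b  | ih = ⊥-elim ([ a , b ]′ (to p))
  ... | no p  | yes a | _     | ih = ⊥-elim (p (q a))
  ... | no p  | no a  | yes b | ih = ⊥-elim (p (r b))
  ... | no p  | no a  | no b  | ih = ih

  filter-⇔ : ∀ {P Q : A → Set} (P? : ∀ x → Dec (P x)) (Q? : ∀ x → Dec (Q x)) →
             (∀ {x} → P x → Q x) → (∀ {x} → Q x → P x) → ∀ xs → filter P? xs ↭ filter Q? xs
  filter-⇔ P? Q? to from [] = refl
  filter-⇔ P? Q? to from (x ∷ xs) with P? x | Q? x | filter-⇔ P? Q? to from xs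
  ... | yes _ | yes _ | ih = prep x ih
  ... | yes p | no q  | _  = ⊥-elim (q (to p))
  ... | no p  | yes q | _  = ⊥-elim (p (from q))
  ... | no _  | no _  | ih = ih

  Σ-filter-≤ : ∀ {P : A → Set} (P? : ∀ x → Dec (P x)) (f : A → ℕ) xs → Σl f (filter P? xs) ≤ Σl f xs
  Σ-filter-≤ P? f [] = z≤n
  Σ-filter-≤ P? f (x ∷ xs) with P? x
  ... | yes _ = +-monoʳ-≤ (f x) (Σ-filter-≤ P? f xs)
  ... | no _  = ≤-trans (Σ-filter-≤ P? f xs) (m≤n+m _ (f x))

  Σ-filter-all : ∀ {P : A → Set} (P? : ∀ x → Dec (P x)) (f : A → ℕ) → (∀ x → ¬ P x → f x ≡ 0) → ∀ xs → Σl f (filter P? xs) ≡ Σl f xs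
  Σ-filter-all P? f z [] = refl
  Σ-filter-all P? f z (x ∷ xs) with P? x
  ... | yes _ = cong (f x +_) (Σ-filter-all P? f z xs)
  ... | no p  = Eq.trans (Σ-filter-all P? f z xs) (cong (_+ Σl f xs) (sym (z x p)))

  Σ-filter-0 : ∀ {P : A → Set} (P? : ∀ x → Dec (P x)) (f : A → ℕ) → (∀ x → P x → f x ≡ 0) → ∀ xs → Σl f (filter P? xs) ≡ 0
  Σ-filter-0 P? f z xs = Eq.trans (Σl-cong (All.map (λ {x} → z x) (Allₚ.all-filter P? xs))) (Σl-zero (filter P? xs))

  Σ-< : ∀ {f g : A → ℕ} {x} xs → (∀ x → f x ≤ g x) → x ∈ xs → f x < g x → Σl f xs < Σl g xs
  Σ-< (y ∷ xs) le (here refl) lt = +-mono-<-≤ lt (Σl-mono (All.universal le xs))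
  Σ-< (y ∷ xs) le (there i)   lt = +-mono-≤-< (le y) (Σ-< xs le i lt)

Σl-tabulate : ∀ {A : Set} (g : A → ℕ) m (f : Fin m → A) → Σl g (tabulate f) ≡ Σ-Fin m (λ i → g (f i))
Σl-tabulate g zero    f = refl
Σl-tabulate g (suc m) f = cong (g (f Fin.zero) +_) (Σl-tabulate g m (λ i → f (Fin.suc i)))

module Main (G : Graph) (k : ℕ) (k≥1 : 1 ≤ k) (reg : Regular (2 * k + 2) G) where

  V E : Set
  V = Fin (n G)
  E = Fin (m G)

  open Delta {V} _≟_
  open Sums {V} _≟_
  open import Data.List.Membership.DecPropositional {A = V} _≟_ using (_∈?_)

  d : ℕ
  d = 2 * k + 2

  fst snd : E → V
  fst e = proj₁ (ends G e)
  snd e = proj₂ (ends G e)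

  edges : List E
  edges = allFin (m G)

  I : V → E → ℕ
  I v e = if incident G e v then 1 else 0

  I-δ : ∀ v e → I v e ≡ δ (fst e) v + δ (snd e) v
  I-δ v e with fst e ≟ v | snd e ≟ v
  ... | yes p | yes q = ⊥-elim (loopless G e (Eq.trans p (sym q)))
  ... | yes _ | no _  = refl
  ... | no _  | yes _ = refl
  ... | no _  | no _  = refl

  I-0 : ∀ {v e} → fst e ≢ v → snd e ≢ v → I v e ≡ 0
  I-0 {v} {e} p q = Eq.trans (I-δ v e) (cong₂ _+_ (δ-≢ p) (δ-≢ q))

  degree≡ : ∀ v → Σl (I v) edges ≡ d
  degree≡ v = Eq.trans (Σl-tabulate (I v) (m G) (λ i → i)) (reg v)

  Touch : List V → E → Set
  Touch Z e = fst e ∈ Z ⊎ snd e ∈ Z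

  touch? : ∀ Z e → Dec (Touch Z e)
  touch? Z e = (fst e ∈? Z) ⊎-dec (snd e ∈? Z)

  Inner : List V → E → Set
  Inner Y e = fst e ∈ Y × snd e ∈ Y

  inner? : ∀ Y e → Dec (Inner Y e)
  inner? Y e = (fst e ∈? Y) ×-dec (snd e ∈? Y)

  Cross : List V → List V → E → Set
  Cross Y P e = (fst e ∈ Y × snd e ∈ P) ⊎ (snd e ∈ Y × fst e ∈ P)

  cross? : ∀ Y P e → Dec (Cross Y P e)
  cross? Y P e = ((fst e ∈? Y) ×-dec (snd e ∈? P)) ⊎-dec ((snd e ∈? Y) ×-dec (fst e ∈? P))

  touching : List V → List E
  touching Z = filter (touch? Z) edges

  Adj : List V → V → Set
  Adj P z = Σ[ e ∈ E ] ((fst e ≡ z × snd e ∈ P) ⊎ (snd e ≡ z × fst e ∈ P))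

  adj? : ∀ P z → Dec (Adj P z)
  adj? P z = Finₚ.any? (λ e → ((fst e ≟ z) ×-dec (snd e ∈? P)) ⊎-dec ((snd e ≟ z) ×-dec (fst e ∈? P)))

  -- P is a level and Z the set of vertices that are not yet reached from it.
  record Front (P Z : List V) : Set where
    field
      P!       : Unique P
      Z!       : Unique Z
      disjoint : ∀ {v} → v ∈ P → v ∉ Z
      closed   : ∀ {e} → Touch Z e → (fst e ∈ Z ⊎ fst e ∈ P) × (snd e ∈ Z ⊎ snd e ∈ P)
      -- The edge `e` leads back to the previous level and is labelled later. A root has no such
      -- edge, and its star is labelled separately.
      anchored : (Σ[ u ∈ V ] P ≡ u ∷ []) ⊎ (∀ {u} → u ∈ P → Σ[ e ∈ E ] (I u e ≡ 1 × ¬ Touch Z e))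

  -- In `below`, the `c` edges at `u` that do not touch `Z` count with the smallest label still
  -- free, so the inequality survives every continuation of the labelling.
  record Labelled (P Z : List V) : Set where
    field
      ys       : List E
      perm     : touching Z ↭ ys
      distinct : ∀ {v v′} → v ∈ Z → v′ ∈ Z → v ≢ v′ → lab (I v) 0 ys ≢ lab (I v′) 0 ys
      below    : ∀ {v u} c → v ∈ Z → u ∈ P → Σl (I u) ys + c ≡ d → lab (I v) 0 ys < lab (I u) 0 ys + c * suc (length ys)

  touching-degree : ∀ {v Z} → v ∈ Z → Σl (I v) (touching Z) ≡ d
  touching-degree {v} {Z} i = Eq.trans (Σ-filter-all (touch? Z) (I v) (λ e n → I-0 (λ q → n (inj₁ (subst (_∈ Z) (sym q) i))) (λ q → n (inj₂ (subst (_∈ Z) (sym q) i)))) edges) (degree≡ v)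

  -- No edge leaves P downwards: the search restarts at a vertex of another component.
  module NewRoot {P z₀ Z₀} (F : Front P (z₀ ∷ Z₀)) (none : ∀ {z} → z ∈ z₀ ∷ Z₀ → ¬ Adj P z) where
    open Front F

    Z : List V
    Z = z₀ ∷ Z₀

    z₀∉ : z₀ ∉ Z₀
    z₀∉ i with Z!
    ... | p ∷ _ = All.lookup p i refl

    not-P : ∀ {e} → Touch Z e → fst e ∉ P × snd e ∉ P
    not-P {e} t = (λ i → [ (λ j → disjoint i j) , (λ j → none j (e , inj₂ (refl , i))) ]′ t) ,
                  (λ i → [ (λ j → none j (e , inj₁ (refl , i))) , (λ j → disjoint i j) ]′ t)

    in-Z : ∀ {e} → Touch Z e → fst e ∈ Z × snd e ∈ Z
    in-Z t = let a , b = closed t ; p , q = not-P t in [ (λ i → i) , (λ i → ⊥-elim (p i)) ]′ a , [ (λ i → i) , (λ i → ⊥-elim (q i)) ]′ b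

    up : ∀ {e} → Touch Z₀ e → Touch Z e
    up (inj₁ i) = inj₁ (there i)
    up (inj₂ i) = inj₂ (there i)

    down : ∀ {e} → Touch Z e → Touch Z₀ e
    down {e} t with in-Z t
    ... | there i  , _       = inj₁ i
    ... | here p   , there j = inj₂ j
    ... | here p   , here q  = ⊥-elim (loopless G e (Eq.trans p (sym q)))

    front : Front (z₀ ∷ []) Z₀
    front = record
      { P! = [] ∷ [] ; Z! = tl Z! ; disjoint = λ { (here refl) j → z₀∉ j }
      ; closed = λ t → let a , b = in-Z (up t) in sp a , sp b
      ; anchored = inj₁ (z₀ , refl) }
      where
      tl : ∀ {x xs} → Unique (x ∷ xs) → Unique {A = V} xs
      tl (_ ∷ u) = u
      sp : ∀ {v} → v ∈ Z → v ∈ Z₀ ⊎ v ∈ z₀ ∷ []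
      sp (here p)  = inj₂ (here p)
      sp (there i) = inj₁ i

    step : Labelled (z₀ ∷ []) Z₀ → Labelled P Z
    step R = record { ys = ys ; perm = perm′ ; distinct = dist ; below = bel }
      where
      open Labelled R
      perm′ : touching Z ↭ ys
      perm′ = trans (filter-⇔ (touch? Z) (touch? Z₀) down up edges) perm
      z₀< : ∀ {v} → v ∈ Z₀ → lab (I v) 0 ys < lab (I z₀) 0 ys
      z₀< i = ≤-trans (below 0 i (here refl) (Eq.trans (+-identityʳ _) (Eq.trans (sym (Σl-↭ (I z₀) perm′)) (touching-degree {Z = Z} (here refl))))) (≤-reflexive (+-identityʳ _))
      dist : ∀ {v v′} → v ∈ Z → v′ ∈ Z → v ≢ v′ → lab (I v) 0 ys ≢ lab (I v′) 0 ys
      dist (here refl) (here refl) n q = n refl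
      dist (here refl) (there j)   n q = <⇒≢ (z₀< j) (sym q)
      dist (there i)   (here refl) n q = <⇒≢ (z₀< i) q
      dist (there i)   (there j)   n q = distinct i j n q
      bel : ∀ {v u} c → v ∈ Z → u ∈ P → Σl (I u) ys + c ≡ d → lab (I v) 0 ys < lab (I u) 0 ys + c * suc (length ys)
      -- None of the `d` edges at `u` is labelled yet, and each will get a larger label than any
      -- edge at `v`.
      bel {v} {u} c i j h = begin-strict
        lab (I v) 0 ys                       ≤⟨ lab-≤ (I v) 0 ys ⟩
        Σl (I v) ys * length ys              ≡⟨ cong (_* length ys) (Eq.trans (sym (Σl-↭ (I v) perm′)) (touching-degree {Z = Z} i)) ⟩
        d * length ys                        <⟨ *-monoʳ-< d {{nz}} (n<1+n (length ys)) ⟩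
        d * suc (length ys)                  ≡⟨ cong (_* suc (length ys)) (sym (Eq.trans (cong (_+ c) (sym u0)) h)) ⟩
        c * suc (length ys)                  ≤⟨ m≤n+m _ (lab (I u) 0 ys) ⟩
        lab (I u) 0 ys + c * suc (length ys) ∎
        where
        open ≤-Reasoning
        nz : ℕ.NonZero d
        nz = ℕ.>-nonZero (≤-trans (s≤s z≤n) (≤-reflexive (+-comm 2 (2 * k))))
        u0 : Σl (I u) ys ≡ 0
        u0 = Eq.trans (sym (Σl-↭ (I u) perm′)) (Σ-filter-0 (touch? Z) (I u) (λ e t → let p , q = not-P t in I-0 (λ r → p (subst (_∈ P) (sym r) j)) (λ r → q (subst (_∈ P) (sym r) j))) edges)

  module NextLevel {P Z} (F : Front P Z) where
    open Front F

    Y Z₁ : List V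
    Y  = filter (adj? P) Z
    Z₁ = filter (λ z → ¬? (adj? P z)) Z

    Y⊆Z : ∀ {v} → v ∈ Y → v ∈ Z
    Y⊆Z i = proj₁ (∈-filter⁻ (adj? P) {xs = Z} i)

    Z₁⊆Z : ∀ {v} → v ∈ Z₁ → v ∈ Z
    Z₁⊆Z i = proj₁ (∈-filter⁻ (λ z → ¬? (adj? P z)) {xs = Z} i)

    Y-adj : ∀ {v} → v ∈ Y → Adj P v
    Y-adj i = proj₂ (∈-filter⁻ (adj? P) {xs = Z} i)

    Z₁-nadj : ∀ {v} → v ∈ Z₁ → ¬ Adj P v
    Z₁-nadj i = proj₂ (∈-filter⁻ (λ z → ¬? (adj? P z)) {xs = Z} i)

    splitZ : ∀ {v} → v ∈ Z → v ∈ Z₁ ⊎ v ∈ Y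
    splitZ {v} i with adj? P v
    ... | yes a = inj₂ (∈-filter⁺ (adj? P) i a)
    ... | no a  = inj₁ (∈-filter⁺ (λ z → ¬? (adj? P z)) i a)

    Y∩Z₁ : ∀ {v} → v ∈ Y → v ∉ Z₁
    Y∩Z₁ i j = Z₁-nadj j (Y-adj i)

    Y∩P : ∀ {v} → v ∈ Y → v ∉ P
    Y∩P i j = disjoint j (Y⊆Z i)

    Z₁∩P : ∀ {v} → v ∈ Z₁ → v ∉ P
    Z₁∩P i j = disjoint j (Z₁⊆Z i)

    touch-Z₁ : ∀ {e} → Touch Z₁ e → Touch Z e
    touch-Z₁ (inj₁ i) = inj₁ (Z₁⊆Z i)
    touch-Z₁ (inj₂ i) = inj₂ (Z₁⊆Z i)

    Z₁-not-P : ∀ {e} → Touch Z₁ e → fst e ∉ P × snd e ∉ P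
    Z₁-not-P {e} t = (λ i → [ (λ j → Z₁∩P j i) , (λ j → Z₁-nadj j (e , inj₂ (refl , i))) ]′ t) ,
                     (λ i → [ (λ j → Z₁-nadj j (e , inj₁ (refl , i))) , (λ j → Z₁∩P j i) ]′ t)

    cross-Z₁ : ∀ {e} → Cross Y P e → ¬ Touch Z₁ e
    cross-Z₁ (inj₁ (_ , j)) t = proj₂ (Z₁-not-P t) j
    cross-Z₁ (inj₂ (_ , j)) t = proj₁ (Z₁-not-P t) j

    inner-Z₁ : ∀ {e} → Inner Y e → ¬ Touch Z₁ e
    inner-Z₁ (i , _) (inj₁ t) = Y∩Z₁ i t
    inner-Z₁ (_ , j) (inj₂ t) = Y∩Z₁ j t

    front : Front Y Z₁
    front = record
      { P! = Uniqueₚ.filter⁺ (adj? P) Z! ; Z! = Uniqueₚ.filter⁺ (λ z → ¬? (adj? P z)) Z! ; disjoint = Y∩Z₁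
      ; closed = λ t → let a , b = closed (touch-Z₁ t) ; p , q = Z₁-not-P t in sp a p , sp b q
      ; anchored = inj₂ anch }
      where
      sp : ∀ {v} → v ∈ Z ⊎ v ∈ P → v ∉ P → v ∈ Z₁ ⊎ v ∈ Y
      sp (inj₁ i) _ = splitZ i
      sp (inj₂ i) n = ⊥-elim (n i)
      anch : ∀ {u} → u ∈ Y → Σ[ e ∈ E ] (I u e ≡ 1 × ¬ Touch Z₁ e)
      anch {u} i with Y-adj i
      ... | e , inj₁ (refl , j) = e , Eq.trans (I-δ u e) (cong₂ _+_ (δ-≡ {u} refl) (δ-≢ λ q → loopless G e (sym q))) , cross-Z₁ (inj₁ (i , j))
      ... | e , inj₂ (refl , j) = e , Eq.trans (I-δ u e) (cong₂ _+_ (δ-≢ (loopless G e)) (δ-≡ {u} refl)) , cross-Z₁ (inj₂ (i , j))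

    dn up : E → V
    dn e = if ⌊ fst e ∈? Y ⌋ then fst e else snd e
    up e = if ⌊ fst e ∈? Y ⌋ then snd e else fst e

    I-dn-up : ∀ v e → I v e ≡ δ (dn e) v + δ (up e) v
    I-dn-up v e with fst e ∈? Y
    ... | yes _ = I-δ v e
    ... | no _  = Eq.trans (I-δ v e) (+-comm (δ (fst e) v) _)

    cross-ends : ∀ {e} → Cross Y P e → dn e ∈ Y × up e ∈ P
    cross-ends {e} x with fst e ∈? Y
    cross-ends (inj₁ (_ , j)) | yes i = i , j
    cross-ends (inj₂ (_ , j)) | yes i = ⊥-elim (Y∩P i j)
    cross-ends (inj₁ (i , _)) | no n  = ⊥-elim (n i)
    cross-ends (inj₂ (i , j)) | no n  = i , j

    B inn : List E
    B   = filter (cross? Y P) edges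
    inn = filter (inner? Y) edges

    B-ends : All (λ e → dn e ∈ Y × up e ∈ P) B
    B-ends = All.map cross-ends (Allₚ.all-filter (cross? Y P) edges)

    I-dn : ∀ {v} → v ∈ Y → All (λ e → I v e ≡ δ (dn e) v) B
    I-dn {v} i = All.map (λ {e} (_ , j) → Eq.trans (I-dn-up v e) (Eq.trans (cong (δ (dn e) v +_) (δ-≢ (λ q → Y∩P i (subst (_∈ P) q j)))) (+-identityʳ _))) B-ends

    I-up : ∀ {u} → u ∈ P → All (λ e → I u e ≡ δ (up e) u) B
    I-up {u} i = All.map (λ {e} (j , _) → Eq.trans (I-dn-up u e) (cong (_+ δ (up e) u) (δ-≢ (λ q → Y∩P j (subst (_∈ P) (sym q) i))))) B-ends

    touch-split : ∀ {e} → Touch Z e → Touch Z₁ e ⊎ (Inner Y e ⊎ Cross Y P e)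
    touch-split {e} t with closed t
    ... | inj₁ i , b with splitZ i
    ... | inj₁ i′ = inj₁ (inj₁ i′)
    ... | inj₂ i′ with b
    ... | inj₂ j = inj₂ (inj₂ (inj₁ (i′ , j)))
    ... | inj₁ j with splitZ j
    ... | inj₁ j′ = inj₁ (inj₂ j′)
    ... | inj₂ j′ = inj₂ (inj₁ (i′ , j′))
    touch-split {e} t | inj₂ i , inj₁ j with splitZ j
    ... | inj₁ j′ = inj₁ (inj₂ j′)
    ... | inj₂ j′ = inj₂ (inj₂ (inj₂ (j′ , i)))
    touch-split {e} t | inj₂ i , inj₂ j = ⊥-elim ([ disjoint i , disjoint j ]′ t)

    inner-cross : ∀ {e} → Inner Y e → ¬ Cross Y P e
    inner-cross (i , j) (inj₁ (_ , q)) = Y∩P j q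
    inner-cross (i , j) (inj₂ (_ , q)) = Y∩P i q

    touching-split : touching Z ↭ touching Z₁ ++ (inn ++ B)
    touching-split = trans
      (filter-⊎ (touch? Z) (touch? Z₁) (λ e → inner? Y e ⊎-dec cross? Y P e) touch-split touch-Z₁
        (λ { (inj₁ (i , _)) → inj₁ (Y⊆Z i) ; (inj₂ (inj₁ (i , _))) → inj₁ (Y⊆Z i) ; (inj₂ (inj₂ (i , _))) → inj₂ (Y⊆Z i) })
        (λ { t (inj₁ x) → inner-Z₁ x t ; t (inj₂ x) → cross-Z₁ x t }) edges)
      (++⁺ˡ (touching Z₁) (filter-⊎ (λ e → inner? Y e ⊎-dec cross? Y P e) (inner? Y) (cross? Y P) (λ x → x) inj₁ inj₂ inner-cross edges))

    module _ (y₀ : V) (y₀∈ : y₀ ∈ Y) (R : Labelled Y Z₁) where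
      module R = Labelled R

      -- The edges inside `Y` are labelled just before `B`, so in `w` they count like the edges to
      -- the levels below.
      pre : List E
      pre = R.ys ++ inn

      s : ℕ
      s = length pre

      perm₀ : touching Z ↭ pre ++ B
      perm₀ = trans touching-split (trans (++⁺ʳ (inn ++ B) R.perm) (subst (R.ys ++ (inn ++ B) ↭_) (sym (++-assoc R.ys inn B)) ↭-refl))

      w z : V → ℕ
      w v = lab (I v) 0 pre
      z v = d ∸ Count.# _≟_ dn v B

      Σ-pre-B : ∀ v → Σl (I v) pre + Σl (I v) B ≤ d
      Σ-pre-B v = ≤-trans (≤-reflexive (sym (Eq.trans (Σl-↭ (I v) perm₀) (Σl-++ (I v) pre B)))) (≤-trans (Σ-filter-≤ (touch? Z) (I v) edges) (≤-reflexive (degree≡ v)))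

      #≤ΣI : ∀ v → Count.# _≟_ dn v B ≤ Σl (I v) B
      #≤ΣI v = Σl-mono (All.universal (λ e → ≤-trans (m≤m+n _ (δ (up e) v)) (≤-reflexive (sym (I-dn-up v e)))) B)

      z+ : ∀ v → Count.# _≟_ dn v B + z v ≡ 2 * k + 2
      z+ v = m+[n∸m]≡n (≤-trans (#≤ΣI v) (≤-trans (m≤n+m _ (Σl (I v) pre)) (Σ-pre-B v)))

      w≤ : ∀ v → w v ≤ z v * s
      w≤ v = ≤-trans (lab-≤ (I v) 0 pre) (*-monoˡ-≤ s (m+n≤o⇒m≤o∸n (Σl (I v) pre) {Count.# _≟_ dn v B} (≤-trans (+-monoʳ-≤ (Σl (I v) pre) (#≤ΣI v)) (Σ-pre-B v))))

      dn≥ : All (λ v → 1 ≤ Count.# _≟_ dn v B) Y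
      dn≥ = All.tabulate one
        where
        one : ∀ {v} → v ∈ Y → 1 ≤ Count.# _≟_ dn v B
        one {v} i with Y-adj i
        ... | e , a = ≤-trans (≤-reflexive (sym (I1 a))) (≤-trans (mem e∈) (≤-reflexive (Σl-cong (I-dn i))))
          where
          cr : (fst e ≡ v × snd e ∈ P) ⊎ (snd e ≡ v × fst e ∈ P) → Cross Y P e
          cr (inj₁ (refl , j)) = inj₁ (i , j)
          cr (inj₂ (refl , j)) = inj₂ (i , j)
          I1 : (fst e ≡ v × snd e ∈ P) ⊎ (snd e ≡ v × fst e ∈ P) → I v e ≡ 1
          I1 (inj₁ (refl , j)) = Eq.trans (I-δ v e) (cong₂ _+_ (δ-≡ {v} refl) (δ-≢ λ q → loopless G e (sym q)))
          I1 (inj₂ (refl , j)) = Eq.trans (I-δ v e) (cong₂ _+_ (δ-≢ (loopless G e)) (δ-≡ {v} refl))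
          e∈ : e ∈ B
          e∈ = ∈-filter⁺ (cross? Y P) (∈-allFin e) (cr a)
          mem : ∀ {xs} → e ∈ xs → I v e ≤ Σl (I v) xs
          mem (here refl) = m≤m+n _ _
          mem {x ∷ xs} (there j) = ≤-trans (mem j) (m≤n+m _ (I v x))

      e₀ : E
      e₀ = proj₁ (Y-adj y₀∈)

      zoneLabelling : ZoneLabelling _≟_ dn up k B P Y s w
      zoneLabelling with anchored
      ... | inj₂ anc = Level.labelling _≟_ dn up e₀ k B P Y P! (Front.P! front) (All.map proj₁ B-ends) dn≥ (All.tabulate up≤) s w z z+ w≤ k≥1
        where
        -- The edge given by `anc` does not touch `Z`, so it is missing from `touching Z` and hence
        -- from `B`.
        up≤ : ∀ {u} → u ∈ P → Count.# _≟_ up u B ≤ 2 * k + 1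
        up≤ {u} i with anc i
        ... | e , I1 , nt = ≤-pred (begin-strict
          Count.# _≟_ up u B            ≡⟨ sym (Σl-cong (I-up i)) ⟩
          Σl (I u) B                    ≤⟨ ≤-trans (m≤n+m _ (Σl (I u) pre)) (≤-reflexive (sym (Eq.trans (Σl-↭ (I u) perm₀) (Σl-++ (I u) pre B)))) ⟩
          Σl (I u) (touching Z)         ≡⟨ ind (touch? Z) edges ⟩
          Σl (λ a → if ⌊ touch? Z a ⌋ then I u a else 0) edges <⟨ Σ-< edges le (∈-allFin e) lt ⟩
          Σl (I u) edges                ≡⟨ degree≡ u ⟩
          2 * k + 2                     ≡⟨ +-suc (2 * k) 1 ⟩
          suc (2 * k + 1)               ∎)
          where
          open ≤-Reasoning
          ind : ∀ {Q : E → Set} (Q? : ∀ a → Dec (Q a)) xs → Σl (I u) (filter Q? xs) ≡ Σl (λ a → if ⌊ Q? a ⌋ then I u a else 0) xs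
          ind Q? [] = refl
          ind Q? (x ∷ xs) with Q? x
          ... | yes _ = cong (I u x +_) (ind Q? xs)
          ... | no _  = ind Q? xs
          le : ∀ a → (if ⌊ touch? Z a ⌋ then I u a else 0) ≤ I u a
          le a with touch? Z a
          ... | yes _ = ≤-refl
          ... | no _  = z≤n
          lt : (if ⌊ touch? Z e ⌋ then I u e else 0) < I u e
          lt with touch? Z e
          ... | yes t = ⊥-elim (nt t)
          ... | no _  = ≤-reflexive (sym I1)
      ... | inj₁ (u₀ , P≡) = subst (λ P → ZoneLabelling _≟_ dn up k B P Y s w) (sym P≡)
              (Star.starLabelling _≟_ dn up k B u₀ Y (All.tabulate one) centre s w w≤′)
        where
        centre : All (λ e → up e ≡ u₀) B
        centre = All.map (λ {e} (_ , j) → single (subst (up e ∈_) P≡ j)) B-ends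
          where
          single : ∀ {v} → v ∈ u₀ ∷ [] → v ≡ u₀
          single (here q) = q
        -- As the graph has no multiple edges, each vertex of `Y` has only one edge to the root.
        same : ∀ {e e′} → dn e ≡ dn e′ → up e ≡ up e′ → e ≡ e′
        same {e} {e′} p q with fst e ∈? Y | fst e′ ∈? Y
        ... | yes _ | yes _ = simple G e e′ (inj₁ (p , q))
        ... | yes _ | no _  = simple G e e′ (inj₂ (p , q))
        ... | no _  | yes _ = simple G e e′ (inj₂ (q , p))
        ... | no _  | no _  = simple G e e′ (inj₁ (q , p))
        ≤one : ∀ v xs → Unique xs → All (λ e → up e ≡ u₀) xs → Count.# _≟_ dn v xs ≤ 1
        ≤one v [] _ _ = z≤n
        ≤one v (x ∷ xs) (p ∷ u) (c ∷ cs) with dn x ≟ v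
        ... | no _  = ≤one v xs u cs
        ... | yes q = s≤s (≤-reflexive (zero′ p cs))
          where
          zero′ : ∀ {ys} → All (x ≢_) ys → All (λ e → up e ≡ u₀) ys → Count.# _≟_ dn v ys ≡ 0
          zero′ [] [] = refl
          zero′ (n ∷ ns) (c′ ∷ cs′) = cong₂ _+_ (δ-≢ (λ r → n (same (Eq.trans q (sym r)) (Eq.trans c (sym c′))))) (zero′ ns cs′)
        one : ∀ {v} → v ∈ Y → Count.# _≟_ dn v B ≡ 1
        one {v} i = ≤-antisym (≤one v B (Uniqueₚ.filter⁺ (cross? Y P) (Uniqueₚ.allFin⁺ (m G))) centre) (All.lookup dn≥ i)
        w≤′ : ∀ {v} → v ∈ Y → w v ≤ (2 * k + 1) * s
        w≤′ {v} i = ≤-trans (w≤ v) (*-monoˡ-≤ s (≤-reflexive (Eq.trans (cong (d ∸_) (one i)) (Eq.trans (cong (_∸ 1) (+-suc (2 * k) 1)) refl))))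

      step : Labelled P Z
      step = record { ys = ys ; perm = perm′ ; distinct = dist ; below = bel }
        where
        module L = ZoneLabelling zoneLabelling
        ys : List E
        ys = pre ++ L.ys
        perm′ : touching Z ↭ ys
        perm′ = trans perm₀ (++⁺ˡ pre L.perm)
        lenys : s + length B ≡ length ys
        lenys = Eq.trans (cong (s +_) (↭-length L.perm)) (sym (length-++ pre))
        lab-Y : ∀ {v} → v ∈ Y → lab (I v) 0 ys ≡ w v + lab (λ e → δ (dn e) v) s L.ys
        lab-Y {v} i = Eq.trans (lab-++ (I v) 0 pre L.ys) (cong (w v +_) (lab-cong s (All-resp-↭ L.perm (I-dn i))))
        P-pre : ∀ {u} → u ∈ P → Σl (I u) pre ≡ 0
        P-pre {u} i = Eq.trans (Σl-++ (I u) R.ys inn) (cong₂ _+_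
          (Eq.trans (sym (Σl-↭ (I u) R.perm)) (Σ-filter-0 (touch? Z₁) (I u) (λ e t → let p , q = Z₁-not-P t in
            I-0 (λ r → p (subst (_∈ P) (sym r) i)) (λ r → q (subst (_∈ P) (sym r) i))) edges))
          (Σ-filter-0 (inner? Y) (I u) (λ e (a , b) → I-0 (λ r → Y∩P a (subst (_∈ P) (sym r) i)) (λ r → Y∩P b (subst (_∈ P) (sym r) i))) edges))
        lab-P : ∀ {u} → u ∈ P → lab (I u) 0 ys ≡ lab (λ e → δ (up e) u) s L.ys
        lab-P {u} i = Eq.trans (lab-++ (I u) 0 pre L.ys) (cong₂ _+_ (lab-0 (I u) 0 pre (P-pre i)) (lab-cong s (All-resp-↭ L.perm (I-up i))))
        Σ-P : ∀ {u} → u ∈ P → Σl (I u) ys ≡ Count.# _≟_ up u B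
        Σ-P {u} i = Eq.trans (Σl-++ (I u) pre L.ys) (cong₂ _+_ (P-pre i) (Eq.trans (sym (Σl-↭ (I u) L.perm)) (Σl-cong (I-up i))))
        Z₁-rest : ∀ {v} → v ∈ Z₁ → Σl (I v) (inn ++ L.ys) ≡ 0
        Z₁-rest {v} i = Eq.trans (Σl-++ (I v) inn L.ys) (cong₂ _+_
          (Σ-filter-0 (inner? Y) (I v) (λ e x → I-0 (λ r → inner-Z₁ x (inj₁ (subst (_∈ Z₁) (sym r) i))) (λ r → inner-Z₁ x (inj₂ (subst (_∈ Z₁) (sym r) i)))) edges)
          (Eq.trans (sym (Σl-↭ (I v) L.perm)) (Σ-filter-0 (cross? Y P) (I v) (λ e x → I-0 (λ r → cross-Z₁ x (inj₁ (subst (_∈ Z₁) (sym r) i))) (λ r → cross-Z₁ x (inj₂ (subst (_∈ Z₁) (sym r) i)))) edges)))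
        ys≡ : ys ≡ R.ys ++ (inn ++ L.ys)
        ys≡ = ++-assoc R.ys inn L.ys
        lab-R : ∀ v → lab (I v) 0 ys ≡ lab (I v) 0 R.ys + lab (I v) (length R.ys) (inn ++ L.ys)
        lab-R v = Eq.trans (cong (lab (I v) 0) ys≡) (lab-++ (I v) 0 R.ys (inn ++ L.ys))
        lab-Z₁ : ∀ {v} → v ∈ Z₁ → lab (I v) 0 ys ≡ lab (I v) 0 R.ys
        lab-Z₁ {v} i = Eq.trans (lab-R v) (Eq.trans (cong (lab (I v) 0 R.ys +_) (lab-0 (I v) _ (inn ++ L.ys) (Z₁-rest i))) (+-identityʳ _))
        -- The edges at `y` that do not touch `Z₁` are the later ones counted by `c` in `R.below`;
        -- their actual labels exceed `length R.ys`.
        Z₁<Y : ∀ {v y} → v ∈ Z₁ → y ∈ Y → lab (I v) 0 ys < lab (I y) 0 ys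
        Z₁<Y {v} {y} i j = begin-strict
          lab (I v) 0 ys                  ≡⟨ lab-Z₁ i ⟩
          lab (I v) 0 R.ys                <⟨ R.below (Σl (I y) (inn ++ L.ys)) i j
              (Eq.trans (sym (Σl-++ (I y) R.ys (inn ++ L.ys))) (Eq.trans (cong (Σl (I y)) (sym ys≡)) (Eq.trans (sym (Σl-↭ (I y) perm′)) (touching-degree (Y⊆Z j))))) ⟩
          lab (I y) 0 R.ys + Σl (I y) (inn ++ L.ys) * suc (length R.ys) ≤⟨ +-monoʳ-≤ (lab (I y) 0 R.ys) (lab-≥ (I y) (length R.ys) (inn ++ L.ys)) ⟩
          lab (I y) 0 R.ys + lab (I y) (length R.ys) (inn ++ L.ys) ≡⟨ sym (lab-R y) ⟩
          lab (I y) 0 ys                  ∎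
          where open ≤-Reasoning
        dist : ∀ {v v′} → v ∈ Z → v′ ∈ Z → v ≢ v′ → lab (I v) 0 ys ≢ lab (I v′) 0 ys
        dist i j n q with splitZ i | splitZ j
        ... | inj₁ a | inj₁ b = R.distinct a b n (Eq.trans (sym (lab-Z₁ a)) (Eq.trans q (lab-Z₁ b)))
        ... | inj₁ a | inj₂ b = <⇒≢ (Z₁<Y a b) q
        ... | inj₂ a | inj₁ b = <⇒≢ (Z₁<Y b a) (sym q)
        ... | inj₂ a | inj₂ b = L.distinct a b n (Eq.trans (sym (lab-Y a)) (Eq.trans q (lab-Y b)))
        belY : ∀ {v u} c → v ∈ Y → u ∈ P → Σl (I u) ys + c ≡ d → lab (I v) 0 ys < lab (I u) 0 ys + c * suc (length ys)
        belY {v} {u} c i j h = subst₂ _<_ (sym (lab-Y i)) (cong₂ (λ a b → a + c * suc b) (sym (lab-P j)) lenys)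
          (L.below c i j (Eq.trans (cong (_+ c) (sym (Σ-P j))) h))
        bel : ∀ {v u} c → v ∈ Z → u ∈ P → Σl (I u) ys + c ≡ d → lab (I v) 0 ys < lab (I u) 0 ys + c * suc (length ys)
        bel c i j h with splitZ i
        ... | inj₂ a = belY c a j h
        -- A vertex farther down is compared with `P` through any vertex of `Y`, which must
        -- therefore be nonempty.
        ... | inj₁ a = <-trans (Z₁<Y a y₀∈) (belY c y₀∈ j h)

  labelled : ∀ N P Z → length Z ≤ N → Front P Z → Labelled P Z
  labelled N P Z len F with filter (adj? P) Z in eq
  ... | y ∷ ys = next N len
    where
    open NextLevel F
    y∈ : y ∈ Y
    y∈ = subst (y ∈_) (sym eq) (here refl)
    shorter : suc (length Z₁) ≤ length Z
    shorter = filter-notAll (λ z → ¬? (adj? P z)) Z (lose (Y⊆Z y∈) (λ n → n (Y-adj y∈)))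
    next : ∀ N → length Z ≤ N → Labelled P Z
    next zero    len with () ← ≤-trans shorter len
    next (suc N) len = step y y∈ (labelled N Y Z₁ (≤-pred (≤-trans shorter len)) front)
  labelled N P [] len F | [] = record { ys = touching [] ; perm = ↭-refl ; distinct = λ () ; below = λ _ () }
  labelled (suc N) P (z ∷ Z) (s≤s len) F | [] = step (labelled N (z ∷ []) Z len front)
    where
    none : ∀ {x} → x ∈ z ∷ Z → ¬ Adj P x
    none i a with () ← subst (_ ∈_) eq (∈-filter⁺ (adj? P) i a)
    open NewRoot F none using (step; front)

  -- From the list of edges to a bijective labelling

  record Numbering : Set where
    field
      ys       : List E
      perm     : edges ↭ ys
      distinct : ∀ {v v′} → v ≢ v′ → lab (I v) 0 ys ≢ lab (I v′) 0 ys

  numbering : V ⊎ ¬ V → Numbering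
  numbering (inj₂ none) = record { ys = edges ; perm = ↭-refl ; distinct = λ {v} _ → ⊥-elim (none v) }
  numbering (inj₁ r) = record { ys = ys ; perm = perm′ ; distinct = λ {v} {v′} → dist v v′ }
    where
    other? : ∀ v → Dec (v ≢ r)
    other? v = ¬? (v ≟ r)
    Z : List V
    Z = filter other? (allFin (n G))
    Z⁺ : ∀ {v} → v ≢ r → v ∈ Z
    Z⁺ {v} p = ∈-filter⁺ other? (∈-allFin v) p
    side : ∀ v → v ∈ Z ⊎ v ∈ r ∷ []
    side v with v ≟ r
    ... | yes p = inj₂ (here p)
    ... | no p  = inj₁ (Z⁺ p)
    front : Front (r ∷ []) Z
    front = record
      { P! = [] ∷ [] ; Z! = Uniqueₚ.filter⁺ other? (Uniqueₚ.allFin⁺ (n G))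
      ; disjoint = λ { (here refl) j → proj₂ (∈-filter⁻ other? {xs = allFin (n G)} j) refl }
      ; closed = λ {e} _ → side (fst e) , side (snd e)
      ; anchored = inj₁ (r , refl) }
    open Labelled (labelled (length Z) (r ∷ []) Z ≤-refl front)
    -- Only `r` is outside `Z`, and an edge has two distinct ends; so the edges touching `Z` are all
    -- the edges.
    every : ∀ e → Touch Z e
    every e with fst e ≟ r
    ... | yes p = inj₂ (Z⁺ (λ q → loopless G e (Eq.trans p (sym q))))
    ... | no p  = inj₁ (Z⁺ p)
    perm′ : edges ↭ ys
    perm′ = subst (_↭ ys) (filter-all (touch? Z) (All.universal every edges)) perm
    r> : ∀ {v} → v ≢ r → lab (I v) 0 ys < lab (I r) 0 ys
    r> p = ≤-trans (below 0 (Z⁺ p) (here refl) (Eq.trans (+-identityʳ _) (Eq.trans (sym (Σl-↭ (I r) perm′)) (degree≡ r)))) (≤-reflexive (+-identityʳ _))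
    dist : ∀ v v′ → v ≢ v′ → lab (I v) 0 ys ≢ lab (I v′) 0 ys
    dist v v′ p q with v ≟ r | v′ ≟ r
    ... | yes refl | yes refl = p refl
    ... | yes refl | no b     = <⇒≢ (r> b) (sym q)
    ... | no a     | yes refl = <⇒≢ (r> a) q
    ... | no a     | no b     = distinct (Z⁺ a) (Z⁺ b) p q

  module Positions where

    pos : E → List E → ℕ
    pos e []       = 0
    pos e (x ∷ xs) = if ⌊ e ≟ x ⌋ then 0 else suc (pos e xs)

    pos-< : ∀ {e xs} → e ∈ xs → pos e xs < length xs
    pos-< {e} {x ∷ xs} i with e ≟ x | i
    ... | yes _ | _       = s≤s z≤n
    ... | no p  | here q  = ⊥-elim (p q)
    ... | no _  | there j = s≤s (pos-< j)

    pos-injective : ∀ {e e′ xs} → e ∈ xs → e′ ∈ xs → pos e xs ≡ pos e′ xs → e ≡ e′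
    pos-injective {e} {e′} {x ∷ xs} i j q with e ≟ x | e′ ≟ x | i | j
    ... | yes p | yes p′ | _       | _        = Eq.trans p (sym p′)
    ... | no p  | _      | here r  | _        = ⊥-elim (p r)
    ... | no _  | no p   | there _ | here r   = ⊥-elim (p r)
    ... | no _  | no _   | there i | there j  = pos-injective i j (suc-injective q)
    pos-injective {e} {e′} {x ∷ xs} i j () | yes p | no p′ | _ | _
    pos-injective {e} {e′} {x ∷ xs} i j () | no _  | yes p | there _ | _

    pos-surjective : ∀ {xs i} → Unique xs → i < length xs → Σ[ e ∈ E ] (e ∈ xs × pos e xs ≡ i)
    pos-surjective {x ∷ xs} {zero} _ _ = x , here refl , p0
      where
      p0 : pos x (x ∷ xs) ≡ 0
      p0 with x ≟ x
      ... | yes _ = refl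
      ... | no n  = ⊥-elim (n refl)
    pos-surjective {x ∷ xs} {suc i} (p ∷ u) (s≤s lt) with pos-surjective u lt
    ... | e , e∈ , refl = e , there e∈ , ps
      where
      ps : pos e (x ∷ xs) ≡ suc (pos e xs)
      ps with e ≟ x
      ... | yes refl = ⊥-elim (All.lookup p e∈ refl)
      ... | no _     = refl

    lab-pos : ∀ (g : E → ℕ) s {xs} → Unique xs → Σl (λ e → g e * suc (s + pos e xs)) xs ≡ lab g s xs
    lab-pos g s [] = refl
    lab-pos g s {x ∷ xs} (p ∷ u) = cong₂ _+_ hd (Eq.trans (Σl-cong (All.map tl p)) (lab-pos g (suc s) u))
      where
      hd : g x * suc (s + pos x (x ∷ xs)) ≡ g x * suc s
      hd with x ≟ x
      ... | yes _ = cong (λ i → g x * suc i) (+-identityʳ s)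
      ... | no n  = ⊥-elim (n refl)
      tl : ∀ {e} → x ≢ e → g e * suc (s + pos e (x ∷ xs)) ≡ g e * suc (suc s + pos e xs)
      tl {e} n with e ≟ x
      ... | yes q = ⊥-elim (n (sym q))
      ... | no _  = cong (λ i → g e * suc i) (+-suc s (pos e xs))

  antimagic : Antimagic G
  antimagic = mk⤖ {to = f} (inj , surj) , anti
    where
    open Positions
    vertex? : ∀ n → Fin n ⊎ ¬ Fin n
    vertex? zero    = inj₂ λ ()
    vertex? (suc n) = inj₁ Fin.zero
    open Numbering (numbering (vertex? (n G)))
    ys! : Unique ys
    ys! = Unique-↭ perm (Uniqueₚ.allFin⁺ (m G))
    len : length ys ≡ m G
    len = Eq.trans (sym (↭-length perm)) (length-tabulate (λ i → i))
    ys∋ : ∀ e → e ∈ ys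
    ys∋ e = ∈-resp-↭ perm (∈-allFin e)
    lt : ∀ e → pos e ys < m G
    lt e = <-≤-trans (pos-< (ys∋ e)) (≤-reflexive len)
    f : E → E
    f e = fromℕ< (lt e)
    toℕ-f : ∀ e → toℕ (f e) ≡ pos e ys
    toℕ-f e = toℕ-fromℕ< (lt e)
    inj : ∀ {x y} → f x ≡ f y → x ≡ y
    inj {x} {y} q = pos-injective (ys∋ x) (ys∋ y) (Eq.trans (sym (toℕ-f x)) (Eq.trans (cong toℕ q) (toℕ-f y)))
    surj : ∀ y → Σ[ x ∈ E ] (∀ {z} → z ≡ x → f z ≡ y)
    surj y with pos-surjective ys! (<-≤-trans (toℕ<n y) (≤-reflexive (sym len)))
    ... | e , e∈ , q = e , λ { refl → toℕ-injective (Eq.trans (toℕ-f e) q) }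
    sum≡ : ∀ v → vertexSum G f v ≡ lab (I v) 0 ys
    sum≡ v = Eq.trans (sym (Σl-tabulate (λ e → if incident G e v then suc (toℕ (f e)) else 0) (m G) (λ i → i)))
      (Eq.trans (Σl-cong′ pt edges) (Eq.trans (Σl-↭ (λ e → I v e * suc (pos e ys)) perm) (lab-pos (I v) 0 ys!)))
      where
      pt : ∀ e → (if incident G e v then suc (toℕ (f e)) else 0) ≡ I v e * suc (pos e ys)
      pt e with incident G e v
      ... | true  = cong suc (Eq.trans (toℕ-f e) (sym (+-identityʳ _)))
      ... | false = refl
    anti : IsAntimagicLabeling G (mk⤖ {to = f} (inj , surj))
    anti u v p q = distinct p (Eq.trans (sym (sum≡ u)) (Eq.trans q (sum≡ v)))

theorem3p1 : (k : ℕ) → k ≥ 1 → (G : Graph) → Regular (2 * k + 2) G → Antimagic G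
theorem3p1 k k≥1 G reg = Main.antimagic G k k≥1 reg
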